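{- Let $n$ and $r$ be positive integers with $n\equiv 3\pmod{4}$. Then, modulo $\Phi_{n^{2r}}(q)^2\prod_{j=1}^{r}\Phi_{n^{2j-1}}(q)^2$, \[ \sum_{k=0}^{(n^{2r}-1)/2}\frac{(1+q^{4k+1})(q^2;q^4)_k^3}{(1+q)(q^4;q^4)_k^3}q^k \equiv \frac{[n^{2r}]_{q^2}(q^3;q^4)_{(n^{2r}-1)/2}}{(q^5;q^4)_{(n^{2r}-1)/2}}\, q^{(1-n^{2r})/2}, \] and \[ \sum_{k=0}^{n^{2r}-1}\frac{(1+q^{4k+1})(q^2;q^4)_k^3}{(1+q)(q^4;q^4)_k^3}q^k \equiv \frac{[n^{2r}]_{q^2}(q^3;q^4)_{(n^{2r}-1)/2}}{(q^5;q^4)_{(n^{2r}-1)/2}}\, q^{(1-n^{2r})/2}. \]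
   Context: The $q$-shifted factorial is $(a;q)_0=1$ and $(a;q)_k=(1-a)(1-aq)\cdots(1-aq^{k-1})$ for $k\geqslant 1$. The $q$-integer is $[N]_q=1+q+\cdots+q^{N-1}$, so $[N]_{q^2}=1+q^2+\cdots+q^{2(N-1)}$. $\Phi_N(q)$ denotes the $N$-th cyclotomic polynomial. For rational functions $A(q),B(q)$, $A(q)\equiv B(q)\pmod{P(q)}$ means that $A(q)-B(q)=P(q)\,U(q)/V(q)$ with polynomials $U,V$ and $V(q)$ relatively prime to $P(q)$. -}

module Defs where

open import Data.Nat as ℕ using (ℕ; zero; suc; _<ᵇ_)
open import Data.Nat.Divisibility using (_∣?_)
open import Data.Integer as ℤ using (ℤ; +_)
open import Data.List as List using (List; []; _∷_; _++_; map; foldr; replicate; length; reverse; filter; applyUpTo)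
open import Data.Product using (_×_; _,_; ∃-syntax)
open import Data.Bool using (if_then_else_)
open import Relation.Binary.PropositionalEquality using (_≡_; _≢_)

-- Polynomials in q with integer coefficients, as coefficient lists
-- (lowest degree first; trailing zeros allowed).

Poly : Set
Poly = List ℤ

cons0 : ℤ → Poly → Poly
cons0 (+ 0) [] = []
cons0 x     ys = x ∷ ys

strip : Poly → Poly
strip []       = []
strip (x ∷ xs) = cons0 x (strip xs)

infix 4 _≈ₚ_
_≈ₚ_ : Poly → Poly → Set
f ≈ₚ g = strip f ≡ strip g

constₚ : ℤ → Poly
constₚ c = c ∷ []

oneₚ : Poly
oneₚ = constₚ (+ 1)

X^ : ℕ → Poly
X^ k = replicate k (+ 0) ++ (+ 1 ∷ [])

infixl 6 _+ₚ_ _-ₚ_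
infixl 7 _*ₚ_

_+ₚ_ : Poly → Poly → Poly
[]       +ₚ g        = g
(a ∷ f)  +ₚ []       = a ∷ f
(a ∷ f)  +ₚ (b ∷ g)  = (a ℤ.+ b) ∷ (f +ₚ g)

negₚ : Poly → Poly
negₚ = map (λ x → ℤ.- x)

_-ₚ_ : Poly → Poly → Poly
f -ₚ g = f +ₚ negₚ g

scaleₚ : ℤ → Poly → Poly
scaleₚ c = map (c ℤ.*_)

_*ₚ_ : Poly → Poly → Poly
[]      *ₚ g = []
(a ∷ f) *ₚ g = scaleₚ a g +ₚ (+ 0 ∷ (f *ₚ g))

_^ₚ_ : Poly → ℕ → Poly
f ^ₚ zero  = oneₚ
f ^ₚ suc k = f *ₚ (f ^ₚ k)

prodₚ : List Poly → Poly
prodₚ = foldr _*ₚ_ oneₚ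

prodFrom1 : ℕ → (ℕ → Poly) → Poly
prodFrom1 zero    f = oneₚ
prodFrom1 (suc r) f = prodFrom1 r f *ₚ f (suc r)

-- divisibility in ℚ[q]:  d ∣ f  iff  c·f = d·g  for some nonzero integer c
-- and some g ∈ ℤ[q]
_∣ₚ_ : Poly → Poly → Set
d ∣ₚ f = ∃[ c ] ∃[ g ] (c ≢ + 0 × (constₚ c *ₚ f ≈ₚ d *ₚ g))

IsConst : Poly → Set
IsConst d = ∃[ c ] (d ≈ₚ constₚ c)

Coprimeₚ : Poly → Poly → Set
Coprimeₚ f g = ∀ d → d ∣ₚ f → d ∣ₚ g → IsConst d

private
  subPrefix : List ℤ → List ℤ → List ℤ
  subPrefix (x ∷ xs) (y ∷ ys) = (x ℤ.- y) ∷ subPrefix xs ys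
  subPrefix xs       []       = xs
  subPrefix []       (y ∷ ys) = []

  -- high-degree-first long division by 1·q^d + (gt), with fuel
  quotHF : ℕ → List ℤ → List ℤ → List ℤ
  quotHF zero    gt f = []
  quotHF (suc k) gt [] = []
  quotHF (suc k) gt (c ∷ rest) =
    if length rest <ᵇ length gt then []
    else c ∷ quotHF k gt (subPrefix rest (map (c ℤ.*_) gt))

  tailL : List ℤ → List ℤ
  tailL []       = []
  tailL (_ ∷ xs) = xs

divMonic : Poly → Poly → Poly
divMonic f g =
  reverse (quotHF (length f) (tailL (reverse (strip g))) (reverse (strip f)))

-- Cyclotomic polynomials, by the standard recursion
--   Φ_N(q) = (q^N - 1) / ∏_{d ∣ N, d < N} Φ_d(q)     (N ≥ 1)

cycFuel : ℕ → ℕ → Poly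
cycFuel zero    N = oneₚ
cycFuel (suc f) N =
  divMonic (X^ N -ₚ oneₚ)
           (prodₚ (map (cycFuel f) (filter (_∣? N) (applyUpTo suc (N ℕ.∸ 1)))))

Φ : ℕ → Poly
Φ N = cycFuel N N

qPoch : ℕ → ℕ → ℕ → Poly
qPoch a b zero    = oneₚ
qPoch a b (suc k) = qPoch a b k *ₚ (oneₚ -ₚ X^ (a ℕ.+ b ℕ.* k))

qInt2 : ℕ → Poly
qInt2 zero    = []
qInt2 (suc N) = qInt2 N +ₚ X^ (2 ℕ.* N)

-- Rational functions as (numerator , denominator)

RatF : Set
RatF = Poly × Poly

_+ᵣ_ : RatF → RatF → RatF
(a , b) +ᵣ (c , d) = ((a *ₚ d) +ₚ (c *ₚ b)) , (b *ₚ d)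

sumTo : ℕ → (ℕ → RatF) → RatF
sumTo zero    t = t 0
sumTo (suc M) t = sumTo M t +ᵣ t (suc M)

-- A ≡ B (mod P):  A - B = P·U/V with V relatively prime to P
_≡_[modₚ_] : RatF → RatF → Poly → Set
(a₁ , a₂) ≡ (b₁ , b₂) [modₚ P ] =
  ∃[ U ] ∃[ V ] (Coprimeₚ V P ×
     (((a₁ *ₚ b₂) -ₚ (b₁ *ₚ a₂)) *ₚ V ≈ₚ (P *ₚ U) *ₚ (a₂ *ₚ b₂)))

term : ℕ → RatF
term k = ((oneₚ +ₚ X^ (4 ℕ.* k ℕ.+ 1)) *ₚ (qPoch 2 4 k ^ₚ 3) *ₚ X^ k)
       , ((oneₚ +ₚ X^ 1) *ₚ (qPoch 4 4 k ^ₚ 3))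

-- [N]_{q^2} (q^3;q^4)_m / (q^5;q^4)_m · q^{-m},  m = (N-1)/2
rhs : ℕ → ℕ → RatF
rhs N m = (qInt2 N *ₚ qPoch 3 4 m) , (qPoch 5 4 m *ₚ X^ m)

{-# OPTIONS --safe #-}
module Submission where

-- Write (x)ₖ for (x;q⁴)ₖ.  With (aq²)ₖ(q²/a)ₖ/((aq⁴)ₖ(q⁴/a)ₖ) in place of
-- ((q²)ₖ/(q⁴)ₖ)² the summands become tₖ(a), the terms of a truncated
-- very-well-poised series, and a limiting case of Watson's transformation reads
--   ∑_{k≤m} tₖ(a) = ∑_{j≤m} F(m,j),
--   F(m,j) = (q⁶)ₘ(q⁶/a)ₘ/((q⁴/a)ₘ(q⁵)ₘ) · (q³/a)ₘ₋ⱼ/(q⁶/a)ₘ₋ⱼ · (aq²)ⱼ(q)ⱼqʲ/((q⁴)ⱼ(aq⁴)ⱼ);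
-- it holds because F(m+1,j) − F(m,j) telescopes in j.
-- Let N = n^{2r} = 2m + 1.  For a = q^{2N} only the term j = 0 survives, and it
-- is the right-hand side of the theorem.  Since tₖ(a) depends on a + 1/a only,
-- tₖ(1) ≡ tₖ(q^{2N}) modulo (1 − q^{2N})², which settles the modulus Φ_N².
-- For a = 1, d = n^{2j-1} ≡ 3 (mod 4) and m ≡ (d−1)/2 (mod d), counting the
-- factors divisible by Φ_d shows that every F(m,j), and the right-hand side, is
-- divisible by Φ_d².  The terms with k mod d > (d−1)/2 are divisible by Φ_d³, so
-- the longer sum may be truncated to such an m as well.
-- Irreducibility of Φ_d is never needed: d ∤ k makes 1 − q^k coprime to Φ_d in
-- the sense of a Bézout identity with a nonzero integer on the right.

open import Defs
open import Algebra.Bundles using (CommutativeRing)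
open import Algebra.Morphism.Structures using (module RingMorphisms)
open import Data.Integer.Base as ℤ using (ℤ; +_; -[1+_])
import Data.Integer.Properties as ℤ
open import Data.Nat.Base as ℕ using (ℕ; zero; suc)
import Data.Nat.Properties as ℕ
open import Data.Product.Base using (_×_; _,_; proj₁; proj₂; ∃-syntax)
open import Data.Sum.Base as Sum using (_⊎_; inj₁; inj₂)
open import Level using (Level; _⊔_; 0ℓ)
import Relation.Binary.Reasoning.Setoid as SetoidReasoning
open import Relation.Binary.PropositionalEquality as ≡ using (_≡_; _≢_; cong)
open import Relation.Nullary.Decidable using (Dec; yes; no)
open import Relation.Nullary.Negation using (¬_; contradiction)

-- Two mechanisms are used because neither covers the whole modulus. Comparing a = 1 with a = q^{2N}
-- works summand by summand, so the denominators (q⁴;q⁴)ₖ with k ≤ m must be coprime to the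
-- cyclotomic polynomial. For Φ_N they are, since N divides no 4i with 0 < i ≤ m; for a smaller d
-- this fails as soon as k ≥ d. Counting factors succeeds for d ≡ 3 (mod 4) but not at N, which is 1
-- modulo 4: there 1 - q^N occurs in (q⁵;q⁴)ₘ, it cancels the factor 1 - q^{2N} of [N]_{q²}, and the
-- right-hand side is not divisible by Φ_N at all. Residue rings are avoided. A congruence is an
-- exact identity x v = P u in the field of fractions of ℤ[q], with v coprime to P in the Bézout
-- sense. Sums and products of such identities give the local statements at each Φ_d, and Bézout
-- identities between the Φ_d multiply the local moduli together.

module _ {c ℓ : Level} (R : CommutativeRing c ℓ) where
  open CommutativeRing R
  open import Algebra.Properties.Semiring.Exp semiring using (_^_)

  NonTrivial : Set ℓ
  NonTrivial = ¬ 1# ≈ 0#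

  NoZeroDivisors : Set (c ⊔ ℓ)
  NoZeroDivisors = ∀ {x y} → ¬ x ≈ 0# → ¬ y ≈ 0# → ¬ x * y ≈ 0#

  RightCancellative : Set (c ⊔ ℓ)
  RightCancellative = ∀ {x y z} → ¬ z ≈ 0# → x * z ≈ y * z → x ≈ y

  IsInverse : (Carrier → Carrier) → Set (c ⊔ ℓ)
  IsInverse inv = ∀ {x} → ¬ x ≈ 0# → x * inv x ≈ 1#

  NotRootOfUnity : Carrier → Set ℓ
  NotRootOfUnity q = ∀ n → 0 ℕ.< n → ¬ q ^ n - 1# ≈ 0#

-- Integers in a commutative ring, and the ring solver with integer coefficients

module IntegerCoefficients {c ℓ : Level} (R : CommutativeRing c ℓ) where

  open CommutativeRing R
  open import Algebra.Properties.Ring ring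
  open import Algebra.Properties.AbelianGroup +-abelianGroup using (⁻¹-∙-comm; ⁻¹-involutive; ε⁻¹≈ε)
  open import Algebra.Properties.Semiring.Mult.TCOptimised semiring using (×-homo-+; ×1-homo-*; 1+×) renaming (_×_ to _·_)
  open import Algebra.Solver.Ring.AlmostCommutativeRing using (fromCommutativeRing; _-Raw-AlmostCommutative⟶_)
  open import Data.Maybe.Base using (Maybe; just; nothing)
  open import Relation.Binary.Reasoning.Setoid setoid
  import Algebra.Solver.Ring as RingSolver

  private
    neg-+ : ∀ x y → - (x + y) ≈ - x + - y
    neg-+ x y = sym (⁻¹-∙-comm x y)

  fromℤ : ℤ → Carrier
  fromℤ (+ n)    = n · 1#
  fromℤ -[1+ n ] = - (suc n · 1#)

  fromℤ-⊖ : ∀ m n → fromℤ (m ℤ.⊖ n) ≈ m · 1# + - (n · 1#)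
  fromℤ-⊖ m zero = sym (trans (+-congˡ ε⁻¹≈ε) (+-identityʳ _))
  fromℤ-⊖ zero (suc n) = sym (+-identityˡ _)
  fromℤ-⊖ (suc m) (suc n) = begin
    fromℤ (suc m ℤ.⊖ suc n)                       ≡⟨ ≡.cong fromℤ (ℤ.[1+m]⊖[1+n]≡m⊖n m n) ⟩
    fromℤ (m ℤ.⊖ n)                               ≈⟨ fromℤ-⊖ m n ⟩
    m · 1# + - (n · 1#)                           ≈⟨ +-congʳ (+-identityʳ _) ⟨
    m · 1# + 0# + - (n · 1#)                      ≈⟨ +-congʳ (+-congˡ (-‿inverseʳ 1#)) ⟨
    m · 1# + (1# + - 1#) + - (n · 1#)             ≈⟨ +-congʳ (+-assoc _ _ _) ⟨
    m · 1# + 1# + - 1# + - (n · 1#)               ≈⟨ +-assoc _ _ _ ⟩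
    m · 1# + 1# + (- 1# + - (n · 1#))             ≈⟨ +-cong (+-comm _ _) (sym (neg-+ _ _)) ⟩
    1# + m · 1# + - (1# + n · 1#)                 ≈⟨ +-cong (1+× m 1#) (-‿cong (1+× n 1#)) ⟨
    suc m · 1# + - (suc n · 1#)                   ∎

  fromℤ-neg : ∀ i → fromℤ (ℤ.- i) ≈ - fromℤ i
  fromℤ-neg (+ zero)  = sym ε⁻¹≈ε
  fromℤ-neg (+ suc n) = refl
  fromℤ-neg -[1+ n ]  = sym (⁻¹-involutive _)

  fromℤ-+ : ∀ i j → fromℤ (i ℤ.+ j) ≈ fromℤ i + fromℤ j
  fromℤ-+ (+ m)    (+ n)    = ×-homo-+ 1# m n
  fromℤ-+ (+ m)    -[1+ n ] = fromℤ-⊖ m (suc n)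
  fromℤ-+ -[1+ m ] (+ n)    = trans (fromℤ-⊖ n (suc m)) (+-comm _ _)
  fromℤ-+ -[1+ m ] -[1+ n ] = begin
    - (suc (suc (m ℕ.+ n)) · 1#)       ≡⟨ ≡.cong (λ k → - (suc k · 1#)) (ℕ.+-suc m n) ⟨
    - ((suc m ℕ.+ suc n) · 1#)         ≈⟨ -‿cong (×-homo-+ 1# (suc m) (suc n)) ⟩
    - (suc m · 1# + suc n · 1#)        ≈⟨ neg-+ _ _ ⟩
    - (suc m · 1#) + - (suc n · 1#)    ∎

  private
    fromℤ-pos* : ∀ m i → fromℤ (+ m ℤ.* i) ≈ m · 1# * fromℤ i
    fromℤ-pos* m (+ n) = begin
      fromℤ (+ m ℤ.* + n) ≡⟨ ≡.cong fromℤ (ℤ.pos-* m n) ⟨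
      (m ℕ.* n) · 1#      ≈⟨ ×1-homo-* m n ⟩
      m · 1# * (n · 1#)   ∎
    fromℤ-pos* m -[1+ n ] = begin
      fromℤ (+ m ℤ.* ℤ.- (+ suc n))   ≡⟨ ≡.cong fromℤ (ℤ.neg-distribʳ-* (+ m) (+ suc n)) ⟨
      fromℤ (ℤ.- (+ m ℤ.* + suc n))   ≡⟨ ≡.cong (λ i → fromℤ (ℤ.- i)) (ℤ.pos-* m (suc n)) ⟨
      fromℤ (ℤ.- (+ (m ℕ.* suc n)))   ≈⟨ fromℤ-neg (+ (m ℕ.* suc n)) ⟩
      - ((m ℕ.* suc n) · 1#)          ≈⟨ -‿cong (×1-homo-* m (suc n)) ⟩
      - (m · 1# * (suc n · 1#))       ≈⟨ -‿distribʳ-* _ _ ⟩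
      m · 1# * - (suc n · 1#)         ∎

  fromℤ-* : ∀ i j → fromℤ (i ℤ.* j) ≈ fromℤ i * fromℤ j
  fromℤ-* (+ m) j = fromℤ-pos* m j
  fromℤ-* -[1+ m ] j = begin
    fromℤ (ℤ.- (+ suc m) ℤ.* j)   ≡⟨ ≡.cong fromℤ (ℤ.neg-distribˡ-* (+ suc m) j) ⟨
    fromℤ (ℤ.- (+ suc m ℤ.* j))   ≈⟨ fromℤ-neg (+ suc m ℤ.* j) ⟩
    - fromℤ (+ suc m ℤ.* j)       ≈⟨ -‿cong (fromℤ-pos* (suc m) j) ⟩
    - (suc m · 1# * fromℤ j)      ≈⟨ -‿distribˡ-* _ _ ⟩
    - (suc m · 1#) * fromℤ j      ∎

  private
    fromℤ-homomorphism : CommutativeRing.rawRing ℤ.+-*-commutativeRing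
                         -Raw-AlmostCommutative⟶ fromCommutativeRing R
    fromℤ-homomorphism = record
      { ⟦_⟧    = fromℤ
      ; +-homo = fromℤ-+
      ; *-homo = fromℤ-*
      ; -‿homo = fromℤ-neg
      ; 0-homo = refl
      ; 1-homo = refl
      }

    _coeff≟_ : ∀ i j → Maybe (fromℤ i ≈ fromℤ j)
    i coeff≟ j with i ℤ.≟ j
    ... | yes ≡.refl = just refl
    ... | no _       = nothing

  open RingSolver _ _ fromℤ-homomorphism _coeff≟_ public
    using (Polynomial; solve; con; _:=_; _:+_; _:*_; _:-_; :-_; _:^_)

-- Basic hypergeometric series over a field

module Hypergeometric {c ℓ : Level} (K : CommutativeRing c ℓ)
  (inv : CommutativeRing.Carrier K → CommutativeRing.Carrier K) (inverseʳ : IsInverse K inv) where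

  open CommutativeRing K

  open import Algebra.Properties.Semiring.Exp semiring using (_^_; ^-homo-*)
  open import Relation.Binary.Reasoning.Setoid setoid
  open IntegerCoefficients K

  ∏ : (ℕ → Carrier) → ℕ → Carrier
  ∏ f zero    = 1#
  ∏ f (suc n) = ∏ f n * f n

  ∏[_,_] : ℕ → ℕ → (ℕ → Carrier) → Carrier
  ∏[ l , zero  ] f = 1#
  ∏[ l , suc k ] f = f l * ∏[ suc l , k ] f

  ∑≤ : ℕ → (ℕ → Carrier) → Carrier
  ∑≤ zero    f = f 0
  ∑≤ (suc n) f = ∑≤ n f + f (suc n)

  ∑≤-head : ∀ n {f} → (∀ k → 0 ℕ.< k → k ℕ.≤ n → f k ≈ 0#) → ∑≤ n f ≈ f 0
  ∑≤-head zero    f≈0 = refl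
  ∑≤-head (suc n) f≈0 = trans
    (+-cong (∑≤-head n (λ k k>0 k≤n → f≈0 k k>0 (ℕ.m≤n⇒m≤1+n k≤n))) (f≈0 (suc n) ℕ.z<s ℕ.≤-refl))
    (+-identityʳ _)

  ∏[]-snoc : ∀ l k f → ∏[ l , suc k ] f ≈ ∏[ l , k ] f * f (l ℕ.+ k)
  ∏[]-snoc l zero f = begin
    f l * 1#             ≈⟨ *-comm _ _ ⟩
    1# * f l             ≡⟨ ≡.cong (λ i → 1# * f i) (≡.sym (ℕ.+-identityʳ l)) ⟩
    1# * f (l ℕ.+ 0)     ∎
  ∏[]-snoc l (suc k) f = begin
    f l * ∏[ suc l , suc k ] f                 ≈⟨ *-congˡ (∏[]-snoc (suc l) k f) ⟩
    f l * (∏[ suc l , k ] f * f (suc l ℕ.+ k)) ≡⟨ ≡.cong (λ i → f l * (∏[ suc l , k ] f * f i)) (≡.sym (ℕ.+-suc l k)) ⟩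
    f l * (∏[ suc l , k ] f * f (l ℕ.+ suc k)) ≈⟨ *-assoc _ _ _ ⟨
    ∏[ l , suc k ] f * f (l ℕ.+ suc k)         ∎

  ∏-∏[] : ∀ l k f → ∏ f l * ∏[ l , k ] f ≈ ∏ f (l ℕ.+ k)
  ∏-∏[] l zero f = trans (*-identityʳ _) (reflexive (≡.cong (∏ f) (≡.sym (ℕ.+-identityʳ l))))
  ∏-∏[] l (suc k) f = begin
    ∏ f l * (f l * ∏[ suc l , k ] f)  ≈⟨ *-assoc _ _ _ ⟨
    ∏ f (suc l) * ∏[ suc l , k ] f    ≈⟨ ∏-∏[] (suc l) k f ⟩
    ∏ f (suc l ℕ.+ k)                 ≡⟨ ≡.cong (∏ f) (ℕ.+-suc l k) ⟨
    ∏ f (l ℕ.+ suc k)                 ∎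

  ∏[]0 : ∀ k f → ∏[ 0 , k ] f ≈ ∏ f k
  ∏[]0 k f = trans (sym (*-identityˡ _)) (∏-∏[] 0 k f)

  ∏-cong : ∀ {f g} → (∀ i → f i ≈ g i) → ∀ k → ∏ f k ≈ ∏ g k
  ∏-cong f≈g zero    = refl
  ∏-cong f≈g (suc k) = *-cong (∏-cong f≈g k) (f≈g k)

  nonzero⇒1≉0 : ∀ {x} → ¬ x ≈ 0# → ¬ 1# ≈ 0#
  nonzero⇒1≉0 {x} x≉0 1≈0 = x≉0 (begin
    x       ≈⟨ *-identityˡ x ⟨
    1# * x  ≈⟨ *-congʳ 1≈0 ⟩
    0# * x  ≈⟨ zeroˡ x ⟩
    0#      ∎)

  inverseˡ : ∀ {x} y → ¬ x ≈ 0# → y * inv x * x ≈ y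
  inverseˡ {x} y x≉0 = begin
    y * inv x * x    ≈⟨ *-assoc _ _ _ ⟩
    y * (inv x * x)  ≈⟨ *-congˡ (trans (*-comm _ _) (inverseʳ x≉0)) ⟩
    y * 1#           ≈⟨ *-identityʳ y ⟩
    y                ∎

  cancelʳ : ∀ {x y d} → ¬ d ≈ 0# → x * d ≈ y * d → x ≈ y
  cancelʳ {x} {y} {d} d≉0 xd≈yd = begin
    x                ≈⟨ drop x ⟨
    x * d * inv d    ≈⟨ *-congʳ xd≈yd ⟩
    y * d * inv d    ≈⟨ drop y ⟩
    y                ∎
    where
    drop : ∀ z → z * d * inv d ≈ z
    drop z = trans (*-assoc _ _ _) (trans (*-congˡ (inverseʳ d≉0)) (*-identityʳ z))

  *-nonzero : ∀ {x y} → ¬ x ≈ 0# → ¬ y ≈ 0# → ¬ x * y ≈ 0#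
  *-nonzero x≉0 y≉0 xy≈0 = x≉0 (cancelʳ y≉0 (trans xy≈0 (sym (zeroˡ _))))

  ∏-nonzero : ∀ {f} → ¬ 1# ≈ 0# → (∀ i → ¬ f i ≈ 0#) → ∀ k → ¬ ∏ f k ≈ 0#
  ∏-nonzero 1≉0 f≉0 zero    = 1≉0
  ∏-nonzero 1≉0 f≉0 (suc k) = *-nonzero (∏-nonzero 1≉0 f≉0 k) (f≉0 k)

  ∏-quotient : ∀ f {g} → (∀ i → ¬ g i ≈ 0#) → ∀ k →
               ∏ (λ i → f i * inv (g i)) k * ∏ g k ≈ ∏ f k
  ∏-quotient f g≉0 zero    = *-identityʳ 1#
  ∏-quotient f {g} g≉0 (suc k) = begin
    h k * (f k * inv (g k)) * (∏ g k * g k)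
      ≈⟨ solve 5 (λ x y z u v → x :* (y :* z) :* (u :* v) := x :* u :* (y :* z :* v)) refl (h k) (f k) (inv (g k)) (∏ g k) (g k) ⟩
    h k * ∏ g k * (f k * inv (g k) * g k)
      ≈⟨ *-cong (∏-quotient f g≉0 k) (inverseˡ (f k) (g≉0 k)) ⟩
    ∏ f k * f k ∎
    where h = ∏ (λ i → f i * inv (g i))

  -- ⟨ e ⟩ k, ⟨a· e ⟩ k and [a- e ] k are the k-th factors of (q^e;q⁴), of
  -- (a q^e;q⁴) and of (q^e/a;q⁴), the last one multiplied by a.
  module Series (q a : Carrier) where

    x : ℕ → Carrier
    x k = (q * q * q * q) ^ k

    ⟨_⟩ ⟨a·_⟩ [a-_] : ℕ → ℕ → Carrier
    ⟨ e ⟩ k   = 1# - q ^ e * x k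
    ⟨a· e ⟩ k = 1# - a * (q ^ e * x k)
    [a- e ] k = a - q ^ e * x k

    -- The ratio of consecutive summands without the factor 1 + q^{4k+1}. The scaling by a of
    -- `[a-_]` occurs once above and once below, so it cancels.
    ρ : ℕ → Carrier
    ρ i = ⟨a· 2 ⟩ i * [a- 2 ] i * ⟨ 2 ⟩ i * q * inv (⟨a· 4 ⟩ i * [a- 4 ] i * ⟨ 4 ⟩ i)

    -- Very-well-poised in base q⁴ with leading parameter q²: of (1 - q^{8k+2})/(1 - q²) only (1 +
    -- q^{4k+1})/(1 + q) is left, because the parameter q contributes (q)ₖ/(q⁵)ₖ = (1 - q)/(1 -
    -- q^{4k+1}).
    t : ℕ → Carrier
    t k = inv (1# + q) * (1# + q * x k) * ∏ ρ k

    P u : ℕ → Carrier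
    P m = ∏ (λ i → ⟨ 6 ⟩ i * inv ([a- 4 ] i * ⟨ 5 ⟩ i)) m
    u j = ∏ (λ i → ⟨a· 2 ⟩ i * ⟨ 1 ⟩ i * q * inv (⟨ 4 ⟩ i * ⟨a· 4 ⟩ i)) j

    -- Meant for i + j = m. The quotient (q⁶/a)ₘ/(q⁶/a)ᵢ is the partial product
    -- `∏[ i , j ] [a- 6 ]`, which keeps its meaning when (q⁶/a)ₘ vanishes, as it does at a = q^{2N}
    -- for m > 0.
    F : ℕ → ℕ → ℕ → Carrier
    F m i j = P m * ∏ [a- 3 ] i * ∏[ i , j ] [a- 6 ] * u j

    -- The transformation of the truncated sum, by telescoping

    module Identity
      (1+q≉0 : ¬ 1# + q ≈ 0#) (1-q≉0 : ¬ 1# - q ≈ 0#)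
      (4≉0 : ∀ k → ¬ ⟨ 4 ⟩ k ≈ 0#) (5≉0 : ∀ k → ¬ ⟨ 5 ⟩ k ≈ 0#)
      (a4≉0 : ∀ k → ¬ ⟨a· 4 ⟩ k ≈ 0#) (4a≉0 : ∀ k → ¬ [a- 4 ] k ≈ 0#) where

      private
        D₁ D₂ D₃ P′ : ℕ → Carrier
        D₁ m = [a- 4 ] m * ⟨ 5 ⟩ m
        D₂ j = ⟨ 4 ⟩ j * ⟨a· 4 ⟩ j
        D₃ k = ⟨a· 4 ⟩ k * [a- 4 ] k * ⟨ 4 ⟩ k
        P′ m = P m * inv (D₁ m)

        D₁≉0 : ∀ m → ¬ D₁ m ≈ 0#
        D₁≉0 m = *-nonzero (4a≉0 m) (5≉0 m)

        D₂≉0 : ∀ m → ¬ D₂ m ≈ 0#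
        D₂≉0 m = *-nonzero (4≉0 m) (a4≉0 m)

        D₃≉0 : ∀ m → ¬ D₃ m ≈ 0#
        D₃≉0 m = *-nonzero (*-nonzero (a4≉0 m) (4a≉0 m)) (4≉0 m)

        -- `P′ m` is a common factor of `P m` and `P (suc m)` with cofactors free of inverses, so
        -- comparing F(m, ·) with F(m+1, ·) becomes a polynomial identity.
        P≈ : ∀ m → P m ≈ P′ m * D₁ m
        P≈ m = sym (inverseˡ (P m) (D₁≉0 m))

        P-suc : ∀ m → P (suc m) ≈ P′ m * ⟨ 6 ⟩ m
        P-suc m = solve 3 (λ p s i → p :* (s :* i) := p :* i :* s) refl (P m) (⟨ 6 ⟩ m) (inv (D₁ m))

        P′-suc : ∀ m → P′ (suc m) * D₁ (suc m) ≈ P′ m * ⟨ 6 ⟩ m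
        P′-suc m = trans (sym (P≈ (suc m))) (P-suc m)

        u-suc : ∀ j → u (suc j) * D₂ j ≈ u j * (⟨a· 2 ⟩ j * ⟨ 1 ⟩ j * q)
        u-suc j = trans (*-congʳ (sym (*-assoc _ _ _))) (inverseˡ _ (D₂≉0 j))

        v-suc : ∀ k → ∏ ρ (suc k) * D₃ k ≈ ∏ ρ k * (⟨a· 2 ⟩ k * [a- 2 ] k * ⟨ 2 ⟩ k * q)
        v-suc k = trans (*-congʳ (sym (*-assoc _ _ _))) (inverseˡ _ (D₃≉0 k))

        -- With i + j = m, G m i j is the sum of F (suc m) − F m over the indices ≤ j.
        G : ℕ → ℕ → ℕ → Carrier
        G m i j = - (q ^ 3 * x i) * P′ m * u j * ∏[ i , j ] [a- 6 ] * ∏ [a- 3 ] i * (⟨a· 2 ⟩ j * ⟨ 1 ⟩ j)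

        x-+ : ∀ i j → x (i ℕ.+ j) ≈ x i * x j
        x-+ i j = ^-homo-* (q * q * q * q) i j

        one : ∀ {n} → Polynomial n
        one = con (+ 1)

        1-cong : ∀ e {y z} → y ≈ z → 1# - q ^ e * y ≈ 1# - q ^ e * z
        1-cong e y≈z = +-congˡ (-‿cong (*-congˡ y≈z))

        a-cong : ∀ e {y z} → y ≈ z → a - q ^ e * y ≈ a - q ^ e * z
        a-cong e y≈z = +-congˡ (-‿cong (*-congˡ y≈z))

        G-zero : ∀ m → F (suc m) (suc m) 0 ≈ F m m 0 + G m m 0
        G-zero m = begin
          P (suc m) * (A * [a- 3 ] m) * 1# * 1#
            ≈⟨ *-congʳ (*-congʳ (*-congʳ (P-suc m))) ⟩
          P′ m * ⟨ 6 ⟩ m * (A * [a- 3 ] m) * 1# * 1#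
            ≈⟨ solve 5 (λ q a y p b →
                 p :* (one :- q :^ 6 :* y) :* (b :* (a :- q :^ 3 :* y)) :* one :* one
                 := p :* ((a :- q :^ 4 :* y) :* (one :- q :^ 5 :* y)) :* b :* one :* one
                    :+ (:- (q :^ 3 :* y)) :* p :* one :* one :* b
                       :* ((one :- a :* (q :^ 2 :* one)) :* (one :- q :^ 1 :* one)))
                 refl q a (x m) (P′ m) A ⟩
          P′ m * D₁ m * A * 1# * 1# + G m m 0
            ≈⟨ +-congʳ (*-congʳ (*-congʳ (*-congʳ (P≈ m)))) ⟨
          P m * A * 1# * 1# + G m m 0 ∎
          where
          A = ∏ [a- 3 ] m

        -- The telescoping step F(m+1, j+1) - F(m, j+1) = G(j+1) - G(j), written without
        -- subtraction. Once `lem₁` has traded `u j` for `u (suc j)`, all four terms share P′, u and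
        -- the partial products, and what remains is an identity in q, a, q^{4i} and q^{4j}.
        G-suc : ∀ i j → let m = i ℕ.+ suc j in
                G m (suc i) j + F (suc m) (suc i) (suc j) ≈ F m i (suc j) + G m i (suc j)
        G-suc i j = begin
          G m (suc i) j + F (suc m) (suc i) (suc j)
            ≈⟨ +-cong lem₁ lem₂ ⟩
          - (q ^ 2 * x (suc i)) * p * E * A′ * (w * D₂ j)
            + p * ⟨ 6 ⟩ m * A′ * (E * [a- 6 ] (suc i ℕ.+ j)) * w
            ≈⟨ +-congˡ (*-congʳ (*-cong (*-congʳ (*-congˡ (1-cong 6 xm))) (*-congˡ (a-cong 6 xm′)))) ⟩
          - (q ^ 2 * x (suc i)) * p * E * A′ * (w * D₂ j)
            + p * (1# - q ^ 6 * z) * A′ * (E * (a - q ^ 6 * z)) * w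
            ≈⟨ solve 8 (λ q a y s p e b w → let z = y :* (q :* q :* q :* q :* s) in
                 (:- (q :^ 2 :* (q :* q :* q :* q :* y))) :* p :* e :* (b :* (a :- q :^ 3 :* y))
                   :* (w :* ((one :- q :^ 4 :* s) :* (one :- a :* (q :^ 4 :* s))))
                 :+ p :* (one :- q :^ 6 :* z) :* (b :* (a :- q :^ 3 :* y)) :* (e :* (a :- q :^ 6 :* z)) :* w
                 := p :* ((a :- q :^ 4 :* z) :* (one :- q :^ 5 :* z)) :* b :* ((a :- q :^ 6 :* y) :* e) :* w
                 :+ (:- (q :^ 3 :* y)) :* p :* w :* ((a :- q :^ 6 :* y) :* e) :* b
                    :* ((one :- a :* (q :^ 2 :* (q :* q :* q :* q :* s))) :* (one :- q :^ 1 :* (q :* q :* q :* q :* s))))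
                 refl q a (x i) (x j) p E A w ⟩
          p * ((a - q ^ 4 * z) * (1# - q ^ 5 * z)) * A * ([a- 6 ] i * E) * w
            + - (q ^ 3 * x i) * p * w * ([a- 6 ] i * E) * A * (⟨a· 2 ⟩ (suc j) * ⟨ 1 ⟩ (suc j))
            ≈⟨ +-congʳ (*-congʳ (*-congʳ (*-congʳ (*-congˡ (*-cong (a-cong 4 xm) (1-cong 5 xm)))))) ⟨
          p * D₁ m * A * ([a- 6 ] i * E) * w
            + - (q ^ 3 * x i) * p * w * ([a- 6 ] i * E) * A * (⟨a· 2 ⟩ (suc j) * ⟨ 1 ⟩ (suc j))
            ≈⟨ +-congʳ (*-congʳ (*-congʳ (*-congʳ (P≈ m)))) ⟨
          F m i (suc j) + G m i (suc j) ∎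
          where
          m = i ℕ.+ suc j
          p = P′ m
          z = x i * x (suc j)
          xm : x m ≈ z
          xm = x-+ i (suc j)
          xm′ : x (suc i ℕ.+ j) ≈ z
          xm′ = trans (reflexive (≡.cong x (≡.sym (ℕ.+-suc i j)))) xm
          A = ∏ [a- 3 ] i
          A′ = ∏ [a- 3 ] (suc i)
          E = ∏[ suc i , j ] [a- 6 ]
          w = u (suc j)
          lem₁ : G m (suc i) j ≈ - (q ^ 2 * x (suc i)) * p * E * A′ * (w * D₂ j)
          lem₁ = begin
            - (q ^ 3 * x (suc i)) * p * u j * E * A′ * (⟨a· 2 ⟩ j * ⟨ 1 ⟩ j)
              ≈⟨ solve 8 (λ q y p w e a r s →
                   (:- (q :^ 3 :* y)) :* p :* w :* e :* a :* (r :* s)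
                   := (:- (q :^ 2 :* y)) :* p :* e :* a :* (w :* (r :* s :* q)))
                   refl q (x (suc i)) p (u j) E A′ (⟨a· 2 ⟩ j) (⟨ 1 ⟩ j) ⟩
            - (q ^ 2 * x (suc i)) * p * E * A′ * (u j * (⟨a· 2 ⟩ j * ⟨ 1 ⟩ j * q))
              ≈⟨ *-congˡ (u-suc j) ⟨
            - (q ^ 2 * x (suc i)) * p * E * A′ * (w * D₂ j) ∎
          lem₂ : F (suc m) (suc i) (suc j) ≈ p * ⟨ 6 ⟩ m * A′ * (E * [a- 6 ] (suc i ℕ.+ j)) * w
          lem₂ = *-congʳ (*-cong (*-congʳ (P-suc m)) (∏[]-snoc (suc i) j [a- 6 ]))

        partial-sum : ∀ J i → let m = i ℕ.+ J in
          ∑≤ J (λ j → F (suc m) (suc m ℕ.∸ j) j) ≈ ∑≤ J (λ j → F m (m ℕ.∸ j) j) + G m i J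
        partial-sum zero i rewrite ℕ.+-identityʳ i = G-zero i
        partial-sum (suc J) i = begin
          ∑≤ J f + F (suc m) (m ℕ.∸ J) (suc J)
            ≈⟨ +-cong ih (reflexive (≡.cong (λ k → F (suc m) k (suc J)) eq₁)) ⟩
          ∑≤ J g + G m (suc i) J + F (suc m) (suc i) (suc J)
            ≈⟨ +-assoc _ _ _ ⟩
          ∑≤ J g + (G m (suc i) J + F (suc m) (suc i) (suc J))
            ≈⟨ +-congˡ (G-suc i J) ⟩
          ∑≤ J g + (F m i (suc J) + G m i (suc J))
            ≈⟨ +-assoc _ _ _ ⟨
          ∑≤ J g + F m i (suc J) + G m i (suc J)
            ≈⟨ +-congʳ (+-congˡ (reflexive (≡.cong (λ k → F m k (suc J)) eq₂))) ⟨
          ∑≤ (suc J) g + G m i (suc J) ∎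
          where
          m = i ℕ.+ suc J
          f = λ j → F (suc m) (suc m ℕ.∸ j) j
          g = λ j → F m (m ℕ.∸ j) j
          eq₂ : m ℕ.∸ suc J ≡ i
          eq₂ = ℕ.m+n∸n≡m i (suc J)
          eq₁ : m ℕ.∸ J ≡ suc i
          eq₁ = ≡.trans (≡.cong (ℕ._∸ J) (ℕ.+-suc i J)) (ℕ.m+n∸n≡m (suc i) J)
          -- The total m stays fixed during the induction: lowering J by one raises i by one.
          ih : ∑≤ J f ≈ ∑≤ J g + G m (suc i) J
          ih = ≡.subst (λ m → ∑≤ J (λ j → F (suc m) (suc m ℕ.∸ j) j)
                                ≈ ∑≤ J (λ j → F m (m ℕ.∸ j) j) + G m (suc i) J)
                       (≡.sym (ℕ.+-suc i J)) (partial-sum J (suc i))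

        -- The factor common to the boundary value `G m 0 m` and the new term `F (suc m) 0 (suc m)`.
        Y : ℕ → Carrier
        Y m = P′ m * ∏ [a- 6 ] m * u (suc m)

        P′0 : P′ 0 * D₁ 0 ≈ 1#
        P′0 = inverseˡ 1# (D₁≉0 0)

        -- Shifting by q⁴ turns one family of factors into the other: (1 - q²)(q⁶)ₘ = (q²)ₘ₊₁,
        -- likewise with q²/a and q⁶/a, and (q)ₘ₊₁/(q⁵)ₘ₊₁ = (1 - q)/(1 - q^{4m+5}). The correction
        -- factors are kept on both sides in place of divisions.
        Y≈ρ : ∀ m → Y m * ⟨ 1 ⟩ (suc m) * (⟨ 2 ⟩ 0 * [a- 2 ] 0) ≈ ∏ ρ (suc m) * ⟨ 1 ⟩ 0
        Y≈ρ zero = cancelʳ (D₃≉0 0) (begin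
          P′ 0 * 1# * u 1 * ⟨ 1 ⟩ 1 * (⟨ 2 ⟩ 0 * [a- 2 ] 0) * D₃ 0
            ≈⟨ solve 5 (λ q a p w r →
                 p :* one :* w :* (one :- q :^ 1 :* (q :* q :* q :* q :* one)) :* r
                   :* ((one :- a :* (q :^ 4 :* one)) :* (a :- q :^ 4 :* one) :* (one :- q :^ 4 :* one))
                 := (p :* ((a :- q :^ 4 :* one) :* (one :- q :^ 5 :* one)))
                    :* (w :* ((one :- q :^ 4 :* one) :* (one :- a :* (q :^ 4 :* one)))) :* r)
                 refl q a (P′ 0) (u 1) (⟨ 2 ⟩ 0 * [a- 2 ] 0) ⟩
          (P′ 0 * D₁ 0) * (u 1 * D₂ 0) * (⟨ 2 ⟩ 0 * [a- 2 ] 0)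
            ≈⟨ *-congʳ (*-cong P′0 (u-suc 0)) ⟩
          1# * (1# * (⟨a· 2 ⟩ 0 * ⟨ 1 ⟩ 0 * q)) * (⟨ 2 ⟩ 0 * [a- 2 ] 0)
            ≈⟨ solve 5 (λ q b c d e → one :* (one :* (b :* c :* q)) :* (d :* e) := one :* (b :* e :* d :* q) :* c)
                 refl q (⟨a· 2 ⟩ 0) (⟨ 1 ⟩ 0) (⟨ 2 ⟩ 0) ([a- 2 ] 0) ⟩
          1# * (⟨a· 2 ⟩ 0 * [a- 2 ] 0 * ⟨ 2 ⟩ 0 * q) * ⟨ 1 ⟩ 0
            ≈⟨ *-congʳ (v-suc 0) ⟨
          ∏ ρ 1 * D₃ 0 * ⟨ 1 ⟩ 0
            ≈⟨ solve 3 (λ a b c → a :* b :* c := a :* c :* b) refl (∏ ρ 1) (D₃ 0) (⟨ 1 ⟩ 0) ⟩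
          ∏ ρ 1 * ⟨ 1 ⟩ 0 * D₃ 0 ∎)
        Y≈ρ (suc m) = cancelʳ (D₃≉0 (suc m)) (begin
          P′ n * (Πa m * [a- 6 ] m) * u (suc n) * ⟨ 1 ⟩ (suc n) * C * D₃ n
            ≈⟨ solve 9 (λ q a y p b e w c s → let z = q :* q :* q :* q :* y in
                 p :* (b :* e) :* w :* (one :- q :^ 1 :* (q :* q :* q :* q :* z)) :* c :* (s :* (a :- q :^ 4 :* z) :* (one :- q :^ 4 :* z))
                 := (p :* ((a :- q :^ 4 :* z) :* (one :- q :^ 5 :* z))) :* b :* (w :* ((one :- q :^ 4 :* z) :* s)) :* c :* e)
                 refl q a (x m) (P′ n) (Πa m) ([a- 6 ] m) (u (suc n)) C (⟨a· 4 ⟩ n) ⟩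
          (P′ n * D₁ n) * Πa m * (u (suc n) * D₂ n) * C * [a- 6 ] m
            ≈⟨ *-congʳ (*-congʳ (*-cong (*-congʳ (P′-suc m)) (u-suc n))) ⟩
          (P′ m * ⟨ 6 ⟩ m) * Πa m * (u n * (⟨a· 2 ⟩ n * ⟨ 1 ⟩ n * q)) * C * [a- 6 ] m
            ≈⟨ solve 9 (λ q a y p b w c s r → let z = q :* q :* q :* q :* y in
                 (p :* (one :- q :^ 6 :* y)) :* b :* (w :* (s :* r :* q)) :* c :* (a :- q :^ 6 :* y)
                 := p :* b :* w :* r :* c :* (s :* (a :- q :^ 2 :* z) :* (one :- q :^ 2 :* z) :* q))
                 refl q a (x m) (P′ m) (Πa m) (u n) C (⟨a· 2 ⟩ n) (⟨ 1 ⟩ n) ⟩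
          Y m * ⟨ 1 ⟩ n * C * (⟨a· 2 ⟩ n * [a- 2 ] n * ⟨ 2 ⟩ n * q)
            ≈⟨ *-congʳ (Y≈ρ m) ⟩
          ∏ ρ n * ⟨ 1 ⟩ 0 * (⟨a· 2 ⟩ n * [a- 2 ] n * ⟨ 2 ⟩ n * q)
            ≈⟨ solve 3 (λ a b c → a :* b :* c := a :* c :* b) refl (∏ ρ n) (⟨ 1 ⟩ 0) (⟨a· 2 ⟩ n * [a- 2 ] n * ⟨ 2 ⟩ n * q) ⟩
          ∏ ρ n * (⟨a· 2 ⟩ n * [a- 2 ] n * ⟨ 2 ⟩ n * q) * ⟨ 1 ⟩ 0
            ≈⟨ *-congʳ (v-suc n) ⟨
          ∏ ρ (suc n) * D₃ n * ⟨ 1 ⟩ 0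
            ≈⟨ solve 3 (λ a b c → a :* b :* c := a :* c :* b) refl (∏ ρ (suc n)) (D₃ n) (⟨ 1 ⟩ 0) ⟩
          ∏ ρ (suc n) * ⟨ 1 ⟩ 0 * D₃ n ∎)
          where
          n = suc m
          Πa = ∏ [a- 6 ]
          C = ⟨ 2 ⟩ 0 * [a- 2 ] 0

        -- The factor 1 + q^{4m+5} of the summand meets the 1 - q^{4m+5} of `Y≈ρ`; together they
        -- restore the very-well-poised factor 1 - q^{8m+10}.
        t-suc : ∀ m → t (suc m) ≈ Y m * ((a - q * q) * (1# - q * q * (x (suc m) * x (suc m))))
        t-suc m = begin
          inv (1# + q) * (1# + q * X) * ∏ ρ (suc m)
            ≈⟨ *-congˡ v≈ ⟩
          inv (1# + q) * (1# + q * X) * (Y m * ⟨ 1 ⟩ (suc m) * (1# + q) * (a - q * q))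
            ≈⟨ solve 5 (λ q a X y i →
                 i :* (one :+ q :* X) :* (y :* (one :- q :^ 1 :* X) :* (one :+ q) :* (a :- q :* q))
                 := (y :* ((a :- q :* q) :* (one :- q :* q :* (X :* X)))) :* ((one :+ q) :* i))
                 refl q a X (Y m) (inv (1# + q)) ⟩
          Y m * ((a - q * q) * (1# - q * q * (X * X))) * ((1# + q) * inv (1# + q))
            ≈⟨ *-congˡ (inverseʳ 1+q≉0) ⟩
          Y m * ((a - q * q) * (1# - q * q * (X * X))) * 1#
            ≈⟨ *-identityʳ _ ⟩
          Y m * ((a - q * q) * (1# - q * q * (X * X))) ∎
          where
          X = x (suc m)
          v≈ : ∏ ρ (suc m) ≈ Y m * ⟨ 1 ⟩ (suc m) * (1# + q) * (a - q * q)
          v≈ = cancelʳ 1-q≉0 (begin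
            ∏ ρ (suc m) * (1# - q)
              ≈⟨ solve 2 (λ r q → r :* (one :- q) := r :* (one :- q :^ 1 :* one)) refl (∏ ρ (suc m)) q ⟩
            ∏ ρ (suc m) * ⟨ 1 ⟩ 0
              ≈⟨ Y≈ρ m ⟨
            Y m * ⟨ 1 ⟩ (suc m) * (⟨ 2 ⟩ 0 * [a- 2 ] 0)
              ≈⟨ solve 4 (λ q a y w → y :* w :* ((one :- q :^ 2 :* one) :* (a :- q :^ 2 :* one))
                   := y :* w :* (one :+ q) :* (a :- q :* q) :* (one :- q)) refl q a (Y m) (⟨ 1 ⟩ (suc m)) ⟩
            Y m * ⟨ 1 ⟩ (suc m) * (1# + q) * (a - q * q) * (1# - q) ∎)

        -- The index j = m + 1 is present only in the sum for m + 1, so telescoping over j ≤ m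
        -- leaves exactly this boundary contribution.
        last-term : ∀ m → G m 0 m + F (suc m) 0 (suc m) ≈ t (suc m)
        last-term m = begin
          G m 0 m + F (suc m) 0 (suc m)
            ≈⟨ +-cong
                 (solve 8 (λ q y p w e b r s →
                   (:- (q :^ 3 :* y)) :* p :* w :* e :* b :* (r :* s)
                   := (:- (q :^ 2 :* y)) :* p :* e :* b :* (w :* (r :* s :* q)))
                   refl q (x 0) (P′ m) (u m) (∏[ 0 , m ] [a- 6 ]) 1# (⟨a· 2 ⟩ m) (⟨ 1 ⟩ m))
                 (*-congʳ (*-cong (*-congʳ (P-suc m)) (∏[]0 (suc m) [a- 6 ]))) ⟩
          - (q ^ 2 * 1#) * P′ m * ∏[ 0 , m ] [a- 6 ] * 1# * (u m * (⟨a· 2 ⟩ m * ⟨ 1 ⟩ m * q))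
            + P′ m * ⟨ 6 ⟩ m * 1# * (E * [a- 6 ] m) * w
            ≈⟨ +-congʳ (*-cong (*-congʳ (*-congˡ (∏[]0 m [a- 6 ]))) (sym (u-suc m))) ⟩
          - (q ^ 2 * 1#) * P′ m * E * 1# * (w * D₂ m) + P′ m * ⟨ 6 ⟩ m * 1# * (E * [a- 6 ] m) * w
            ≈⟨ solve 6 (λ q a y p e w → let X = q :* q :* q :* q :* y in
                 (:- (q :^ 2 :* one)) :* p :* e :* one :* (w :* ((one :- q :^ 4 :* y) :* (one :- a :* (q :^ 4 :* y))))
                   :+ p :* (one :- q :^ 6 :* y) :* one :* (e :* (a :- q :^ 6 :* y)) :* w
                 := p :* e :* w :* ((a :- q :* q) :* (one :- q :* q :* (X :* X))))
                 refl q a (x m) (P′ m) E w ⟩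
          Y m * ((a - q * q) * (1# - q * q * (x (suc m) * x (suc m))))
            ≈⟨ t-suc m ⟨
          t (suc m) ∎
          where
          E = ∏ [a- 6 ] m
          w = u (suc m)

      truncated-sum : ∀ m → ∑≤ m t ≈ ∑≤ m (λ j → F m (m ℕ.∸ j) j)
      truncated-sum zero = begin
        inv (1# + q) * (1# + q * 1#) * 1#
          ≈⟨ solve 2 (λ i q → i :* (one :+ q :* one) :* one := one :* ((one :+ q) :* i)) refl (inv (1# + q)) q ⟩
        1# * ((1# + q) * inv (1# + q))   ≈⟨ *-congˡ (inverseʳ 1+q≉0) ⟩
        1# * 1#                          ≈⟨ solve 0 (one :* one := one :* one :* one :* one) refl ⟩
        1# * 1# * 1# * 1#                ∎
      truncated-sum (suc m) = begin
        ∑≤ m t + t (suc m)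
          ≈⟨ +-cong (truncated-sum m) (sym (last-term m)) ⟩
        ∑≤ m f + (G m 0 m + F (suc m) 0 (suc m))
          ≈⟨ +-assoc _ _ _ ⟨
        ∑≤ m f + G m 0 m + F (suc m) 0 (suc m)
          ≈⟨ +-cong (partial-sum m 0) (reflexive (≡.cong (λ k → F (suc m) k (suc m)) (ℕ.n∸n≡0 (suc m)))) ⟨
        ∑≤ (suc m) (λ j → F (suc m) (suc m ℕ.∸ j) j) ∎
        where f = λ j → F m (m ℕ.∸ j) j

-- The field of fractions

module FractionField {c ℓ : Level} (R : CommutativeRing c ℓ)
  (1≉0 : NonTrivial R) (cancelʳ : RightCancellative R)
  (_≟0 : ∀ x → Dec (CommutativeRing._≈_ R x (CommutativeRing.0# R))) where

  open CommutativeRing R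

  open import Relation.Binary.Reasoning.Setoid setoid
  open IntegerCoefficients R

  *-nonzero : ∀ {x y} → ¬ x ≈ 0# → ¬ y ≈ 0# → ¬ x * y ≈ 0#
  *-nonzero x≉0 y≉0 xy≈0 = x≉0 (cancelʳ y≉0 (trans xy≈0 (sym (zeroˡ _))))

  record Fraction : Set (c ⊔ ℓ) where
    constructor _/_∣_
    field
      num   : Carrier
      den   : Carrier
      den≉0 : ¬ den ≈ 0#
  open Fraction

  infix 4 _≈ᶠ_
  record _≈ᶠ_ (x y : Fraction) : Set ℓ where
    constructor cross
    field
      cross-eq : num x * den y ≈ num y * den x
  open _≈ᶠ_ public

  _+ᶠ_ _*ᶠ_ : Fraction → Fraction → Fraction
  (n / d ∣ d≉0) +ᶠ (m / e ∣ e≉0) = (n * e + m * d) / (d * e) ∣ *-nonzero d≉0 e≉0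
  (n / d ∣ d≉0) *ᶠ (m / e ∣ e≉0) = (n * m) / (d * e) ∣ *-nonzero d≉0 e≉0

  -ᶠ_ : Fraction → Fraction
  -ᶠ (n / d ∣ d≉0) = (- n) / d ∣ d≉0

  ι : Carrier → Fraction
  ι x = x / 1# ∣ 1≉0

  invᶠ : Fraction → Fraction
  invᶠ (n / d ∣ d≉0) with n ≟0
  -- An arbitrary value: `IsInverse` constrains nonzero arguments only.
  ... | yes _  = ι 0#
  ... | no n≉0 = d / n ∣ n≉0

  private
    one : ∀ {n} → Polynomial n
    one = con (+ 1)

    zer : ∀ {n} → Polynomial n
    zer = con (+ 0)

    ≈ᶠ-trans : ∀ {x y z} → x ≈ᶠ y → y ≈ᶠ z → x ≈ᶠ z
    ≈ᶠ-trans {n / d ∣ _} {m / e ∣ e≉0} {k / f ∣ _} (cross p) (cross q) = cross (cancelʳ e≉0 (begin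
      n * f * e    ≈⟨ solve 3 (λ n f e → n :* f :* e := n :* e :* f) refl n f e ⟩
      n * e * f    ≈⟨ *-congʳ p ⟩
      m * d * f    ≈⟨ solve 3 (λ m d f → m :* d :* f := m :* f :* d) refl m d f ⟩
      m * f * d    ≈⟨ *-congʳ q ⟩
      k * e * d    ≈⟨ solve 3 (λ k e d → k :* e :* d := k :* d :* e) refl k e d ⟩
      k * d * e    ∎))

    +ᶠ-cong : ∀ {x y u v} → x ≈ᶠ y → u ≈ᶠ v → x +ᶠ u ≈ᶠ y +ᶠ v
    +ᶠ-cong {n / d ∣ _} {m / e ∣ _} {n′ / d′ ∣ _} {m′ / e′ ∣ _} (cross p) (cross q) = cross (begin
      (n * d′ + n′ * d) * (e * e′)
        ≈⟨ solve 6 (λ n d n′ d′ e e′ → (n :* d′ :+ n′ :* d) :* (e :* e′) := (n :* e) :* (d′ :* e′) :+ (n′ :* e′) :* (d :* e)) refl n d n′ d′ e e′ ⟩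
      (n * e) * (d′ * e′) + (n′ * e′) * (d * e)
        ≈⟨ +-cong (*-congʳ p) (*-congʳ q) ⟩
      (m * d) * (d′ * e′) + (m′ * d′) * (d * e)
        ≈⟨ solve 6 (λ m d m′ d′ e e′ → (m :* d) :* (d′ :* e′) :+ (m′ :* d′) :* (d :* e) := (m :* e′ :+ m′ :* e) :* (d :* d′)) refl m d m′ d′ e e′ ⟩
      (m * e′ + m′ * e) * (d * d′) ∎)

    *ᶠ-cong : ∀ {x y u v} → x ≈ᶠ y → u ≈ᶠ v → x *ᶠ u ≈ᶠ y *ᶠ v
    *ᶠ-cong {n / d ∣ _} {m / e ∣ _} {n′ / d′ ∣ _} {m′ / e′ ∣ _} (cross p) (cross q) = cross (begin
      n * n′ * (e * e′)     ≈⟨ solve 4 (λ n n′ e e′ → n :* n′ :* (e :* e′) := n :* e :* (n′ :* e′)) refl n n′ e e′ ⟩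
      n * e * (n′ * e′)     ≈⟨ *-cong p q ⟩
      m * d * (m′ * d′)     ≈⟨ solve 4 (λ n n′ e e′ → n :* e :* (n′ :* e′) := n :* n′ :* (e :* e′)) refl m m′ d d′ ⟩
      m * m′ * (d * d′)     ∎)

    -ᶠ-cong : ∀ {x y} → x ≈ᶠ y → -ᶠ x ≈ᶠ -ᶠ y
    -ᶠ-cong {n / d ∣ _} {m / e ∣ _} (cross p) = cross (begin
      - n * e     ≈⟨ solve 2 (λ n e → (:- n) :* e := :- (n :* e)) refl n e ⟩
      - (n * e)   ≈⟨ -‿cong p ⟩
      - (m * d)   ≈⟨ solve 2 (λ n e → :- (n :* e) := (:- n) :* e) refl m d ⟩
      - m * d     ∎)

  field-of-fractions : CommutativeRing (c ⊔ ℓ) ℓ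
  field-of-fractions = record
    { Carrier = Fraction
    ; _≈_ = _≈ᶠ_
    ; _+_ = _+ᶠ_
    ; _*_ = _*ᶠ_
    ; -_  = -ᶠ_
    ; 0#  = ι 0#
    ; 1#  = ι 1#
    ; isCommutativeRing = record
      { isRing = record
        { +-isAbelianGroup = record
          { isGroup = record
            { isMonoid = record
              { isSemigroup = record
                { isMagma = record
                  { isEquivalence = record
                    { refl  = cross refl
                    ; sym   = λ { (cross p) → cross (sym p) }
                    ; trans = ≈ᶠ-trans
                    }
                  ; ∙-cong = +ᶠ-cong
                  }
                ; assoc = λ { (n / d ∣ _) (m / e ∣ _) (k / f ∣ _) → cross (solve 6 (λ n d m e k f →
                      ((n :* e :+ m :* d) :* f :+ k :* (d :* e)) :* (d :* (e :* f))
                      := (n :* (e :* f) :+ (m :* f :+ k :* e) :* d) :* (d :* e :* f)) refl n d m e k f) }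
                }
              ; identity = (λ { (n / d ∣ _) → cross (solve 2 (λ n d → (zer :* d :+ n :* one) :* d := n :* (one :* d)) refl n d) })
                         , (λ { (n / d ∣ _) → cross (solve 2 (λ n d → (n :* one :+ zer :* d) :* d := n :* (d :* one)) refl n d) })
              }
            ; inverse = (λ { (n / d ∣ _) → cross (solve 2 (λ n d → ((:- n) :* d :+ n :* d) :* one := zer :* (d :* d)) refl n d) })
                      , (λ { (n / d ∣ _) → cross (solve 2 (λ n d → (n :* d :+ (:- n) :* d) :* one := zer :* (d :* d)) refl n d) })
            ; ⁻¹-cong = -ᶠ-cong
            }
          ; comm = λ { (n / d ∣ _) (m / e ∣ _) → cross (solve 4 (λ n d m e →
                (n :* e :+ m :* d) :* (e :* d) := (m :* d :+ n :* e) :* (d :* e)) refl n d m e) }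
          }
        ; *-cong = *ᶠ-cong
        ; *-assoc = λ { (n / d ∣ _) (m / e ∣ _) (k / f ∣ _) → cross (solve 6 (λ n d m e k f →
              (n :* m :* k) :* (d :* (e :* f)) := (n :* (m :* k)) :* (d :* e :* f)) refl n d m e k f) }
        ; *-identity = (λ { (n / d ∣ _) → cross (solve 2 (λ n d → one :* n :* d := n :* (one :* d)) refl n d) })
                     , (λ { (n / d ∣ _) → cross (solve 2 (λ n d → n :* one :* d := n :* (d :* one)) refl n d) })
        ; distrib = (λ { (n / d ∣ _) (m / e ∣ _) (k / f ∣ _) → cross (solve 6 (λ n d m e k f →
                        n :* (m :* f :+ k :* e) :* (d :* e :* (d :* f))
                        := (n :* m :* (d :* f) :+ n :* k :* (d :* e)) :* (d :* (e :* f))) refl n d m e k f) })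
                  , (λ { (n / d ∣ _) (m / e ∣ _) (k / f ∣ _) → cross (solve 6 (λ n d m e k f →
                        (m :* f :+ k :* e) :* n :* (e :* d :* (f :* d))
                        := (m :* n :* (f :* d) :+ k :* n :* (e :* d)) :* (e :* f :* d)) refl n d m e k f) })
        }
      ; *-comm = λ { (n / d ∣ _) (m / e ∣ _) → cross (solve 4 (λ n d m e →
              n :* m :* (e :* d) := m :* n :* (d :* e)) refl n d m e) }
      }
    }

  private module K = CommutativeRing field-of-fractions

  invᶠ-inverseʳ : ∀ {x} → ¬ x ≈ᶠ ι 0# → (x *ᶠ invᶠ x) ≈ᶠ ι 1#
  invᶠ-inverseʳ {n / d ∣ d≉0} x≉0 with n ≟0
  ... | yes n≈0 = contradiction (cross (trans (*-congʳ n≈0) (trans (zeroˡ _) (sym (zeroˡ _))))) x≉0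
  ... | no n≉0  = cross (solve 2 (λ n d → n :* d :* one := one :* (d :* n)) refl n d)

  ι-cong : ∀ {x y} → x ≈ y → ι x ≈ᶠ ι y
  ι-cong x≈y = cross (*-congʳ x≈y)

  ι-injective : ∀ {x y} → ι x ≈ᶠ ι y → x ≈ y
  ι-injective (cross p) = cancelʳ 1≉0 p

  ι-+ : ∀ x y → ι (x + y) ≈ᶠ (ι x +ᶠ ι y)
  ι-+ x y = cross (solve 2 (λ x y → (x :+ y) :* (one :* one) := (x :* one :+ y :* one) :* one) refl x y)

  ι-* : ∀ x y → ι (x * y) ≈ᶠ (ι x *ᶠ ι y)
  ι-* x y = cross (solve 2 (λ x y → (x :* y) :* (one :* one) := (x :* y) :* one) refl x y)

  fraction-num : ∀ x → (x *ᶠ ι (den x)) ≈ᶠ ι (num x)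
  fraction-num (n / d ∣ _) = cross (solve 2 (λ n d → n :* d :* one := n :* (d :* one)) refl n d)

  ι-isRingMonomorphism : RingMorphisms.IsRingMonomorphism rawRing K.rawRing ι
  ι-isRingMonomorphism = record
    { isRingHomomorphism = record
      { isSemiringHomomorphism = record
        { isNearSemiringHomomorphism = record
          { +-isMonoidHomomorphism = record
            { isMagmaHomomorphism = record
              { isRelHomomorphism = record { cong = ι-cong }
              ; homo = ι-+
              }
            ; ε-homo = K.refl
            }
          ; *-homo = ι-*
          }
        ; 1#-homo = K.refl
        }
      ; -‿homo = λ _ → K.refl
      }
    ; injective = ι-injective
    }

-- Integer polynomials

module IntegerPolynomials where

  open import Data.Integer.Solver using (module +-*-Solver)
  open import Data.List.Base using ([]; _∷_)
  open import Relation.Binary.PropositionalEquality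
  open ≡-Reasoning

  coeff : Poly → ℕ → ℤ
  coeff []      _       = + 0
  coeff (a ∷ f) zero    = a
  coeff (a ∷ f) (suc i) = coeff f i

  infix 4 _≋_
  -- Equality of coefficient sequences, which ignores trailing zeros just as `strip` does; the ring
  -- laws are then checked one coefficient at a time.
  record _≋_ (f g : Poly) : Set where
    constructor pointwise
    field coeff-≡ : ∀ i → coeff f i ≡ coeff g i
  open _≋_ public

  ≋-refl : ∀ {f} → f ≋ f
  ≋-refl = pointwise λ _ → refl

  ≋-sym : ∀ {f g} → f ≋ g → g ≋ f
  ≋-sym (pointwise p) = pointwise λ i → sym (p i)

  ≋-trans : ∀ {f g h} → f ≋ g → g ≋ h → f ≋ h
  ≋-trans (pointwise p) (pointwise r) = pointwise λ i → trans (p i) (r i)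

  ∷-cong : ∀ {a b f g} → a ≡ b → f ≋ g → a ∷ f ≋ b ∷ g
  ∷-cong a≡b (pointwise p) = pointwise λ { zero → a≡b ; (suc i) → p i }

  coeff-cons0 : ∀ a f i → coeff (cons0 a f) i ≡ coeff (a ∷ f) i
  coeff-cons0 (+ zero)  []      zero    = refl
  coeff-cons0 (+ zero)  []      (suc i) = refl
  coeff-cons0 (+ zero)  (_ ∷ _) i       = refl
  coeff-cons0 (+ suc _) _       i       = refl
  coeff-cons0 -[1+ _ ]  _       i       = refl

  strip-≋ : ∀ f → strip f ≋ f
  strip-≋ []      = ≋-refl
  strip-≋ (a ∷ f) = ≋-trans (pointwise (coeff-cons0 a (strip f))) (∷-cong refl (strip-≋ f))

  strip-≋[] : ∀ f → f ≋ [] → strip f ≡ []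
  strip-≋[] []      _ = refl
  strip-≋[] (a ∷ f) (pointwise p) with refl ← p 0
    rewrite strip-≋[] f (pointwise λ i → p (suc i)) = refl

  ≋⇒≈ₚ : ∀ {f g} → f ≋ g → f ≈ₚ g
  ≋⇒≈ₚ {[]}    {g}     f≋g = sym (strip-≋[] g (≋-sym f≋g))
  ≋⇒≈ₚ {a ∷ f} {[]}    f≋g = strip-≋[] (a ∷ f) f≋g
  ≋⇒≈ₚ {a ∷ f} {b ∷ g} (pointwise p) =
    cong₂ cons0 (p 0) (≋⇒≈ₚ {f} {g} (pointwise λ i → p (suc i)))

  ≈ₚ⇒≋ : ∀ {f g} → f ≈ₚ g → f ≋ g
  ≈ₚ⇒≋ {f} {g} f≈g =
    ≋-trans (≋-sym (strip-≋ f)) (≋-trans (pointwise λ i → cong (λ h → coeff h i) f≈g) (strip-≋ g))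

  coeff-0∷[] : ∀ i → coeff (+ 0 ∷ []) i ≡ + 0
  coeff-0∷[] zero    = refl
  coeff-0∷[] (suc i) = refl

  coeff-+ : ∀ f g i → coeff (f +ₚ g) i ≡ coeff f i ℤ.+ coeff g i
  coeff-+ []      g       i       = sym (ℤ.+-identityˡ _)
  coeff-+ (a ∷ f) []      i       = sym (ℤ.+-identityʳ _)
  coeff-+ (a ∷ f) (b ∷ g) zero    = refl
  coeff-+ (a ∷ f) (b ∷ g) (suc i) = coeff-+ f g i

  coeff-neg : ∀ f i → coeff (negₚ f) i ≡ ℤ.- coeff f i
  coeff-neg []      i       = refl
  coeff-neg (a ∷ f) zero    = refl
  coeff-neg (a ∷ f) (suc i) = coeff-neg f i

  coeff-scale : ∀ c f i → coeff (scaleₚ c f) i ≡ c ℤ.* coeff f i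
  coeff-scale c []      i       = sym (ℤ.*-zeroʳ c)
  coeff-scale c (a ∷ f) zero    = refl
  coeff-scale c (a ∷ f) (suc i) = coeff-scale c f i

  coeff-∷* : ∀ a f g i → coeff ((a ∷ f) *ₚ g) i ≡ a ℤ.* coeff g i ℤ.+ coeff (+ 0 ∷ f *ₚ g) i
  coeff-∷* a f g i = trans (coeff-+ (scaleₚ a g) _ i) (cong (ℤ._+ coeff (+ 0 ∷ f *ₚ g) i) (coeff-scale a g i))

  private
    +-cong : ∀ {f g h k} → f ≋ g → h ≋ k → f +ₚ h ≋ g +ₚ k
    +-cong {f} {g} {h} {k} (pointwise p) (pointwise r) = pointwise λ i →
      trans (coeff-+ f h i) (trans (cong₂ ℤ._+_ (p i) (r i)) (sym (coeff-+ g k i)))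

    neg-cong : ∀ {f g} → f ≋ g → negₚ f ≋ negₚ g
    neg-cong {f} {g} (pointwise p) = pointwise λ i →
      trans (coeff-neg f i) (trans (cong ℤ.-_ (p i)) (sym (coeff-neg g i)))

    +-assoc : ∀ f g h → (f +ₚ g) +ₚ h ≋ f +ₚ (g +ₚ h)
    +-assoc f g h = pointwise λ i → begin
      coeff ((f +ₚ g) +ₚ h) i                       ≡⟨ coeff-+ (f +ₚ g) h i ⟩
      coeff (f +ₚ g) i ℤ.+ coeff h i                ≡⟨ cong (ℤ._+ _) (coeff-+ f g i) ⟩
      coeff f i ℤ.+ coeff g i ℤ.+ coeff h i         ≡⟨ ℤ.+-assoc (coeff f i) _ _ ⟩
      coeff f i ℤ.+ (coeff g i ℤ.+ coeff h i)       ≡⟨ cong (λ z → coeff f i ℤ.+ z) (coeff-+ g h i) ⟨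
      coeff f i ℤ.+ coeff (g +ₚ h) i                ≡⟨ coeff-+ f (g +ₚ h) i ⟨
      coeff (f +ₚ (g +ₚ h)) i                       ∎

    +-comm : ∀ f g → f +ₚ g ≋ g +ₚ f
    +-comm f g = pointwise λ i →
      trans (coeff-+ f g i) (trans (ℤ.+-comm (coeff f i) _) (sym (coeff-+ g f i)))

    +-identityʳ : ∀ f → f +ₚ [] ≋ f
    +-identityʳ []      = ≋-refl
    +-identityʳ (a ∷ f) = ≋-refl

    +-inverseʳ : ∀ f → f +ₚ negₚ f ≋ []
    +-inverseʳ f = pointwise λ i → trans (coeff-+ f (negₚ f) i)
      (trans (cong (λ z → coeff f i ℤ.+ z) (coeff-neg f i)) (ℤ.+-inverseʳ (coeff f i)))

    0∷-cong : ∀ {f g} → f ≋ g → ∀ i → coeff (+ 0 ∷ f) i ≡ coeff (+ 0 ∷ g) i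
    0∷-cong p = coeff-≡ (∷-cong refl p)

    coeff-0∷+ : ∀ f g i → coeff (+ 0 ∷ (f +ₚ g)) i ≡ coeff (+ 0 ∷ f) i ℤ.+ coeff (+ 0 ∷ g) i
    coeff-0∷+ f g zero    = refl
    coeff-0∷+ f g (suc i) = coeff-+ f g i

    *-congˡ : ∀ f {g h} → g ≋ h → f *ₚ g ≋ f *ₚ h
    *-congˡ []      g≋h = ≋-refl
    *-congˡ (a ∷ f) {g} {h} g≋h = pointwise λ i → trans (coeff-∷* a f g i)
      (trans (cong₂ ℤ._+_ (cong (a ℤ.*_) (coeff-≡ g≋h i)) (0∷-cong (*-congˡ f g≋h) i)) (sym (coeff-∷* a f h i)))

    *-distribʳ : ∀ h f g → (f +ₚ g) *ₚ h ≋ f *ₚ h +ₚ g *ₚ h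
    *-distribʳ h []      g       = ≋-refl
    *-distribʳ h (a ∷ f) []      = ≋-sym (+-identityʳ _)
    *-distribʳ h (a ∷ f) (b ∷ g) = pointwise λ i → begin
      coeff ((a ℤ.+ b ∷ f +ₚ g) *ₚ h) i
        ≡⟨ coeff-∷* (a ℤ.+ b) (f +ₚ g) h i ⟩
      (a ℤ.+ b) ℤ.* coeff h i ℤ.+ coeff (+ 0 ∷ (f +ₚ g) *ₚ h) i
        ≡⟨ cong₂ ℤ._+_ (ℤ.*-distribʳ-+ (coeff h i) a b)
             (trans (0∷-cong (*-distribʳ h f g) i) (coeff-0∷+ (f *ₚ h) (g *ₚ h) i)) ⟩
      (a ℤ.* coeff h i ℤ.+ b ℤ.* coeff h i) ℤ.+ (coeff (+ 0 ∷ f *ₚ h) i ℤ.+ coeff (+ 0 ∷ g *ₚ h) i)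
        ≡⟨ solve 4 (λ x y z w → (x :+ y) :+ (z :+ w) := (x :+ z) :+ (y :+ w)) refl
             (a ℤ.* coeff h i) (b ℤ.* coeff h i) (coeff (+ 0 ∷ f *ₚ h) i) (coeff (+ 0 ∷ g *ₚ h) i) ⟩
      (a ℤ.* coeff h i ℤ.+ coeff (+ 0 ∷ f *ₚ h) i) ℤ.+ (b ℤ.* coeff h i ℤ.+ coeff (+ 0 ∷ g *ₚ h) i)
        ≡⟨ cong₂ ℤ._+_ (coeff-∷* a f h i) (coeff-∷* b g h i) ⟨
      coeff ((a ∷ f) *ₚ h) i ℤ.+ coeff ((b ∷ g) *ₚ h) i
        ≡⟨ coeff-+ ((a ∷ f) *ₚ h) ((b ∷ g) *ₚ h) i ⟨
      coeff ((a ∷ f) *ₚ h +ₚ (b ∷ g) *ₚ h) i ∎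
      where open +-*-Solver

    *-zeroʳ : ∀ f → f *ₚ [] ≋ []
    *-zeroʳ []      = ≋-refl
    *-zeroʳ (a ∷ f) = pointwise λ { zero → refl ; (suc i) → coeff-≡ (*-zeroʳ f) i }

    -- `_*ₚ_` recurses on its left factor. This mirrored recursion on the right factor is what
    -- commutativity rests on.
    coeff-*∷ : ∀ f b g i → coeff (f *ₚ (b ∷ g)) i ≡ b ℤ.* coeff f i ℤ.+ coeff (+ 0 ∷ f *ₚ g) i
    coeff-*∷ []      b g zero    = sym (trans (ℤ.+-identityʳ _) (ℤ.*-zeroʳ b))
    coeff-*∷ []      b g (suc i) = sym (trans (ℤ.+-identityʳ _) (ℤ.*-zeroʳ b))
    coeff-*∷ (a ∷ f) b g zero    = cong (ℤ._+ + 0) (ℤ.*-comm a b)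
    coeff-*∷ (a ∷ f) b g (suc i) = begin
      coeff (scaleₚ a g +ₚ f *ₚ (b ∷ g)) i
        ≡⟨ coeff-+ (scaleₚ a g) _ i ⟩
      coeff (scaleₚ a g) i ℤ.+ coeff (f *ₚ (b ∷ g)) i
        ≡⟨ cong (λ z → coeff (scaleₚ a g) i ℤ.+ z) (coeff-*∷ f b g i) ⟩
      coeff (scaleₚ a g) i ℤ.+ (b ℤ.* coeff f i ℤ.+ coeff (+ 0 ∷ f *ₚ g) i)
        ≡⟨ solve 3 (λ x y z → x :+ (y :+ z) := y :+ (x :+ z)) refl
             (coeff (scaleₚ a g) i) (b ℤ.* coeff f i) (coeff (+ 0 ∷ f *ₚ g) i) ⟩
      b ℤ.* coeff f i ℤ.+ (coeff (scaleₚ a g) i ℤ.+ coeff (+ 0 ∷ f *ₚ g) i)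
        ≡⟨ cong (λ z → b ℤ.* coeff f i ℤ.+ z) (coeff-+ (scaleₚ a g) _ i) ⟨
      b ℤ.* coeff f i ℤ.+ coeff ((a ∷ f) *ₚ g) i ∎
      where open +-*-Solver

    *-comm : ∀ f g → f *ₚ g ≋ g *ₚ f
    *-comm []      g = ≋-sym (*-zeroʳ g)
    *-comm (a ∷ f) g = pointwise λ i → begin
      coeff ((a ∷ f) *ₚ g) i                              ≡⟨ coeff-∷* a f g i ⟩
      a ℤ.* coeff g i ℤ.+ coeff (+ 0 ∷ f *ₚ g) i          ≡⟨ cong (λ z → a ℤ.* coeff g i ℤ.+ z) (0∷-cong (*-comm f g) i) ⟩
      a ℤ.* coeff g i ℤ.+ coeff (+ 0 ∷ g *ₚ f) i          ≡⟨ coeff-*∷ g a f i ⟨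
      coeff (g *ₚ (a ∷ f)) i                              ∎

    *-cong : ∀ {f g h k} → f ≋ g → h ≋ k → f *ₚ h ≋ g *ₚ k
    *-cong {f} {g} {h} {k} f≋g h≋k = ≋-trans (*-congˡ f h≋k)
      (≋-trans (*-comm f k) (≋-trans (*-congˡ k f≋g) (*-comm k g)))

    scale-* : ∀ a g h → scaleₚ a g *ₚ h ≋ scaleₚ a (g *ₚ h)
    scale-* a []      h = ≋-refl
    scale-* a (b ∷ g) h = pointwise λ i → begin
      coeff ((a ℤ.* b ∷ scaleₚ a g) *ₚ h) i
        ≡⟨ coeff-∷* (a ℤ.* b) (scaleₚ a g) h i ⟩
      a ℤ.* b ℤ.* coeff h i ℤ.+ coeff (+ 0 ∷ scaleₚ a g *ₚ h) i
        ≡⟨ cong (λ z → a ℤ.* b ℤ.* coeff h i ℤ.+ z) (trans (0∷-cong (scale-* a g h) i) (0∷-scale i)) ⟩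
      a ℤ.* b ℤ.* coeff h i ℤ.+ a ℤ.* coeff (+ 0 ∷ g *ₚ h) i
        ≡⟨ solve 4 (λ a b c d → a :* b :* c :+ a :* d := a :* (b :* c :+ d)) refl a b (coeff h i) (coeff (+ 0 ∷ g *ₚ h) i) ⟩
      a ℤ.* (b ℤ.* coeff h i ℤ.+ coeff (+ 0 ∷ g *ₚ h) i)
        ≡⟨ cong (a ℤ.*_) (coeff-∷* b g h i) ⟨
      a ℤ.* coeff ((b ∷ g) *ₚ h) i
        ≡⟨ coeff-scale a ((b ∷ g) *ₚ h) i ⟨
      coeff (scaleₚ a ((b ∷ g) *ₚ h)) i ∎
      where
      open +-*-Solver
      0∷-scale : ∀ i → coeff (+ 0 ∷ scaleₚ a (g *ₚ h)) i ≡ a ℤ.* coeff (+ 0 ∷ g *ₚ h) i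
      0∷-scale zero    = sym (ℤ.*-zeroʳ a)
      0∷-scale (suc i) = coeff-scale a (g *ₚ h) i

  0∷-* : ∀ f g → (+ 0 ∷ f) *ₚ g ≋ + 0 ∷ f *ₚ g
  0∷-* f g = pointwise λ i → trans (coeff-∷* (+ 0) f g i) (ℤ.+-identityˡ _)

  private
    *-assoc : ∀ f g h → (f *ₚ g) *ₚ h ≋ f *ₚ (g *ₚ h)
    *-assoc []      g h = ≋-refl
    *-assoc (a ∷ f) g h = ≋-trans (*-distribʳ h (scaleₚ a g) (+ 0 ∷ f *ₚ g))
      (+-cong (scale-* a g h) (≋-trans (0∷-* (f *ₚ g) h) (∷-cong refl (*-assoc f g h))))

    *-identityˡ : ∀ f → oneₚ *ₚ f ≋ f
    *-identityˡ f = pointwise λ i → trans (coeff-∷* (+ 1) [] f i)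
      (trans (cong₂ ℤ._+_ (ℤ.*-identityˡ (coeff f i)) (coeff-0∷[] i)) (ℤ.+-identityʳ _))

  ℤ[q] : CommutativeRing 0ℓ 0ℓ
  ℤ[q] = record
    { Carrier = Poly
    ; _≈_ = _≋_
    ; _+_ = _+ₚ_
    ; _*_ = _*ₚ_
    ; -_  = negₚ
    ; 0#  = []
    ; 1#  = oneₚ
    ; isCommutativeRing = record
      { isRing = record
        { +-isAbelianGroup = record
          { isGroup = record
            { isMonoid = record
              { isSemigroup = record
                { isMagma = record
                  { isEquivalence = record { refl = ≋-refl ; sym = ≋-sym ; trans = ≋-trans }
                  ; ∙-cong = +-cong
                  }
                ; assoc = +-assoc
                }
              ; identity = (λ _ → ≋-refl) , +-identityʳ
              }
            ; inverse = (λ f → ≋-trans (+-comm (negₚ f) f) (+-inverseʳ f)) , +-inverseʳ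
            ; ⁻¹-cong = neg-cong
            }
          ; comm = +-comm
          }
        ; *-cong = *-cong
        ; *-assoc = *-assoc
        ; *-identity = *-identityˡ , λ f → ≋-trans (*-comm f oneₚ) (*-identityˡ f)
        ; distrib = (λ f g h → ≋-trans (*-comm f (g +ₚ h))
                       (≋-trans (*-distribʳ f g h) (+-cong (*-comm g f) (*-comm h f))))
                  , *-distribʳ
        }
      ; *-comm = *-comm
      }
    }

  Below : Poly → ℕ → Set
  Below f n = ∀ i → n ℕ.≤ i → coeff f i ≡ + 0

  -- Stated with degree bounds instead of degrees, so that it serves both exact degrees and monic
  -- polynomials.
  top-coeff : ∀ {f g n m} → Below f (suc n) → Below g (suc m) →
              Below (f *ₚ g) (suc (n ℕ.+ m)) × coeff (f *ₚ g) (n ℕ.+ m) ≡ coeff f n ℤ.* coeff g m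
  top-coeff {[]} f< g< = (λ _ _ → refl) , refl
  top-coeff {a ∷ f} {g} {zero} {m} f< g< = above , here
    where
    f≋[] : f *ₚ g ≋ []
    f≋[] = *-cong {f} {[]} {g} {g} (pointwise λ i → f< (suc i) ℕ.z<s) ≋-refl
    scaled : ∀ i → coeff ((a ∷ f) *ₚ g) i ≡ a ℤ.* coeff g i
    scaled i = trans (coeff-∷* a f g i) (trans (cong (λ z → a ℤ.* coeff g i ℤ.+ z)
      (trans (0∷-cong f≋[] i) (coeff-0∷[] i))) (ℤ.+-identityʳ _))
    here : coeff ((a ∷ f) *ₚ g) m ≡ a ℤ.* coeff g m
    here = scaled m
    above : Below ((a ∷ f) *ₚ g) (suc m)
    above i m<i = trans (scaled i) (trans (cong (a ℤ.*_) (g< i m<i)) (ℤ.*-zeroʳ a))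
  top-coeff {a ∷ f} {g} {suc n} {m} f< g< = above , here
    where
    ih : Below (f *ₚ g) (suc (n ℕ.+ m)) × coeff (f *ₚ g) (n ℕ.+ m) ≡ coeff f n ℤ.* coeff g m
    ih = top-coeff {f} {g} {n} {m} (λ i n<i → f< (suc i) (ℕ.s≤s n<i)) g<
    shifted : ∀ i → m ℕ.≤ i → coeff ((a ∷ f) *ₚ g) (suc i) ≡ coeff (f *ₚ g) i
    shifted i m≤i = trans (coeff-∷* a f g (suc i)) (trans (cong (ℤ._+ coeff (f *ₚ g) i)
      (trans (cong (a ℤ.*_) (g< (suc i) (ℕ.s≤s m≤i))) (ℤ.*-zeroʳ a))) (ℤ.+-identityˡ _))
    here : coeff ((a ∷ f) *ₚ g) (suc (n ℕ.+ m)) ≡ coeff f n ℤ.* coeff g m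
    here = trans (shifted (n ℕ.+ m) (ℕ.m≤n+m m n)) (proj₂ ih)
    above : Below ((a ∷ f) *ₚ g) (suc (suc n ℕ.+ m))
    above (suc i) (ℕ.s≤s n+m<i) = trans
      (shifted i (ℕ.≤-trans (ℕ.m≤n+m m (suc n)) n+m<i)) (proj₁ ih i n+m<i)

  record Degree (f : Poly) (n : ℕ) : Set where
    constructor degree
    field
      below   : Below f (suc n)
      leading : coeff f n ≢ + 0
  open Degree public

  degree-∷ : ∀ {a f n} → Degree f n → Degree (a ∷ f) (suc n)
  degree-∷ (degree b l) = degree (λ { (suc i) (ℕ.s≤s n<i) → b i n<i }) l

  zero-or-degree : ∀ f → f ≋ [] ⊎ ∃[ n ] Degree f n
  zero-or-degree [] = inj₁ ≋-refl
  zero-or-degree (a ∷ f) with zero-or-degree f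
  ... | inj₂ (n , d) = inj₂ (suc n , degree-∷ d)
  ... | inj₁ f≋[] with a ℤ.≟ + 0
  ...   | yes refl = inj₁ (pointwise λ { zero → refl ; (suc i) → coeff-≡ f≋[] i })
  ...   | no a≢0   = inj₂ (0 , degree (λ { (suc i) _ → coeff-≡ f≋[] i }) a≢0)

  degree⇒≉0 : ∀ {f n} → Degree f n → ¬ f ≋ []
  degree⇒≉0 {n = n} (degree _ l) f≋[] = l (coeff-≡ f≋[] n)

  degree-* : ∀ {f g n m} → Degree f n → Degree g m → Degree (f *ₚ g) (n ℕ.+ m)
  degree-* {f} {g} {n} {m} (degree fb fl) (degree gb gl) = degree (proj₁ tc) λ eq →
    Sum.[ fl , gl ] (ℤ.i*j≡0⇒i≡0∨j≡0 (coeff f n) (trans (sym (proj₂ tc)) eq))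
    where
    tc = top-coeff {f} {g} {n} {m} fb gb

  *-nonzero : ∀ {f g} → ¬ f ≋ [] → ¬ g ≋ [] → ¬ f *ₚ g ≋ []
  *-nonzero {f} {g} f≉0 g≉0 with zero-or-degree f | zero-or-degree g
  ... | inj₁ f≋0 | _ = contradiction f≋0 f≉0
  ... | inj₂ _ | inj₁ g≋0 = contradiction g≋0 g≉0
  ... | inj₂ (_ , df) | inj₂ (_ , dg) = degree⇒≉0 (degree-* df dg)

  _≟0 : ∀ f → Dec (f ≋ [])
  f ≟0 with zero-or-degree f
  ... | inj₁ f≋0     = yes f≋0
  ... | inj₂ (_ , d) = no (degree⇒≉0 d)

  *ₚ-cancelʳ : ∀ {f g h} → ¬ h ≋ [] → f *ₚ h ≋ g *ₚ h → f ≋ g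
  *ₚ-cancelʳ {f} {g} {h} h≉0 fh≋gh with (f -ₚ g) ≟0
  ... | yes f-g≋0 = x∙y⁻¹≈ε⇒x≈y f g f-g≋0
    where open import Algebra.Properties.Group (CommutativeRing.+-group ℤ[q])
  ... | no f-g≉0 = contradiction
    (≋-trans ([y-z]x≈yx-zx h f g) (x≈y⇒x∙y⁻¹≈ε fh≋gh)) (*-nonzero f-g≉0 h≉0)
    where
    open import Algebra.Properties.Group (CommutativeRing.+-group ℤ[q])
    open import Algebra.Properties.Ring (CommutativeRing.ring ℤ[q]) using ([y-z]x≈yx-zx)

  -- Degrees add, so a factor of positive degree would force the nonzero constant to have positive
  -- degree.
  const-divisor : ∀ {d g c} → c ≢ + 0 → d *ₚ g ≋ constₚ c → ∃[ b ] d ≋ constₚ b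
  const-divisor {d} {g} {c} c≢0 dg≋c with zero-or-degree d | zero-or-degree g
  ... | inj₁ d≋0 | _ = + 0 , ≋-trans d≋0 (pointwise λ { zero → refl ; (suc i) → refl })
  ... | inj₂ _ | inj₁ g≋0 = contradiction
          (trans (sym (coeff-≡ dg≋c 0)) (coeff-≡ (≋-trans (*-congˡ d g≋0) (*-zeroʳ d)) 0)) c≢0
  ... | inj₂ (suc n , dd) | inj₂ (m , dg) =
          contradiction (coeff-≡ dg≋c (suc n ℕ.+ m)) (leading (degree-* dd dg))
  ... | inj₂ (zero , degree b _) | inj₂ _ = coeff d 0 ,
          pointwise λ { zero → refl ; (suc i) → b (suc i) ℕ.z<s }

-- Correctness of long division by a monic polynomial

module MonicDivision where

  open IntegerPolynomials
  open import Data.Nat.Base using (_<ᵇ_; _∸_)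

  open IntegerPolynomials
  open import Data.Bool.Base using (true; false; if_then_else_; T)
  open import Data.List.Base using (List; []; _∷_; length; map; reverse; _∷ʳ_)
  open import Data.List.Properties using (unfold-reverse; length-reverse; length-map; reverse-involutive; length-++)

  private module R = CommutativeRing ℤ[q]
  open IntegerCoefficients ℤ[q]
  open import Relation.Binary.Reasoning.Setoid R.setoid

  one : ∀ {n} → Polynomial n
  one = con (+ 1)

  X^-suc : ∀ k → X^ (suc k) ≋ X^ 1 *ₚ X^ k
  X^-suc k = ≋-sym (≋-trans (0∷-* oneₚ (X^ k)) (∷-cong ≡.refl (R.*-identityˡ _)))

  X^-+ : ∀ m n → X^ (m ℕ.+ n) ≋ X^ m *ₚ X^ n
  X^-+ zero    n = ≋-sym (R.*-identityˡ _)
  X^-+ (suc m) n = ≋-trans (∷-cong ≡.refl (X^-+ m n)) (≋-sym (0∷-* (X^ m) (X^ n)))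

  constₚ-* : ∀ a b → constₚ (a ℤ.* b) ≋ constₚ a *ₚ constₚ b
  constₚ-* a b = pointwise λ { zero → ≡.sym (ℤ.+-identityʳ _) ; (suc i) → ≡.refl }

  ∷≋ : ∀ a f → a ∷ f ≋ constₚ a +ₚ X^ 1 *ₚ f
  ∷≋ a f = ≋-trans (pointwise λ { zero → ≡.sym (ℤ.+-identityʳ a) ; (suc i) → ≡.refl })
    (R.+-congˡ {constₚ a} (≋-sym (≋-trans (0∷-* oneₚ f) (∷-cong ≡.refl (R.*-identityˡ f)))))

  -- The functions behind divMonic are private to their module; each underscore
  -- below is solved by unification with what divMonic unfolds to.
  mutual
    divMonicBy : (Poly → Poly) → ℕ → Poly → Poly → Poly
    divMonicBy = _

    divMonic-unfold : ∀ f g →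
      divMonic f g ≡ divMonicBy reverse (length f) (reverse (strip g)) (reverse (strip f))
    divMonic-unfold f g with length f | reverse (strip g) | reverse (strip f)
    ... | n | r | s with reverse {A = ℤ}
    ...   | rev = ≡.refl

  -- The bare division loop, obtained by putting the identity for the final `reverse`. `gt` lists
  -- the coefficients of the divisor after its leading 1, highest degree first.
  quotient : ℕ → Poly → Poly → Poly
  quotient k gt = divMonicBy (λ l → l) k (+ 1 ∷ gt)

  private
    mutual
      quotientOfDifference : ℕ → Poly → Poly → Poly → Poly
      quotientOfDifference = _

      quotient-suc′ : ∀ k gt c f → quotient (suc k) gt (c ∷ f) ≡
        (if length f <ᵇ length gt then [] else (c ∷ quotientOfDifference k gt f (map (c ℤ.*_) gt)))
      quotient-suc′ k gt c f with map (c ℤ.*_) gt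
      ... | l = ≡.refl

  mutual
    subtractPrefix : Poly → Poly → Poly
    subtractPrefix = _

    private
      quotientOfDifference-unfold : ∀ k gt f l →
        quotientOfDifference k gt f l ≡ quotient k gt (subtractPrefix f l)
      quotientOfDifference-unfold k gt f l with quotient k gt
      ... | Q = ≡.refl

  quotient-suc : ∀ k gt c f → quotient (suc k) gt (c ∷ f) ≡
    (if length f <ᵇ length gt then [] else (c ∷ quotient k gt (subtractPrefix f (map (c ℤ.*_) gt))))
  quotient-suc k gt c f = ≡.refl

  subtractPrefix-[] : ∀ f → subtractPrefix f [] ≡ f
  subtractPrefix-[] []      = ≡.refl
  subtractPrefix-[] (x ∷ f) = ≡.refl

  desc : List ℤ → Poly
  desc []      = []
  desc (c ∷ l) = constₚ c *ₚ X^ (length l) +ₚ desc l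

  ∷ʳ≋ : ∀ f c → f ∷ʳ c ≋ constₚ c *ₚ X^ (length f) +ₚ f
  ∷ʳ≋ [] c = ≋-trans (≋-sym (R.*-identityʳ (constₚ c))) (≋-sym (R.+-identityʳ _))
  ∷ʳ≋ (a ∷ f) c = begin
    a ∷ (f ∷ʳ c)
      ≈⟨ ∷≋ a (f ∷ʳ c) ⟩
    constₚ a +ₚ X^ 1 *ₚ (f ∷ʳ c)
      ≈⟨ R.+-congˡ {constₚ a} (R.*-congˡ {X^ 1} (∷ʳ≋ f c)) ⟩
    constₚ a +ₚ X^ 1 *ₚ (constₚ c *ₚ X^ (length f) +ₚ f)
      ≈⟨ solve 5 (λ a x c y f → a :+ x :* (c :* y :+ f) := c :* (x :* y) :+ (a :+ x :* f)) R.refl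
           (constₚ a) (X^ 1) (constₚ c) (X^ (length f)) f ⟩
    constₚ c *ₚ (X^ 1 *ₚ X^ (length f)) +ₚ (constₚ a +ₚ X^ 1 *ₚ f)
      ≈⟨ R.+-cong (R.*-congˡ {constₚ c} (X^-suc (length f))) (∷≋ a f) ⟨
    constₚ c *ₚ X^ (suc (length f)) +ₚ (a ∷ f) ∎

  reverse≋desc : ∀ l → reverse l ≋ desc l
  reverse≋desc [] = ≋-refl
  reverse≋desc (c ∷ l) = begin
    reverse (c ∷ l)
      ≡⟨ unfold-reverse c l ⟩
    reverse l ∷ʳ c
      ≈⟨ ∷ʳ≋ (reverse l) c ⟩
    constₚ c *ₚ X^ (length (reverse l)) +ₚ reverse l
      ≡⟨ cong (λ n → constₚ c *ₚ X^ n +ₚ reverse l) (length-reverse l) ⟩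
    constₚ c *ₚ X^ (length l) +ₚ reverse l
      ≈⟨ R.+-congˡ (reverse≋desc l) ⟩
    desc (c ∷ l) ∎

  below-length : ∀ f → Below f (length f)
  below-length []      i       _           = ≡.refl
  below-length (a ∷ f) (suc i) (ℕ.s≤s l≤i) = below-length f i l≤i

  desc-below : ∀ l → Below (desc l) (length l)
  desc-below l i l≤i = ≡.trans (≡.sym (coeff-≡ (reverse≋desc l) i))
    (below-length (reverse l) i (ℕ.≤-trans (ℕ.≤-reflexive (length-reverse l)) l≤i))

  desc-map : ∀ c l → desc (map (c ℤ.*_) l) ≋ constₚ c *ₚ desc l
  desc-map c []      = ≋-sym (R.zeroʳ (constₚ c))
  desc-map c (a ∷ l) = begin
    constₚ (c ℤ.* a) *ₚ X^ (length (map (c ℤ.*_) l)) +ₚ desc (map (c ℤ.*_) l)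
      ≡⟨ cong (λ n → constₚ (c ℤ.* a) *ₚ X^ n +ₚ desc (map (c ℤ.*_) l)) (length-map _ l) ⟩
    constₚ (c ℤ.* a) *ₚ X^ (length l) +ₚ desc (map (c ℤ.*_) l)
      ≈⟨ R.+-cong (R.*-congʳ {X^ (length l)} (constₚ-* c a)) (desc-map c l) ⟩
    constₚ c *ₚ constₚ a *ₚ X^ (length l) +ₚ constₚ c *ₚ desc l
      ≈⟨ solve 4 (λ c a x l → c :* a :* x :+ c :* l := c :* (a :* x :+ l)) R.refl (constₚ c) (constₚ a) (X^ (length l)) (desc l) ⟩
    constₚ c *ₚ desc (a ∷ l) ∎

  length-subtractPrefix : ∀ f l → length l ℕ.≤ length f → length (subtractPrefix f l) ≡ length f
  length-subtractPrefix f       []      _           = cong length (subtractPrefix-[] f)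
  length-subtractPrefix (x ∷ f) (y ∷ l) (ℕ.s≤s l≤f) = cong suc (length-subtractPrefix f l l≤f)

  desc-subtractPrefix : ∀ f l → length l ℕ.≤ length f →
    desc (subtractPrefix f l) ≋ desc f -ₚ desc l *ₚ X^ (length f ∸ length l)
  desc-subtractPrefix f [] _ = begin
    desc (subtractPrefix f [])   ≡⟨ cong desc (subtractPrefix-[] f) ⟩
    desc f                       ≈⟨ R.+-identityʳ (desc f) ⟨
    desc f -ₚ []                 ∎
  desc-subtractPrefix (x ∷ f) (y ∷ l) (ℕ.s≤s l≤f) = begin
    constₚ (x ℤ.- y) *ₚ X^ (length (subtractPrefix f l)) +ₚ desc (subtractPrefix f l)
      ≡⟨ cong (λ n → constₚ (x ℤ.- y) *ₚ X^ n +ₚ desc (subtractPrefix f l)) (length-subtractPrefix f l l≤f) ⟩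
    constₚ (x ℤ.- y) *ₚ X^ n +ₚ desc (subtractPrefix f l)
      ≈⟨ R.+-cong (R.*-congˡ {constₚ (x ℤ.- y)} X^n≋) (desc-subtractPrefix f l l≤f) ⟩
    (constₚ x -ₚ constₚ y) *ₚ (X^ m *ₚ X^ e) +ₚ (desc f -ₚ desc l *ₚ X^ e)
      ≈⟨ solve 6 (λ x y a b f l → (x :- y) :* (a :* b) :+ (f :- l :* b) := x :* (a :* b) :+ f :- (y :* a :+ l) :* b) R.refl
           (constₚ x) (constₚ y) (X^ m) (X^ e) (desc f) (desc l) ⟩
    constₚ x *ₚ (X^ m *ₚ X^ e) +ₚ desc f -ₚ desc (y ∷ l) *ₚ X^ e
      ≈⟨ R.+-congʳ {negₚ (desc (y ∷ l) *ₚ X^ e)} (R.+-congʳ {desc f} (R.*-congˡ {constₚ x} X^n≋)) ⟨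
    desc (x ∷ f) -ₚ desc (y ∷ l) *ₚ X^ e ∎
    where
    n = length f
    m = length l
    e = n ∸ m
    X^n≋ : X^ n ≋ X^ m *ₚ X^ e
    X^n≋ = ≋-trans (R.reflexive (cong X^ (≡.sym (ℕ.m+[n∸m]≡n l≤f)))) (X^-+ m e)

  -- The length of the quotient belongs to the induction because it decides which power of X the
  -- next quotient coefficient multiplies.
  long-division : ∀ k gt f → length f ℕ.≤ k → let Q = quotient k gt f in
    length Q ≡ length f ∸ length gt ×
    ∃[ r ] Below r (length gt) × desc f ≋ desc (+ 1 ∷ gt) *ₚ desc Q +ₚ r
  long-division zero    gt [] _ = ≡.sym (ℕ.0∸n≡0 (length gt)) , [] , (λ _ _ → ≡.refl) ,
    ≋-sym (≋-trans (R.+-identityʳ _) (R.zeroʳ (desc (+ 1 ∷ gt))))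
  long-division (suc k) gt [] _ = ≡.sym (ℕ.0∸n≡0 (length gt)) , [] , (λ _ _ → ≡.refl) ,
    ≋-sym (≋-trans (R.+-identityʳ _) (R.zeroʳ (desc (+ 1 ∷ gt))))
  long-division (suc k) gt (c ∷ f) (ℕ.s≤s f≤k) rewrite quotient-suc k gt c f
    with length f <ᵇ length gt in eq
  ... | true = ≡.sym (ℕ.m≤n⇒m∸n≡0 f<gt) , desc (c ∷ f) ,
      (λ i gt≤i → desc-below (c ∷ f) i (ℕ.≤-trans f<gt gt≤i)) ,
      ≋-sym (R.+-congʳ (R.zeroʳ (desc (+ 1 ∷ gt))))
    where
    f<gt : length f ℕ.< length gt
    f<gt = ℕ.<ᵇ⇒< (length f) (length gt) (≡.subst T (≡.sym eq) _)
  ... | false = length-eq , r , r-below , (begin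
      constₚ c *ₚ X^ n +ₚ desc f
        ≈⟨ R.+-congʳ {desc f} (R.*-congˡ {constₚ c} X^n≋) ⟩
      constₚ c *ₚ (X^ m *ₚ X^ e) +ₚ desc f
        ≈⟨ solve 5 (λ c a b f g → c :* (a :* b) :+ f := c :* (a :* b) :+ c :* g :* b :+ (f :- c :* g :* b)) R.refl
             (constₚ c) (X^ m) (X^ e) (desc f) (desc gt) ⟩
      constₚ c *ₚ (X^ m *ₚ X^ e) +ₚ constₚ c *ₚ desc gt *ₚ X^ e +ₚ (desc f -ₚ constₚ c *ₚ desc gt *ₚ X^ e)
        ≈⟨ R.+-congˡ {constₚ c *ₚ (X^ m *ₚ X^ e) +ₚ constₚ c *ₚ desc gt *ₚ X^ e} step ⟩
      constₚ c *ₚ (X^ m *ₚ X^ e) +ₚ constₚ c *ₚ desc gt *ₚ X^ e +ₚ (desc (+ 1 ∷ gt) *ₚ desc Q +ₚ r)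
        ≈⟨ solve 6 (λ c a b g Q r → c :* (a :* b) :+ c :* g :* b :+ ((one :* a :+ g) :* Q :+ r)
             := (one :* a :+ g) :* (c :* b :+ Q) :+ r) R.refl
             (constₚ c) (X^ m) (X^ e) (desc gt) (desc Q) r ⟩
      desc (+ 1 ∷ gt) *ₚ (constₚ c *ₚ X^ e +ₚ desc Q) +ₚ r
        ≡⟨ cong (λ k → desc (+ 1 ∷ gt) *ₚ (constₚ c *ₚ X^ k +ₚ desc Q) +ₚ r) Q-length ⟨
      desc (+ 1 ∷ gt) *ₚ desc (c ∷ Q) +ₚ r ∎)
    where
    n = length f
    m = length gt
    e = n ∸ m
    m≤n : m ℕ.≤ n
    m≤n = ℕ.≮⇒≥ λ n<m → ≡.subst T eq (ℕ.<⇒<ᵇ n<m)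
    X^n≋ : X^ n ≋ X^ m *ₚ X^ e
    X^n≋ = ≋-trans (R.reflexive (cong X^ (≡.sym (ℕ.m+[n∸m]≡n m≤n)))) (X^-+ m e)
    map≤ : length (map (c ℤ.*_) gt) ℕ.≤ n
    map≤ = ℕ.≤-trans (ℕ.≤-reflexive (length-map _ gt)) m≤n
    f′ = subtractPrefix f (map (c ℤ.*_) gt)
    Q = quotient k gt f′
    f′-length : length f′ ≡ n
    f′-length = length-subtractPrefix f _ map≤
    ih = long-division k gt f′ (ℕ.≤-trans (ℕ.≤-reflexive f′-length) f≤k)
    Q-length : length Q ≡ e
    Q-length = ≡.trans (proj₁ ih) (cong (_∸ m) f′-length)
    length-eq : suc (length Q) ≡ suc n ∸ m
    length-eq = ≡.trans (cong suc Q-length) (≡.sym (ℕ.+-∸-assoc 1 m≤n))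
    r = proj₁ (proj₂ ih)
    r-below = proj₁ (proj₂ (proj₂ ih))
    step : desc f -ₚ constₚ c *ₚ desc gt *ₚ X^ e ≋ desc (+ 1 ∷ gt) *ₚ desc Q +ₚ r
    step = begin
      desc f -ₚ constₚ c *ₚ desc gt *ₚ X^ e
        ≈⟨ R.+-congˡ (R.-‿cong (R.*-congʳ (desc-map c gt))) ⟨
      desc f -ₚ desc (map (c ℤ.*_) gt) *ₚ X^ e
        ≡⟨ cong (λ k → desc f -ₚ desc (map (c ℤ.*_) gt) *ₚ X^ (n ∸ k)) (length-map _ gt) ⟨
      desc f -ₚ desc (map (c ℤ.*_) gt) *ₚ X^ (n ∸ length (map (c ℤ.*_) gt))
        ≈⟨ desc-subtractPrefix f _ map≤ ⟨
      desc f′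
        ≈⟨ proj₂ (proj₂ (proj₂ ih)) ⟩
      desc (+ 1 ∷ gt) *ₚ desc Q +ₚ r ∎

  record Monic (f : Poly) (n : ℕ) : Set where
    constructor monic
    field
      monic-below : Below f (suc n)
      monic-top   : coeff f n ≡ + 1
  open Monic public

  monic⇒degree : ∀ {f n} → Monic f n → Degree f n
  monic⇒degree (monic b t) = degree b λ t≡0 → contradiction (≡.trans (≡.sym t) t≡0) λ ()

  cons0-∷ : ∀ a x f → cons0 a (x ∷ f) ≡ a ∷ x ∷ f
  cons0-∷ (+ zero)   x f = ≡.refl
  cons0-∷ (+ suc _)  x f = ≡.refl
  cons0-∷ ℤ.-[1+ _ ] x f = ≡.refl

  -- `strip` removes only zeros above degree n, so the reversed list begins with the leading 1, the
  -- shape that `long-division` presupposes.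
  reverse-strip-monic : ∀ {g n} → Monic g n →
    ∃[ gt ] reverse (strip g) ≡ + 1 ∷ gt × length gt ≡ n
  reverse-strip-monic {a ∷ f} {zero} (monic b ≡.refl)
    rewrite strip-≋[] f (pointwise λ i → b (suc i) ℕ.z<s) = [] , ≡.refl , ≡.refl
  reverse-strip-monic {a ∷ f} {suc n} (monic b t)
    with gt , eq , len ← reverse-strip-monic {f} {n} (monic (λ i n<i → b (suc i) (ℕ.s≤s n<i)) t)
    = gt ∷ʳ a , rev , ≡.trans (length-++ gt) (≡.trans (ℕ.+-comm (length gt) 1) (cong suc len))
    where
    cons0-nonempty : ∀ {s} → reverse s ≡ + 1 ∷ gt → cons0 a s ≡ a ∷ s
    cons0-nonempty {[]} ()
    cons0-nonempty {x ∷ s} _ = cons0-∷ a x s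
    rev : reverse (cons0 a (strip f)) ≡ + 1 ∷ gt ∷ʳ a
    rev = ≡.trans (cong reverse (cons0-nonempty eq))
            (≡.trans (unfold-reverse a (strip f)) (cong (_∷ʳ a) eq))

  length-strip : ∀ f → length (strip f) ℕ.≤ length f
  length-strip []      = ℕ.z≤n
  length-strip (a ∷ f) = ℕ.≤-trans (length-cons0 a (strip f)) (ℕ.s≤s (length-strip f))
    where
    length-cons0 : ∀ a f → length (cons0 a f) ℕ.≤ suc (length f)
    length-cons0 (+ zero)     []      = ℕ.z≤n
    length-cons0 (+ zero)     (_ ∷ _) = ℕ.≤-refl
    length-cons0 (+ suc _)    f       = ℕ.≤-refl
    length-cons0 ℤ.-[1+ _ ]   f       = ℕ.≤-refl

  division-with-remainder : ∀ {g n} → Monic g n → ∀ f →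
    ∃[ r ] Below r n × f ≋ g *ₚ divMonic f g +ₚ r
  division-with-remainder {g} {n} g-monic f
    = proj₁ (proj₂ division) , ≡.subst (Below (proj₁ (proj₂ division))) len≡ (proj₁ (proj₂ (proj₂ division))) , (begin
      f                                     ≈⟨ desc-reverse f ⟨
      desc (reverse (strip f))              ≈⟨ proj₂ (proj₂ (proj₂ division)) ⟩
      desc (+ 1 ∷ gt) *ₚ desc Q +ₚ proj₁ (proj₂ division)        ≡⟨ cong (λ l → desc l *ₚ desc Q +ₚ proj₁ (proj₂ division)) rev≡ ⟨
      desc (reverse (strip g)) *ₚ desc Q +ₚ proj₁ (proj₂ division) ≈⟨ R.+-congʳ (R.*-cong (desc-reverse g) Q≋) ⟩
      g *ₚ divMonic f g +ₚ proj₁ (proj₂ division)                ∎)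
    where
    gt = proj₁ (reverse-strip-monic g-monic)
    rev≡ = proj₁ (proj₂ (reverse-strip-monic g-monic))
    len≡ = proj₂ (proj₂ (reverse-strip-monic g-monic))
    division = long-division (length f) gt (reverse (strip f))
      (ℕ.≤-trans (ℕ.≤-reflexive (length-reverse (strip f))) (length-strip f))
    Q = quotient (length f) gt (reverse (strip f))

    desc-reverse : ∀ f → desc (reverse (strip f)) ≋ f
    desc-reverse f = begin
      desc (reverse (strip f))      ≈⟨ reverse≋desc (reverse (strip f)) ⟨
      reverse (reverse (strip f))   ≡⟨ reverse-involutive (strip f) ⟩
      strip f                       ≈⟨ strip-≋ f ⟩
      f                             ∎

    Q≋ : desc Q ≋ divMonic f g
    Q≋ = begin
      desc Q                                ≈⟨ reverse≋desc Q ⟨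
      reverse Q                             ≡⟨ cong (λ r → divMonicBy reverse (length f) r (reverse (strip f))) rev≡ ⟨
      divMonicBy reverse (length f) (reverse (strip g)) (reverse (strip f)) ≡⟨ divMonic-unfold f g ⟨
      divMonic f g                          ∎

  small-multiple : ∀ {g n z} → Monic g n → Below (g *ₚ z) n → z ≋ []
  small-multiple {g} {n} {z} g-monic gz-below with zero-or-degree z
  ... | inj₁ z≋0     = z≋0
  ... | inj₂ (m , d) = contradiction (gz-below (n ℕ.+ m) (ℕ.m≤m+n n m))
                         (leading (degree-* (monic⇒degree g-monic) d))

  -- Integral Bézout arguments yield divisibility of an integer multiple of f only. With quotient Q
  -- and remainder r, c r = g (z - c Q) is a multiple of g of degree below that of g, so z = c Q and
  -- then r = 0.
  divMonic-exact : ∀ {c f g z n} → Monic g n → c ≢ + 0 → constₚ c *ₚ f ≋ g *ₚ z →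
                   f ≋ g *ₚ divMonic f g
  divMonic-exact {c} {f} {g} {z} {n} g-monic c≢0 cf≋gz = begin
      f               ≈⟨ f≋ ⟩
      g *ₚ Q +ₚ r     ≈⟨ R.+-congˡ {g *ₚ Q} r≋0 ⟩
      g *ₚ Q +ₚ []    ≈⟨ R.+-identityʳ (g *ₚ Q) ⟩
      g *ₚ Q          ∎
    where
    Q = divMonic f g
    r = proj₁ (division-with-remainder g-monic f)
    f≋ = proj₂ (proj₂ (division-with-remainder g-monic f))
    d = z -ₚ constₚ c *ₚ Q

    gd≋cr : g *ₚ d ≋ constₚ c *ₚ r
    gd≋cr = begin
      g *ₚ d
        ≈⟨ solve 4 (λ g z c Q → g :* (z :- c :* Q) := g :* z :- c :* (g :* Q)) R.refl g z (constₚ c) Q ⟩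
      g *ₚ z -ₚ constₚ c *ₚ (g *ₚ Q)
        ≈⟨ R.+-congʳ (≋-sym cf≋gz) ⟩
      constₚ c *ₚ f -ₚ constₚ c *ₚ (g *ₚ Q)
        ≈⟨ R.+-congʳ {negₚ (constₚ c *ₚ (g *ₚ Q))} (R.*-congˡ {constₚ c} f≋) ⟩
      constₚ c *ₚ (g *ₚ Q +ₚ r) -ₚ constₚ c *ₚ (g *ₚ Q)
        ≈⟨ solve 3 (λ c x r → c :* (x :+ r) :- c :* x := c :* r) R.refl (constₚ c) (g *ₚ Q) r ⟩
      constₚ c *ₚ r ∎

    coeff-c* : ∀ i → coeff (constₚ c *ₚ r) i ≡ c ℤ.* coeff r i
    coeff-c* i = ≡.trans (coeff-∷* c [] r i)
      (≡.trans (cong (λ x → c ℤ.* coeff r i ℤ.+ x) (coeff-0∷[] i)) (ℤ.+-identityʳ _))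

    d≋0 : d ≋ []
    d≋0 = small-multiple g-monic λ i n≤i → ≡.trans (coeff-≡ gd≋cr i) (≡.trans (coeff-c* i)
      (≡.trans (cong (c ℤ.*_) (proj₁ (proj₂ (division-with-remainder g-monic f)) i n≤i)) (ℤ.*-zeroʳ c)))

    r≋0 : r ≋ []
    r≋0 = pointwise λ i → Sum.fromInj₂ (λ c≡0 → contradiction c≡0 c≢0) (ℤ.i*j≡0⇒i≡0∨j≡0 c
      (≡.trans (≡.sym (coeff-c* i)) (≡.trans (≡.sym (coeff-≡ gd≋cr i)) (coeff-≡ (≋-trans (R.*-congˡ {g} d≋0) (R.zeroʳ g)) i))))

  monic-resp : ∀ {f g n} → f ≋ g → Monic f n → Monic g n
  monic-resp (pointwise p) (monic b t) =
    monic (λ i n<i → ≡.trans (≡.sym (p i)) (b i n<i)) (≡.trans (≡.sym (p _)) t)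

  monic-one : Monic oneₚ 0
  monic-one = monic (λ { (suc i) _ → ≡.refl }) ≡.refl

  monic-* : ∀ {f g n m} → Monic f n → Monic g m → Monic (f *ₚ g) (n ℕ.+ m)
  monic-* {f} {g} {n} {m} (monic fb ft) (monic gb gt)
    with b , t ← top-coeff {f} {g} {n} {m} fb gb
    = monic b (≡.trans t (≡.cong₂ ℤ._*_ ft gt))

  monic-cofactor : ∀ {f g h n m} → Monic f n → Monic g m → f ≋ g *ₚ h → ∃[ k ] Monic h k
  monic-cofactor {f} {g} {h} {n} {m} f-monic g-monic f≋gh with zero-or-degree h
  ... | inj₁ h≋0 = contradiction (≋-trans f≋gh (≋-trans (R.*-congˡ {g} h≋0) (R.zeroʳ g)))
                     (degree⇒≉0 (monic⇒degree f-monic))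
  ... | inj₂ (k , d) = k , monic (below d) 
    (≡.trans (≡.sym (ℤ.*-identityˡ _))
    (≡.trans (cong (ℤ._* coeff h k) (≡.sym (monic-top g-monic)))
    (≡.trans (≡.sym (proj₂ (top-coeff {g} {h} {m} {k} (monic-below g-monic) (below d))))
    (≡.trans (≡.sym (coeff-≡ f≋gh (m ℕ.+ k)))
    (≡.trans (cong (coeff f) m+k≡n) (monic-top f-monic))))))
    where
    dgh = degree-* (monic⇒degree g-monic) d
    m+k≡n : m ℕ.+ k ≡ n
    m+k≡n = ℕ.≤-antisym
      (ℕ.≮⇒≥ λ n<m+k → leading dgh (≡.trans (≡.sym (coeff-≡ f≋gh _)) (monic-below f-monic _ n<m+k)))
      (ℕ.≮⇒≥ λ m+k<n → leading (monic⇒degree f-monic) (≡.trans (coeff-≡ f≋gh _) (below dgh _ m+k<n)))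

-- Bézout coprimality and cyclotomic factors

module Coprimality {c ℓ : Level} (R : CommutativeRing c ℓ) where

  open CommutativeRing R
  open IntegerCoefficients R
  open import Algebra.Properties.Semiring.Exp semiring using (_^_; ^-homo-*)
  open import Data.Nat.Divisibility using (_∣_; _∣?_; divides; ∣-refl; ∣-trans; ∣⇒≤; 0∣⇒≡0)
  open import Data.Nat.GCD using (module GCD; module Bézout)
  open import Data.Sum.Base using ([_,_])
  open import Function.Base using (_∘_)
  open import Relation.Binary.Reasoning.Setoid setoid

  private
    one : ∀ {n} → Polynomial n
    one = con (+ 1)

  _≢0×≢0⇒*≢0_ : ∀ {a b} → a ≢ + 0 → b ≢ + 0 → a ℤ.* b ≢ + 0
  _≢0×≢0⇒*≢0_ {a} a≢0 b≢0 = [ a≢0 , b≢0 ] ∘ ℤ.i*j≡0⇒i≡0∨j≡0 a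

  infix 4 _⊥_
  _⊥_ : Carrier → Carrier → Set _
  x ⊥ y = ∃[ u ] ∃[ v ] ∃[ k ] (k ≢ + 0 × u * x + v * y ≈ fromℤ k)

  ⊥-sym : ∀ {x y} → x ⊥ y → y ⊥ x
  ⊥-sym (u , v , k , k≢0 , eq) = v , u , k , k≢0 , trans (+-comm _ _) eq

  ⊥-respˡ : ∀ {x y z} → x ≈ y → x ⊥ z → y ⊥ z
  ⊥-respˡ x≈y (u , v , k , k≢0 , eq) = u , v , k , k≢0 , trans (+-congʳ (*-congˡ (sym x≈y))) eq

  1⊥ : ∀ {x} → 1# ⊥ x
  1⊥ {x} = 1# , 0# , + 1 , (λ ()) , solve 1 (λ x → one :* one :+ con (+ 0) :* x := one) refl x

  *⊥ : ∀ {x y z} → x ⊥ z → y ⊥ z → x * y ⊥ z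
  *⊥ {x} {y} {z} (u , v , k , k≢0 , eq) (u′ , v′ , k′ , k′≢0 , eq′) =
    u * u′ , u * x * v′ + v * (u′ * y + v′ * z) , k ℤ.* k′ , k≢0 ≢0×≢0⇒*≢0 k′≢0 , (begin
      u * u′ * (x * y) + (u * x * v′ + v * (u′ * y + v′ * z)) * z
        ≈⟨ solve 7 (λ x y z u v u′ v′ →
             u :* u′ :* (x :* y) :+ (u :* x :* v′ :+ v :* (u′ :* y :+ v′ :* z)) :* z
             := (u :* x :+ v :* z) :* (u′ :* y :+ v′ :* z)) refl x y z u v u′ v′ ⟩
      (u * x + v * z) * (u′ * y + v′ * z)   ≈⟨ *-cong eq eq′ ⟩
      fromℤ k * fromℤ k′                    ≈⟨ fromℤ-* k k′ ⟨
      fromℤ (k ℤ.* k′)                      ∎)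

  combination⊥ : ∀ {w x y z p} → w ≈ x * y + z * p → w ⊥ p → y ⊥ p
  combination⊥ {w} {x} {y} {z} {p} w≈ (u , v , k , k≢0 , eq) = u * x , u * z + v , k , k≢0 , (begin
    u * x * y + (u * z + v) * p
      ≈⟨ solve 6 (λ x y z p u v → u :* x :* y :+ (u :* z :+ v) :* p := u :* (x :* y :+ z :* p) :+ v :* p) refl x y z p u v ⟩
    u * (x * y + z * p) + v * p   ≈⟨ +-congʳ (*-congˡ w≈) ⟨
    u * w + v * p                 ≈⟨ eq ⟩
    fromℤ k                       ∎)

  factor⊥ : ∀ {w x y p} → w ≈ x * y → w ⊥ p → y ⊥ p
  factor⊥ {w} {x} {y} {p} w≈ = combination⊥ {z = 0#} (trans w≈
    (solve 3 (λ x y p → x :* y := x :* y :+ con (+ 0) :* p) refl x y p))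

  +*⊥ : ∀ {x y z} → x ⊥ z → x + y * z ⊥ z
  +*⊥ {x} {y} {z} (u , v , k , k≢0 , eq) = u , v - u * y , k , k≢0 , trans
    (solve 5 (λ x y z u v → u :* (x :+ y :* z) :+ (v :- u :* y) :* z := u :* x :+ v :* z) refl x y z u v) eq

  ⊥-power : ∀ {x y} k → x ⊥ y → x ^ k ⊥ y
  ⊥-power zero    x⊥y = 1⊥
  ⊥-power (suc k) x⊥y = *⊥ x⊥y (⊥-power k x⊥y)

  fromℤ⊥ : ∀ {k x} → k ≢ + 0 → fromℤ k ⊥ x
  fromℤ⊥ {k} {x} k≢0 = 1# , 0# , k , k≢0 ,
    solve 2 (λ k x → one :* k :+ con (+ 0) :* x := k) refl (fromℤ k) x

  -- Quotients and greatest common divisors of the elements q^n - 1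

  module PowersMinusOne (q : Carrier) where

    w : ℕ → Carrier
    w n = q ^ n - 1#

    w-+ : ∀ m n → w (m ℕ.+ n) ≈ w m + q ^ m * w n
    w-+ m n = begin
      q ^ (m ℕ.+ n) - 1#     ≈⟨ +-congʳ (^-homo-* q m n) ⟩
      q ^ m * q ^ n - 1#     ≈⟨ solve 2 (λ x y → x :* y :- one := x :- one :+ x :* (y :- one)) refl (q ^ m) (q ^ n) ⟩
      w m + q ^ m * w n      ∎

    -- σ n k is the geometric sum 1 + q^n + ... + q^{n(k-1)}, and τ n k is the quotient of σ n k - k
    -- by q^n - 1.
    σ τ : ℕ → ℕ → Carrier
    σ n zero    = 0#
    σ n (suc k) = 1# + q ^ n * σ n k
    τ n zero    = 0#
    τ n (suc k) = τ n k + σ n k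

    w-* : ∀ k n → w (k ℕ.* n) ≈ w n * σ n k
    w-* zero n = trans (-‿inverseʳ 1#) (sym (zeroʳ _))
    w-* (suc k) n = begin
      w (n ℕ.+ k ℕ.* n)             ≈⟨ w-+ n (k ℕ.* n) ⟩
      w n + q ^ n * w (k ℕ.* n)     ≈⟨ +-congˡ (*-congˡ (w-* k n)) ⟩
      w n + q ^ n * (w n * σ n k)   ≈⟨ solve 3 (λ w x s → w :+ x :* (w :* s) := w :* (one :+ x :* s)) refl (w n) (q ^ n) (σ n k) ⟩
      w n * σ n (suc k)             ∎

    σ≈ : ∀ n k → σ n k ≈ fromℤ (+ k) + τ n k * w n
    σ≈ n zero = solve 1 (λ w → con (+ 0) := con (+ 0) :+ con (+ 0) :* w) refl (w n)
    σ≈ n (suc k) = begin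
      1# + q ^ n * σ n k
        ≈⟨ solve 2 (λ x s → one :+ x :* s := one :+ (s :+ s :* (x :- one))) refl (q ^ n) (σ n k) ⟩
      1# + (σ n k + σ n k * w n)
        ≈⟨ +-congˡ (+-congʳ (σ≈ n k)) ⟩
      1# + (fromℤ (+ k) + τ n k * w n + σ n k * w n)
        ≈⟨ solve 4 (λ k t s w → one :+ (k :+ t :* w :+ s :* w) := one :+ k :+ (t :+ s) :* w) refl (fromℤ (+ k)) (τ n k) (σ n k) (w n) ⟩
      1# + fromℤ (+ k) + (τ n k + σ n k) * w n
        ≈⟨ +-congʳ (fromℤ-+ (+ 1) (+ k)) ⟨
      fromℤ (+ suc k) + τ n (suc k) * w n ∎

    -- Modulo q^n - 1 the geometric sum is the integer k. Already 1 + q and q - 1 combine over ℤ[q]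
    -- to 2 but not to 1, hence the nonzero integer in `_⊥_`.
    σ⊥w : ∀ n k → 0 ℕ.< k → σ n k ⊥ w n
    σ⊥w n (suc k) _ = ⊥-respˡ (sym (σ≈ n (suc k))) (+*⊥ (fromℤ⊥ {+ suc k} λ ()))

    q⊥w : ∀ n → 0 ℕ.< n → q ⊥ w n
    q⊥w (suc n) _ = q ^ n , - 1# , + 1 , (λ ()) ,
      solve 2 (λ q x → x :* q :+ (:- one) :* (q :* x :- one) := one) refl q (q ^ n)

    -- A relation g + y n = x m between exponents becomes w(g) = w(x m) - q^g w(y n), and w(x m),
    -- w(y n) are multiples of w(m), w(n).
    w-bezout : ∀ {g m n} → Bézout.Identity g m n → ∃[ x ] ∃[ y ] w g ≈ x * w m + y * w n
    w-bezout {g} {m} {n} (Bézout.+- x y eq) = σ m x , - (q ^ g * σ n y) , (begin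
      w g
        ≈⟨ solve 2 (λ a b → a := a :+ b :- b) refl (w g) (q ^ g * w (y ℕ.* n)) ⟩
      w g + q ^ g * w (y ℕ.* n) - q ^ g * w (y ℕ.* n)
        ≈⟨ +-congʳ (w-+ g (y ℕ.* n)) ⟨
      w (g ℕ.+ y ℕ.* n) - q ^ g * w (y ℕ.* n)
        ≡⟨ ≡.cong (λ k → w k - q ^ g * w (y ℕ.* n)) eq ⟩
      w (x ℕ.* m) - q ^ g * w (y ℕ.* n)
        ≈⟨ +-cong (w-* x m) (-‿cong (*-congˡ (w-* y n))) ⟩
      w m * σ m x - q ^ g * (w n * σ n y)
        ≈⟨ solve 5 (λ a b c d e → a :* b :- c :* (d :* e) := b :* a :+ (:- (c :* e)) :* d) refl (w m) (σ m x) (q ^ g) (w n) (σ n y) ⟩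
      σ m x * w m + - (q ^ g * σ n y) * w n ∎)
    w-bezout {g} {m} {n} (Bézout.-+ x y eq)
      with a , b , p ← w-bezout {g} {n} {m} (Bézout.+- y x eq) = b , a , trans p (+-comm _ _)

    -- The factorisation of q^n - 1 over the divisors of n

    module Cyclotomic
      (cancelʳ : ∀ {x y z} → ¬ z ≈ 0# → x * z ≈ y * z → x ≈ y)
      (w≉0 : ∀ n → 0 ℕ.< n → ¬ w n ≈ 0#)
      (φ : ℕ → Carrier) where

      part : ℕ → ℕ → Carrier
      part n i with i ∣? n
      ... | yes _ = φ i
      ... | no _  = 1#

      part-∣ : ∀ {n i} → i ∣ n → part n i ≡ φ i
      part-∣ {n} {i} i∣n with i ∣? n
      ... | yes _   = ≡.refl
      ... | no i∤n  = contradiction i∣n i∤n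

      part-∤ : ∀ {n i} → ¬ i ∣ n → part n i ≡ 1#
      part-∤ {n} {i} i∤n with i ∣? n
      ... | yes i∣n = contradiction i∣n i∤n
      ... | no _    = ≡.refl

      product : ℕ → ℕ → Carrier
      product n zero    = 1#
      product n (suc k) = product n k * part n (suc k)

      -- q^n - 1 is the product of φ i over i ∣ n, the other i ≤ n contributing 1. The lemmas below
      -- assume this only up to a bound, so they are available inside the induction that establishes
      -- it for `Φ`.
      IsCyclotomic : ℕ → Set _
      IsCyclotomic n = product n n ≈ w n

      φ∣w : ∀ {e n} → IsCyclotomic e → 0 ℕ.< e → e ∣ n → ∃[ z ] w n ≈ z * φ e
      φ∣w {suc e} {n} cyc _ (divides k ≡.refl) = product (suc e) e * σ (suc e) k , (begin
        w (k ℕ.* suc e)                                        ≈⟨ w-* k (suc e) ⟩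
        w (suc e) * σ (suc e) k                                ≈⟨ *-congʳ cyc ⟨
        product (suc e) e * part (suc e) (suc e) * σ (suc e) k ≡⟨ ≡.cong (λ p → product (suc e) e * p * σ (suc e) k) (part-∣ {suc e} ∣-refl) ⟩
        product (suc e) e * φ (suc e) * σ (suc e) k
          ≈⟨ solve 3 (λ a b c → a :* b :* c := a :* c :* b) refl (product (suc e) e) (φ (suc e)) (σ (suc e) k) ⟩
        product (suc e) e * σ (suc e) k * φ (suc e) ∎)

      product-∣ : ∀ {g d} → g ∣ d → ∀ k → ∃[ z ] product d k ≈ z * product g k
      product-∣ g∣d zero = 1# , sym (*-identityˡ 1#)
      product-∣ {g} {d} g∣d (suc k) with product-∣ {g} {d} g∣d k | suc k ∣? g
      ... | z , eq | no _ = z * part d (suc k) , (begin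
        product d k * part d (suc k)             ≈⟨ *-congʳ eq ⟩
        z * product g k * part d (suc k)
          ≈⟨ solve 3 (λ a b c → a :* b :* c := a :* c :* (b :* one)) refl z (product g k) (part d (suc k)) ⟩
        z * part d (suc k) * (product g k * 1#)  ∎)
      ... | z , eq | yes k∣g = z , (begin
        product d k * part d (suc k)     ≡⟨ ≡.cong (product d k *_) (part-∣ (∣-trans k∣g g∣d)) ⟩
        product d k * φ (suc k)          ≈⟨ *-congʳ eq ⟩
        z * product g k * φ (suc k)      ≈⟨ *-assoc _ _ _ ⟩
        z * (product g k * φ (suc k))    ∎)

      product-beyond : ∀ {g} k → 0 ℕ.< g → product g (k ℕ.+ g) ≈ product g g
      product-beyond zero _ = refl
      product-beyond {suc g} (suc k) g>0 = begin
        product (suc g) (k ℕ.+ suc g) * part (suc g) (suc k ℕ.+ suc g)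
          ≡⟨ ≡.cong (product (suc g) (k ℕ.+ suc g) *_) (part-∤ λ ∣g → ℕ.<-irrefl ≡.refl
               (ℕ.<-≤-trans (ℕ.s≤s (ℕ.m≤n+m (suc g) k)) (∣⇒≤ ∣g))) ⟩
        product (suc g) (k ℕ.+ suc g) * 1#
          ≈⟨ *-identityʳ _ ⟩
        product (suc g) (k ℕ.+ suc g)
          ≈⟨ product-beyond k g>0 ⟩
        product (suc g) (suc g) ∎

      -- All factors φ i of q^g - 1 occur among the factors of q^d - 1 other than φ d. Hence φ d
      -- divides (q^d - 1)/(q^g - 1), a geometric sum coprime to q^g - 1.
      divisor⊥φ : ∀ {g d} → 0 ℕ.< g → g ℕ.< d → g ∣ d → IsCyclotomic g → IsCyclotomic d → w g ⊥ φ d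
      divisor⊥φ {g} {suc d} g>0 (ℕ.s≤s g≤d) g∣d@(divides k d≡kg) cyc-g cyc-d
        with z , eq ← product-∣ {g} {suc d} g∣d d
        = ⊥-sym (factor⊥ σ≈zφ (σ⊥w g k k>0))
        where
        k>0 : 0 ℕ.< k
        k>0 = ℕ.n≢0⇒n>0 λ k≡0 → ℕ.1+n≢0 (≡.trans d≡kg (≡.cong (ℕ._* g) k≡0))
        zw≈ : product (suc d) d ≈ z * w g
        zw≈ = begin
          product (suc d) d                    ≈⟨ eq ⟩
          z * product g d                      ≡⟨ ≡.cong (λ i → z * product g i) (≡.sym (ℕ.m∸n+n≡m g≤d)) ⟩
          z * product g (d ℕ.∸ g ℕ.+ g)        ≈⟨ *-congˡ (product-beyond (d ℕ.∸ g) g>0) ⟩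
          z * product g g                      ≈⟨ *-congˡ cyc-g ⟩
          z * w g                              ∎
        σ≈zφ : σ g k ≈ z * φ (suc d)
        σ≈zφ = cancelʳ (w≉0 g g>0) (begin
          σ g k * w g                          ≈⟨ *-comm _ _ ⟩
          w g * σ g k                          ≈⟨ w-* k g ⟨
          w (k ℕ.* g)                          ≡⟨ ≡.cong w d≡kg ⟨
          w (suc d)                            ≈⟨ cyc-d ⟨
          product (suc d) d * part (suc d) (suc d) ≡⟨ ≡.cong (product (suc d) d *_) (part-∣ {suc d} ∣-refl) ⟩
          product (suc d) d * φ (suc d)        ≈⟨ *-congʳ zw≈ ⟩
          z * w g * φ (suc d)                  ≈⟨ solve 3 (λ a b c → a :* b :* c := a :* c :* b) refl z (w g) (φ (suc d)) ⟩
          z * φ (suc d) * w g                  ∎)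

      -- For g = gcd(d, l), q^g - 1 is a combination of q^d - 1 and q^l - 1, and the first of these
      -- is a multiple of φ d. As d ∤ l, g is a proper divisor of d and `divisor⊥φ` applies.
      w⊥φ : ∀ {l d} → 0 ℕ.< d → (∀ e → 0 ℕ.< e → e ℕ.≤ d → IsCyclotomic e) → ¬ d ∣ l → w l ⊥ φ d
      w⊥φ {l} {d} d>0 cyc d∤l with Bézout.lemma d l
      ... | Bézout.result g isGCD identity
        with x , y , eq ← w-bezout identity
        with v , wd≈ ← φ∣w (cyc d d>0 ℕ.≤-refl) d>0 ∣-refl
        = combination⊥ {z = x * v} (begin
            w g                            ≈⟨ eq ⟩
            x * w d + y * w l              ≈⟨ +-congʳ (*-congˡ wd≈) ⟩
            x * (v * φ d) + y * w l
              ≈⟨ solve 5 (λ x v f y l → x :* (v :* f) :+ y :* l := y :* l :+ x :* v :* f) refl x v (φ d) y (w l) ⟩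
            y * w l + x * v * φ d          ∎)
          (divisor⊥φ g>0 g<d g∣d (cyc g g>0 (ℕ.<⇒≤ g<d)) (cyc d d>0 ℕ.≤-refl))
        where
        gcd∣m = proj₁ (GCD.commonDivisor isGCD)
        gcd∣n = proj₂ (GCD.commonDivisor isGCD)
        g∣d = gcd∣m
        g>0 : 0 ℕ.< g
        g>0 = ℕ.n≢0⇒n>0 λ { ≡.refl → ℕ.<-irrefl (≡.sym (0∣⇒≡0 g∣d)) d>0 }
        g<d : g ℕ.< d
        g<d = ℕ.≤∧≢⇒< (∣⇒≤ {{ℕ.>-nonZero d>0}} g∣d) λ { ≡.refl → d∤l gcd∣n }

      φ⊥φ : ∀ {e d} → 0 ℕ.< e → e ℕ.< d → (∀ e → 0 ℕ.< e → e ℕ.≤ d → IsCyclotomic e) → φ e ⊥ φ d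
      φ⊥φ {e} {d} e>0 e<d cyc with z , eq ← φ∣w (cyc e e>0 (ℕ.<⇒≤ e<d)) e>0 ∣-refl
        = factor⊥ eq (w⊥φ (ℕ.<-trans e>0 e<d) cyc λ d∣e →
            ℕ.<⇒≱ e<d (∣⇒≤ {{ℕ.>-nonZero e>0}} d∣e))

      part⊥φ : ∀ {n e d} → 0 ℕ.< e → e ℕ.< d → (∀ e → 0 ℕ.< e → e ℕ.≤ d → IsCyclotomic e) → part n e ⊥ φ d
      part⊥φ {n} {e} e>0 e<d cyc with e ∣? n
      ... | yes _ = φ⊥φ e>0 e<d cyc
      ... | no _  = 1⊥

      product⊥φ : ∀ {n d} k → k ℕ.< d → (∀ e → 0 ℕ.< e → e ℕ.≤ d → IsCyclotomic e) → product n k ⊥ φ d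
      product⊥φ zero    k<d cyc = 1⊥
      product⊥φ {n} (suc k) k<d cyc =
        *⊥ (product⊥φ {n} k (ℕ.<-trans (ℕ.n<1+n k) k<d) cyc) (part⊥φ {n} ℕ.z<s k<d cyc)

      -- Pairwise coprime divisors of q^n - 1 are merged one at a time; each merge contributes the
      -- integer of its Bézout identity to b. Only the factors up to k are assumed cyclotomic, which
      -- makes the division defining the next one exact.
      product∣w : ∀ {n} k → (∀ e → 0 ℕ.< e → e ℕ.≤ k → IsCyclotomic e) →
                  ∃[ b ] ∃[ z ] (b ≢ + 0 × fromℤ b * w n ≈ product n k * z)
      product∣w {n} zero cyc = + 1 , w n , (λ ()) , refl
      product∣w {n} (suc k) cyc
        with product∣w {n} k (λ e e>0 e≤k → cyc e e>0 (ℕ.m≤n⇒m≤1+n e≤k)) | suc k ∣? n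
      ... | b , z , b≢0 , eq | no _ = b , z , b≢0 , trans eq (*-congʳ (sym (*-identityʳ _)))
      ... | b , z , b≢0 , eq | yes k∣n
        with y , wn≈ ← φ∣w (cyc (suc k) ℕ.z<s ℕ.≤-refl) ℕ.z<s k∣n
           | u , v , a , a≢0 , eq′ ← product⊥φ {n} {suc k} k (ℕ.n<1+n k) cyc
        = a ℤ.* b , u * (fromℤ b * y) + v * z , a≢0 ≢0×≢0⇒*≢0 b≢0 , (begin
          fromℤ (a ℤ.* b) * w n
            ≈⟨ *-congʳ (fromℤ-* a b) ⟩
          fromℤ a * fromℤ b * w n
            ≈⟨ *-congʳ (*-congʳ eq′) ⟨
          (u * p + v * f) * fromℤ b * w n
            ≈⟨ solve 6 (λ u p v f b w → (u :* p :+ v :* f) :* b :* w := u :* p :* b :* w :+ v :* f :* (b :* w))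
                 refl u p v f (fromℤ b) (w n) ⟩
          u * p * fromℤ b * w n + v * f * (fromℤ b * w n)
            ≈⟨ +-cong (*-congˡ wn≈) (*-congˡ eq) ⟩
          u * p * fromℤ b * (y * f) + v * f * (p * z)
            ≈⟨ solve 7 (λ u p v f b y z → u :* p :* b :* (y :* f) :+ v :* f :* (p :* z)
                 := p :* f :* (u :* (b :* y) :+ v :* z)) refl u p v f (fromℤ b) y z ⟩
          p * f * (u * (fromℤ b * y) + v * z) ∎)
        where
        p = product n k
        f = φ (suc k)

      q⊥φ : ∀ {d} → 0 ℕ.< d → IsCyclotomic d → q ⊥ φ d
      q⊥φ {d} d>0 cyc with v , wd≈ ← φ∣w cyc d>0 ∣-refl = ⊥-sym (factor⊥ wd≈ (⊥-sym (q⊥w d d>0)))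

      -- φ d divides q^l - 1 exactly once: the other factors of q^d - 1 are coprime to it, and (q^l
      -- - 1)/(q^d - 1) is coprime even to q^d - 1.
      w-multiple : ∀ {l d} → 0 ℕ.< d → (∀ e → 0 ℕ.< e → e ℕ.≤ d → IsCyclotomic e) → 0 ℕ.< l → d ∣ l →
                   ∃[ v ] (v ⊥ φ d × w l ≈ φ d * v)
      w-multiple {l} {suc d} d>0 cyc l>0 (divides k l≡kd) = Ψ * σ (suc d) k ,
        *⊥ (product⊥φ {suc d} d (ℕ.n<1+n d) cyc) (⊥-sym (factor⊥ wd≈ (⊥-sym (σ⊥w (suc d) k k>0)))) , (begin
          w l                        ≡⟨ ≡.cong w l≡kd ⟩
          w (k ℕ.* suc d)            ≈⟨ w-* k (suc d) ⟩
          w (suc d) * σ (suc d) k    ≈⟨ *-congʳ wd≈ ⟩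
          Ψ * φ (suc d) * σ (suc d) k
            ≈⟨ solve 3 (λ a b c → a :* b :* c := b :* (a :* c)) refl Ψ (φ (suc d)) (σ (suc d) k) ⟩
          φ (suc d) * (Ψ * σ (suc d) k) ∎)
        where
        Ψ = product (suc d) d
        k>0 : 0 ℕ.< k
        k>0 = ℕ.n≢0⇒n>0 λ { ≡.refl → ℕ.<-irrefl (≡.sym l≡kd) l>0 }
        wd≈ : w (suc d) ≈ Ψ * φ (suc d)
        wd≈ = trans (sym (cyc (suc d) d>0 ℕ.≤-refl)) (reflexive (≡.cong (Ψ *_) (part-∣ {suc d} ∣-refl)))

-- The polynomials `Φ` factor q^n - 1

module CyclotomicPolynomials where

  open IntegerPolynomials
  open MonicDivision

  open IntegerPolynomials
  open MonicDivision
  open import Data.Nat.Divisibility using (_∣_; _∣?_; ∣-refl)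
  open import Data.List.Base using (List; []; _∷_; map; filter; applyUpTo; _++_)
  open import Data.List.Properties using (map-cong-local; map-++; filter-++; filter-accept; filter-reject; applyUpTo-∷ʳ)
  open import Data.List.Relation.Unary.All as All using (All)
  import Data.List.Relation.Unary.All.Properties as All

  private module R = CommutativeRing ℤ[q]
  open import Algebra.Properties.Semiring.Exp R.semiring using (_^_)
  open import Algebra.Properties.Semiring.Mult.TCOptimised R.semiring using (1+×) renaming (_×_ to _·_)
  open IntegerCoefficients ℤ[q] using (fromℤ)
  open import Relation.Binary.Reasoning.Setoid R.setoid

  X^≋ : ∀ n → X^ n ≋ X^ 1 ^ n
  X^≋ zero    = ≋-refl
  X^≋ (suc n) = ≋-trans (X^-suc n) (R.*-congˡ {X^ 1} (X^≋ n))

  fromℤ≋constₚ : ∀ k → fromℤ k ≋ constₚ k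
  fromℤ≋constₚ (+ n)    = pos n
    where
    pos : ∀ n → n · oneₚ ≋ constₚ (+ n)
    pos zero    = pointwise λ { zero → ≡.refl ; (suc i) → ≡.refl }
    pos (suc n) = ≋-trans (1+× n oneₚ) (R.+-congˡ {oneₚ} (pos n))
  fromℤ≋constₚ -[1+ n ] = R.-‿cong (fromℤ≋constₚ (+ suc n))

  open Coprimality ℤ[q] using (module PowersMinusOne)
  open PowersMinusOne (X^ 1) using (w)

  X^-1≋w : ∀ n → X^ n -ₚ oneₚ ≋ w n
  X^-1≋w n = R.+-congʳ (X^≋ n)

  X^-below : ∀ n → Below (X^ n) (suc n)
  X^-below zero    (suc i) _             = ≡.refl
  X^-below (suc n) (suc i) (ℕ.s≤s n<i) = X^-below n i n<i

  X^-top : ∀ n → coeff (X^ n) n ≡ + 1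
  X^-top zero    = ≡.refl
  X^-top (suc n) = X^-top n

  X^-1-monic : ∀ n → 0 ℕ.< n → Monic (X^ n -ₚ oneₚ) n
  X^-1-monic (suc n) _ = monic
    (λ i n<i → ≡.trans (same i n<i) (X^-below (suc n) i n<i))
    (≡.trans (coeff-+ (X^ (suc n)) (negₚ oneₚ) (suc n)) (≡.trans (ℤ.+-identityʳ _) (X^-top (suc n))))
    where
    same : ∀ i → suc n ℕ.< i → coeff (X^ (suc n) -ₚ oneₚ) i ≡ coeff (X^ (suc n)) i
    same (suc i) _ = ≡.trans (coeff-+ (X^ (suc n)) (negₚ oneₚ) (suc i)) (ℤ.+-identityʳ _)

  w-monic : ∀ n → 0 ℕ.< n → Monic (w n) n
  w-monic n n>0 = monic-resp (X^-1≋w n) (X^-1-monic n n>0)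

  w≉0 : ∀ n → 0 ℕ.< n → ¬ w n ≋ []
  w≉0 n n>0 = degree⇒≉0 (monic⇒degree (w-monic n n>0))

  properDivisors : ℕ → List ℕ
  properDivisors n = filter (_∣? n) (applyUpTo suc (n ℕ.∸ 1))

  cycFuel-irrelevant : ∀ f g n → 0 ℕ.< n → n ℕ.≤ f → n ℕ.≤ g → cycFuel f n ≡ cycFuel g n
  cycFuel-irrelevant (suc f) (suc g) (suc n) _ (ℕ.s≤s n≤f) (ℕ.s≤s n≤g) =
    cong (λ l → divMonic (X^ (suc n) -ₚ oneₚ) (prodₚ l))
      (map-cong-local {xs = properDivisors (suc n)} (All.filter⁺ (_∣? suc n) (All.applyUpTo⁺₁ suc n λ {i} i<n →
        cycFuel-irrelevant f g (suc i) ℕ.z<s (ℕ.≤-trans i<n n≤f) (ℕ.≤-trans i<n n≤g))))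

  Φ-suc : ∀ n → Φ (suc n) ≡ divMonic (X^ (suc n) -ₚ oneₚ) (prodₚ (map Φ (properDivisors (suc n))))
  Φ-suc n = cong (λ l → divMonic (X^ (suc n) -ₚ oneₚ) (prodₚ l))
    (map-cong-local {xs = properDivisors (suc n)} (All.filter⁺ (_∣? suc n) (All.applyUpTo⁺₁ suc n λ {i} i<n →
      cycFuel-irrelevant n (suc i) (suc i) ℕ.z<s i<n ℕ.≤-refl)))

  open PowersMinusOne (X^ 1) using (module Cyclotomic)
  open Cyclotomic *ₚ-cancelʳ w≉0 Φ public

  prodₚ-++ : ∀ l m → prodₚ (l ++ m) ≋ prodₚ l *ₚ prodₚ m
  prodₚ-++ []      m = ≋-sym (R.*-identityˡ _)
  prodₚ-++ (f ∷ l) m = ≋-trans (R.*-congˡ {f} (prodₚ-++ l m)) (≋-sym (R.*-assoc f _ _))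

  prodₚ≋product : ∀ n k → prodₚ (map Φ (filter (_∣? n) (applyUpTo suc k))) ≋ product n k
  prodₚ≋product n zero = ≋-refl
  prodₚ≋product n (suc k) = begin
    prodₚ (map Φ (filter (_∣? n) (applyUpTo suc (suc k))))
      ≡⟨ cong (λ l → prodₚ (map Φ (filter (_∣? n) l))) (applyUpTo-∷ʳ suc k) ⟨
    prodₚ (map Φ (filter (_∣? n) (applyUpTo suc k ++ suc k ∷ [])))
      ≡⟨ cong (λ l → prodₚ (map Φ l)) (filter-++ (_∣? n) (applyUpTo suc k) (suc k ∷ [])) ⟩
    prodₚ (map Φ (filter (_∣? n) (applyUpTo suc k) ++ filter (_∣? n) (suc k ∷ [])))
      ≡⟨ cong prodₚ (map-++ Φ (filter (_∣? n) (applyUpTo suc k)) _) ⟩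
    prodₚ (map Φ (filter (_∣? n) (applyUpTo suc k)) ++ map Φ (filter (_∣? n) (suc k ∷ [])))
      ≈⟨ prodₚ-++ (map Φ (filter (_∣? n) (applyUpTo suc k))) _ ⟩
    prodₚ (map Φ (filter (_∣? n) (applyUpTo suc k))) *ₚ prodₚ (map Φ (filter (_∣? n) (suc k ∷ [])))
      ≈⟨ R.*-cong (prodₚ≋product n k) last ⟩
    product n k *ₚ part n (suc k) ∎
    where
    split : Dec (suc k ∣ n) → prodₚ (map Φ (filter (_∣? n) (suc k ∷ []))) ≋ part n (suc k)
    split (yes k∣n) = begin
      prodₚ (map Φ (filter (_∣? n) (suc k ∷ [])))  ≡⟨ cong (λ l → prodₚ (map Φ l)) (filter-accept (_∣? n) k∣n) ⟩
      Φ (suc k) *ₚ oneₚ                            ≈⟨ R.*-identityʳ (Φ (suc k)) ⟩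
      Φ (suc k)                                    ≡⟨ part-∣ k∣n ⟨
      part n (suc k)                               ∎
    split (no k∤n) = begin
      prodₚ (map Φ (filter (_∣? n) (suc k ∷ [])))  ≡⟨ cong (λ l → prodₚ (map Φ l)) (filter-reject (_∣? n) k∤n) ⟩
      oneₚ                                         ≡⟨ part-∤ k∤n ⟨
      part n (suc k)                               ∎
    last : prodₚ (map Φ (filter (_∣? n) (suc k ∷ []))) ≋ part n (suc k)
    last = split (suc k ∣? n)

  IsMonic : Poly → Set
  IsMonic f = ∃[ n ] Monic f n

  product-monic : ∀ n k → (∀ e → 0 ℕ.< e → e ℕ.≤ k → IsMonic (Φ e)) → IsMonic (product n k)
  product-monic n zero    Φ-monic = 0 , monic-one
  product-monic n (suc k) Φ-monic
    with d , p ← product-monic n k (λ e e>0 e≤k → Φ-monic e e>0 (ℕ.m≤n⇒m≤1+n e≤k)) | suc k ∣? n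
  ... | yes _ with d′ , p′ ← Φ-monic (suc k) ℕ.z<s ℕ.≤-refl = d ℕ.+ d′ , monic-* p p′
  ... | no _ = d ℕ.+ 0 , monic-* p monic-one

  -- The two properties advance together: dividing by the product of the earlier factors is
  -- meaningful only if that product is monic, and exact only because of their factorisations.
  cyclotomic-step : ∀ n → (∀ e → 0 ℕ.< e → e ℕ.≤ n → IsCyclotomic e × IsMonic (Φ e)) →
                    IsCyclotomic (suc n) × IsMonic (Φ (suc n))
  cyclotomic-step n ih = cyclotomic , monic-cofactor (w-monic (suc n) ℕ.z<s) (proj₂ Ψ-monic) w≋ΨΦ
    where
    Ψ = product (suc n) n
    P = prodₚ (map Φ (properDivisors (suc n)))
    P≋Ψ : P ≋ Ψ
    P≋Ψ = prodₚ≋product (suc n) n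
    Ψ-monic : IsMonic Ψ
    Ψ-monic = product-monic (suc n) n (λ e e>0 e≤n → proj₂ (ih e e>0 e≤n))
    w≋ΨΦ : w (suc n) ≋ Ψ *ₚ Φ (suc n)
    w≋ΨΦ with b , z , b≢0 , eq ← product∣w {suc n} n (λ e e>0 e≤n → proj₁ (ih e e>0 e≤n)) = begin
      w (suc n)                                  ≈⟨ X^-1≋w (suc n) ⟨
      X^ (suc n) -ₚ oneₚ
        ≈⟨ divMonic-exact {b} {z = z} (monic-resp (≋-sym P≋Ψ) (proj₂ Ψ-monic)) b≢0
             (≋-trans (R.*-cong (≋-sym (fromℤ≋constₚ b)) (X^-1≋w (suc n))) (≋-trans eq (R.*-congʳ {z} (≋-sym P≋Ψ)))) ⟩
      P *ₚ divMonic (X^ (suc n) -ₚ oneₚ) P       ≡⟨ cong (P *ₚ_) (Φ-suc n) ⟨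
      P *ₚ Φ (suc n)                             ≈⟨ R.*-congʳ {Φ (suc n)} P≋Ψ ⟩
      Ψ *ₚ Φ (suc n)                             ∎
    cyclotomic : IsCyclotomic (suc n)
    cyclotomic = ≋-trans (R.reflexive (cong (Ψ *ₚ_) (part-∣ {suc n} ∣-refl))) (≋-sym w≋ΨΦ)

  cyclotomic-upto : ∀ n e → 0 ℕ.< e → e ℕ.≤ n → IsCyclotomic e × IsMonic (Φ e)
  cyclotomic-upto zero    e e>0 e≤0 = contradiction (ℕ.<-≤-trans e>0 e≤0) λ ()
  cyclotomic-upto (suc n) e e>0 e≤1+n with ℕ.m≤n⇒m<n∨m≡n e≤1+n
  ... | inj₁ (ℕ.s≤s e≤n) = cyclotomic-upto n e e>0 e≤n
  ... | inj₂ ≡.refl      = cyclotomic-step n (cyclotomic-upto n)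

  cyclotomic : ∀ n → 0 ℕ.< n → IsCyclotomic n
  cyclotomic n n>0 = proj₁ (cyclotomic-upto n n n>0 ℕ.≤-refl)

  Φ-monic : ∀ n → 0 ℕ.< n → IsMonic (Φ n)
  Φ-monic n n>0 = proj₂ (cyclotomic-upto n n n>0 ℕ.≤-refl)

-- Divisibility of fractions

module Valuation {c ℓ c′ ℓ′ : Level} (R : CommutativeRing c ℓ) (K : CommutativeRing c′ ℓ′)
  (ι : CommutativeRing.Carrier R → CommutativeRing.Carrier K)
  (ι-mono : RingMorphisms.IsRingMonomorphism (CommutativeRing.rawRing R) (CommutativeRing.rawRing K) ι) where

  private
    module R = CommutativeRing R
    module K = CommutativeRing K

  open RingMorphisms.IsRingMonomorphism ι-mono
    renaming (⟦⟧-cong to ι-cong; +-homo to ι-+; *-homo to ι-*; 1#-homo to ι-1; -‿homo to ι-neg; injective to ι-injective)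
  open Coprimality R
  open import Algebra.Properties.Semiring.Exp R.semiring using (_^_; ^-homo-*)
  import Relation.Binary.Reasoning.Setoid as SetoidReasoning

  private
    module SR = IntegerCoefficients R
    module SK = IntegerCoefficients K
    open SR using (fromℤ)

  ι-*₃ : ∀ x y z → ι (x R.* y R.* z) K.≈ ι x K.* ι y K.* ι z
  ι-*₃ x y z = K.trans (ι-* _ _) (K.*-congʳ (ι-* _ _))

  -- For x = A - B this is A ≡ B modulo p, with the coprimality of the denominator in Bézout form.
  Multiple : R.Carrier → K.Carrier → Set _
  Multiple p x = ∃[ u ] ∃[ v ] (v ⊥ p × x K.* ι v K.≈ ι (p R.* u))

  private
    -- Euclid's lemma with explicit witnesses: p₂ divides p₁ u₁ v₂ and is coprime to p₁ and to v₂,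
    -- so it divides u₁ up to the integers k and k′.
    clear-cofactor : ∀ {p₁ p₂ u₁ u₂ v₁ v₂ s t s′ t′ k k′} →
      s R.* p₁ R.+ t R.* p₂ R.≈ k → s′ R.* v₂ R.+ t′ R.* p₂ R.≈ k′ →
      p₁ R.* u₁ R.* v₂ R.≈ p₂ R.* u₂ R.* v₁ →
      p₁ R.* u₁ R.* (k R.* k′) R.≈
        p₁ R.* p₂ R.* (s R.* (s′ R.* (u₂ R.* v₁) R.+ t′ R.* (p₁ R.* u₁)) R.+ t R.* u₁ R.* k′)
    clear-cofactor {p₁} {p₂} {u₁} {u₂} {v₁} {v₂} {s} {t} {s′} {t′} {k} {k′} eqₚ eqᵥ exchange = begin
      p₁ * u₁ * (k * k′)
        ≈⟨ *-congˡ (*-congʳ eqₚ) ⟨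
      p₁ * u₁ * ((s * p₁ + t * p₂) * k′)
        ≈⟨ solve 6 (λ p₁ p₂ u₁ s t A → p₁ :* u₁ :* ((s :* p₁ :+ t :* p₂) :* A)
             := s :* p₁ :* (p₁ :* u₁ :* A) :+ p₁ :* p₂ :* (t :* u₁ :* A)) refl p₁ p₂ u₁ s t k′ ⟩
      s * p₁ * (p₁ * u₁ * k′) + p₁ * p₂ * (t * u₁ * k′)
        ≈⟨ +-congʳ (*-congˡ (*-congˡ eqᵥ)) ⟨
      s * p₁ * (p₁ * u₁ * (s′ * v₂ + t′ * p₂)) + p₁ * p₂ * (t * u₁ * k′)
        ≈⟨ +-congʳ (*-congˡ (solve 5 (λ x s v t p → x :* (s :* v :+ t :* p) := s :* (x :* v) :+ p :* (t :* x)) refl (p₁ * u₁) s′ v₂ t′ p₂)) ⟩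
      s * p₁ * (s′ * (p₁ * u₁ * v₂) + p₂ * (t′ * (p₁ * u₁))) + p₁ * p₂ * (t * u₁ * k′)
        ≈⟨ +-congʳ (*-congˡ (+-congʳ (*-congˡ exchange))) ⟩
      s * p₁ * (s′ * (p₂ * u₂ * v₁) + p₂ * (t′ * (p₁ * u₁))) + p₁ * p₂ * (t * u₁ * k′)
        ≈⟨ +-congʳ (*-congˡ (solve 5 (λ s p u v y → s :* (p :* u :* v) :+ p :* y := p :* (s :* (u :* v) :+ y)) refl s′ p₂ u₂ v₁ (t′ * (p₁ * u₁)))) ⟩
      s * p₁ * (p₂ * B) + p₁ * p₂ * (t * u₁ * k′)
        ≈⟨ solve 5 (λ p₁ p₂ s B C → s :* p₁ :* (p₂ :* B) :+ p₁ :* p₂ :* C := p₁ :* p₂ :* (s :* B :+ C))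
             refl p₁ p₂ s B (t * u₁ * k′) ⟩
      p₁ * p₂ * (s * B + t * u₁ * k′) ∎
      where
      open R
      open SR
      open SetoidReasoning R.setoid
      B = s′ * (u₂ * v₁) + t′ * (p₁ * u₁)

    Lift : R.Carrier → R.Carrier → K.Carrier → Set _
    Lift p₁ p₂ x = ∃[ u ] ∃[ v ] (v ⊥ p₁ × x K.* ι v K.≈ ι (p₁ R.* p₂ R.* u))

    -- Equating the two representations of x gives p₁ u₁ v₂ = p₂ u₂ v₁, which moves the factor p₂
    -- into the numerator over v₁. The price is a denominator known to be coprime to p₁ only;
    -- `merge` repairs this.
    lift-multiple : ∀ {p₁ p₂ x} → p₁ ⊥ p₂ → Multiple p₁ x → Multiple p₂ x → Lift p₁ p₂ x
    lift-multiple {p₁} {p₂} {x} (s , t , k , k≢0 , eqₚ) (u₁ , v₁ , v₁⊥ , eq₁) (u₂ , v₂ , (s′ , t′ , k′ , k′≢0 , eqᵥ) , eq₂) =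
      _ , v₁ R.* (fromℤ k R.* fromℤ k′) , *⊥ v₁⊥ (*⊥ (fromℤ⊥ k≢0) (fromℤ⊥ k′≢0)) , (begin
        x * ι (v₁ R.* (fromℤ k R.* fromℤ k′))      ≈⟨ *-congˡ (ι-* _ _) ⟩
        x * (ι v₁ * ι (fromℤ k R.* fromℤ k′))      ≈⟨ *-assoc _ _ _ ⟨
        x * ι v₁ * ι (fromℤ k R.* fromℤ k′)        ≈⟨ *-congʳ eq₁ ⟩
        ι (p₁ R.* u₁) * ι (fromℤ k R.* fromℤ k′)   ≈⟨ ι-* _ _ ⟨
        ι (p₁ R.* u₁ R.* (fromℤ k R.* fromℤ k′))   ≈⟨ ι-cong (clear-cofactor eqₚ eqᵥ exchange) ⟩
        ι _                                        ∎)
      where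
      open K
      open SetoidReasoning setoid
      exchange : p₁ R.* u₁ R.* v₂ R.≈ p₂ R.* u₂ R.* v₁
      exchange = ι-injective (begin
        ι (p₁ R.* u₁ R.* v₂)       ≈⟨ ι-* _ _ ⟩
        ι (p₁ R.* u₁) * ι v₂       ≈⟨ *-congʳ eq₁ ⟨
        x * ι v₁ * ι v₂            ≈⟨ SK.solve 3 (λ x v w → x SK.:* v SK.:* w SK.:= x SK.:* w SK.:* v) refl x (ι v₁) (ι v₂) ⟩
        x * ι v₂ * ι v₁            ≈⟨ *-congʳ eq₂ ⟩
        ι (p₂ R.* u₂) * ι v₁       ≈⟨ ι-* _ _ ⟨
        ι (p₂ R.* u₂ R.* v₁)       ∎)

  private
    -- v₁ is coprime to p₁ only and v₂ to p₂ only, but v₁ p₂ + v₂ p₁ is coprime to both.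
    merge : ∀ {p₁ p₂ x} → p₁ ⊥ p₂ → Lift p₁ p₂ x → Lift p₂ p₁ x → Multiple (p₁ R.* p₂) x
    merge {p₁} {p₂} {x} p₁⊥p₂ (u₁ , v₁ , v₁⊥ , eq₁) (u₂ , v₂ , v₂⊥ , eq₂)
      = p₂ R.* u₁ R.+ p₁ R.* u₂ , V , ⊥-sym (*⊥ (⊥-sym V⊥p₁) (⊥-sym V⊥p₂)) , (begin
        x * ι V
          ≈⟨ *-congˡ (trans (ι-+ _ _) (+-cong (ι-* _ _) (ι-* _ _))) ⟩
        x * (ι v₁ * ι p₂ + ι v₂ * ι p₁)
          ≈⟨ SK.solve 5 (λ x a b c d → x SK.:* (a SK.:* b SK.:+ c SK.:* d) SK.:= x SK.:* a SK.:* b SK.:+ x SK.:* c SK.:* d) refl x (ι v₁) (ι p₂) (ι v₂) (ι p₁) ⟩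
        x * ι v₁ * ι p₂ + x * ι v₂ * ι p₁
          ≈⟨ +-cong (*-congʳ eq₁) (*-congʳ eq₂) ⟩
        ι (p₁ R.* p₂ R.* u₁) * ι p₂ + ι (p₂ R.* p₁ R.* u₂) * ι p₁
          ≈⟨ +-cong (ι-* _ _) (ι-* _ _) ⟨
        ι (p₁ R.* p₂ R.* u₁ R.* p₂) + ι (p₂ R.* p₁ R.* u₂ R.* p₁)
          ≈⟨ ι-+ _ _ ⟨
        ι (p₁ R.* p₂ R.* u₁ R.* p₂ R.+ p₂ R.* p₁ R.* u₂ R.* p₁)
          ≈⟨ ι-cong (SR.solve 4 (λ p q u v → p SR.:* q SR.:* u SR.:* q SR.:+ q SR.:* p SR.:* v SR.:* p
               SR.:= p SR.:* q SR.:* (q SR.:* u SR.:+ p SR.:* v)) R.refl p₁ p₂ u₁ u₂) ⟩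
        ι (p₁ R.* p₂ R.* (p₂ R.* u₁ R.+ p₁ R.* u₂)) ∎)
      where
      open K
      open SetoidReasoning setoid
      V = v₁ R.* p₂ R.+ v₂ R.* p₁
      V⊥p₁ : V ⊥ p₁
      V⊥p₁ = +*⊥ (*⊥ v₁⊥ (⊥-sym p₁⊥p₂))
      V⊥p₂ : V ⊥ p₂
      V⊥p₂ = ⊥-respˡ (R.+-comm _ _) (+*⊥ (*⊥ v₂⊥ p₁⊥p₂))

  multiple-* : ∀ {p₁ p₂ x} → p₁ ⊥ p₂ → Multiple p₁ x → Multiple p₂ x → Multiple (p₁ R.* p₂) x
  multiple-* p₁⊥p₂ m₁ m₂ =
    merge p₁⊥p₂ (lift-multiple p₁⊥p₂ m₁ m₂) (lift-multiple (⊥-sym p₁⊥p₂) m₂ m₁)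

  module AtPrime (π : R.Carrier) where

    -- `Div` bounds the order of a fraction at π from below, which is what survives addition; `Val`
    -- gives the exact order of a ring element, which is what a denominator must have.
    record Div (k : ℕ) (x : K.Carrier) : Set (c ⊔ ℓ ⊔ ℓ′) where
      constructor div
      field
        u v : R.Carrier
        v⊥π : v ⊥ π
        x*v : x K.* ι v K.≈ ι (π ^ k R.* u)

    record Val (b : R.Carrier) (k : ℕ) : Set (c ⊔ ℓ) where
      constructor val
      field
        v   : R.Carrier
        v⊥π : v ⊥ π
        b≈  : b R.≈ π ^ k R.* v

    Div⇒Multiple : ∀ {k x} → Div k x → Multiple (π ^ k) x
    Div⇒Multiple {k} (div u v v⊥ eq) = u , v , ⊥-sym (⊥-power k (⊥-sym v⊥)) , eq

    Div-resp : ∀ {k x y} → x K.≈ y → Div k x → Div k y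
    Div-resp x≈y (div u v v⊥ eq) = div u v v⊥ (K.trans (K.*-congʳ (K.sym x≈y)) eq)

    Div-ι : ∀ {k x r} u → x K.≈ ι r → r R.≈ π ^ k R.* u → Div k x
    Div-ι u x≈ r≈ = div u R.1# 1⊥ (K.trans (K.*-congˡ ι-1) (K.trans (K.*-identityʳ _) (K.trans x≈ (ι-cong r≈))))

    Div-ι₀ : ∀ {x} r → x K.≈ ι r → Div 0 x
    Div-ι₀ r x≈ = Div-ι r x≈ (R.sym (R.*-identityˡ r))

    Div-+ : ∀ {k x y} → Div k x → Div k y → Div k (x K.+ y)
    Div-+ {k} {x} {y} (div u v v⊥ eq) (div u′ v′ v′⊥ eq′) =
      div (u R.* v′ R.+ u′ R.* v) (v R.* v′) (*⊥ v⊥ v′⊥) (begin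
        (x + y) * ι (v R.* v′)
          ≈⟨ *-congˡ (ι-* _ _) ⟩
        (x + y) * (ι v * ι v′)
          ≈⟨ solve 4 (λ x y v v′ → (x :+ y) :* (v :* v′) := x :* v :* v′ :+ y :* v′ :* v) refl x y (ι v) (ι v′) ⟩
        x * ι v * ι v′ + y * ι v′ * ι v
          ≈⟨ +-cong (*-congʳ eq) (*-congʳ eq′) ⟩
        ι (π ^ k R.* u) * ι v′ + ι (π ^ k R.* u′) * ι v
          ≈⟨ +-cong (ι-* _ _) (ι-* _ _) ⟨
        ι (π ^ k R.* u R.* v′) + ι (π ^ k R.* u′ R.* v)
          ≈⟨ ι-+ _ _ ⟨
        ι (π ^ k R.* u R.* v′ R.+ π ^ k R.* u′ R.* v)
          ≈⟨ ι-cong (SR.solve 5 (λ p u v u′ v′ → p SR.:* u SR.:* v′ SR.:+ p SR.:* u′ SR.:* v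
               SR.:= p SR.:* (u SR.:* v′ SR.:+ u′ SR.:* v)) R.refl (π ^ k) u v u′ v′) ⟩
        ι (π ^ k R.* (u R.* v′ R.+ u′ R.* v)) ∎)
      where
      open K
      open SK
      open SetoidReasoning setoid

    Div-* : ∀ {k l x y} → Div k x → Div l y → Div (k ℕ.+ l) (x K.* y)
    Div-* {k} {l} {x} {y} (div u v v⊥ eq) (div u′ v′ v′⊥ eq′) =
      div (u R.* u′) (v R.* v′) (*⊥ v⊥ v′⊥) (begin
        x * y * ι (v R.* v′)
          ≈⟨ *-congˡ (ι-* _ _) ⟩
        x * y * (ι v * ι v′)
          ≈⟨ solve 4 (λ x y v v′ → x :* y :* (v :* v′) := x :* v :* (y :* v′)) refl x y (ι v) (ι v′) ⟩
        x * ι v * (y * ι v′)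
          ≈⟨ *-cong eq eq′ ⟩
        ι (π ^ k R.* u) * ι (π ^ l R.* u′)
          ≈⟨ ι-* _ _ ⟨
        ι (π ^ k R.* u R.* (π ^ l R.* u′))
          ≈⟨ ι-cong (R.trans (SR.solve 4 (λ p q u u′ → p SR.:* u SR.:* (q SR.:* u′)
               SR.:= p SR.:* q SR.:* (u SR.:* u′)) R.refl (π ^ k) (π ^ l) u u′) (R.*-congʳ (R.sym (^-homo-* π k l)))) ⟩
        ι (π ^ (k ℕ.+ l) R.* (u R.* u′)) ∎)
      where
      open K
      open SK
      open SetoidReasoning setoid

    Div-neg : ∀ {k x} → Div k x → Div k (K.- x)
    Div-neg {k} {x} (div u v v⊥ eq) = div (R.- u) v v⊥ (begin
      - x * ι v                ≈⟨ solve 2 (λ x v → (:- x) :* v := :- (x :* v)) refl x (ι v) ⟩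
      - (x * ι v)              ≈⟨ -‿cong eq ⟩
      - ι (π ^ k R.* u)        ≈⟨ ι-neg _ ⟨
      ι (R.- (π ^ k R.* u))    ≈⟨ ι-cong (SR.solve 2 (λ p u → SR.:- (p SR.:* u) SR.:= p SR.:* (SR.:- u)) R.refl (π ^ k) u) ⟩
      ι (π ^ k R.* R.- u)      ∎)
      where
      open K
      open SK
      open SetoidReasoning setoid

    Div-- : ∀ {k x y} → Div k x → Div k y → Div k (x K.- y)
    Div-- dx dy = Div-+ dx (Div-neg dy)

    Val-resp : ∀ {b b′ k} → b R.≈ b′ → Val b k → Val b′ k
    Val-resp b≈ (val v v⊥ eq) = val v v⊥ (R.trans (R.sym b≈) eq)

    Val-⊥ : ∀ {b} → b ⊥ π → Val b 0
    Val-⊥ {b} b⊥ = val b b⊥ (R.sym (R.*-identityˡ b))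

    Val-* : ∀ {a b k l} → Val a k → Val b l → Val (a R.* b) (k ℕ.+ l)
    Val-* {a} {b} {k} {l} (val v v⊥ eq) (val v′ v′⊥ eq′) = val (v R.* v′) (*⊥ v⊥ v′⊥) (begin
      a R.* b                              ≈⟨ R.*-cong eq eq′ ⟩
      π ^ k R.* v R.* (π ^ l R.* v′)       ≈⟨ solve 4 (λ p q u u′ → p :* u :* (q :* u′) := p :* q :* (u :* u′)) R.refl (π ^ k) (π ^ l) v v′ ⟩
      π ^ k R.* π ^ l R.* (v R.* v′)       ≈⟨ R.*-congʳ (^-homo-* π k l) ⟨
      π ^ (k ℕ.+ l) R.* (v R.* v′)         ∎)
      where
      open SR
      open SetoidReasoning R.setoid

    module _ (inv : K.Carrier → K.Carrier)
             (inverseʳ : ∀ {x} → ¬ x K.≈ K.0# → x K.* inv x K.≈ K.1#) where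

      open Hypergeometric K inv inverseʳ using (cancelʳ)

      -- Order at least m above and exactly n below leaves at least m - n. The common πⁿ may be
      -- cancelled because it is a factor of the nonzero b.
      Div-quotient : ∀ {x a b m w} k {n} → ¬ ι b K.≈ K.0# → a R.≈ π ^ m R.* w → Val b n → k ℕ.+ n ℕ.≤ m →
                     x K.* ι b K.≈ ι a → Div k x
      Div-quotient {x} {a} {b} {m} {w} k {n} b≉0 a≈ (val v v⊥ b≈) k+n≤m xb≈a =
        div (π ^ e R.* w) v v⊥ (cancelʳ πⁿ≉0 (begin
          x * ι v * ι (π ^ n)
            ≈⟨ *-assoc _ _ _ ⟩
          x * (ι v * ι (π ^ n))
            ≈⟨ *-congˡ (trans (*-comm _ _) (trans (sym (ι-* _ _)) (ι-cong (R.sym b≈)))) ⟩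
          x * ι b
            ≈⟨ xb≈a ⟩
          ι a
            ≈⟨ ι-cong (R.trans a≈ (R.*-congʳ (R.trans (R.reflexive (≡.cong (π ^_) (≡.sym (ℕ.m+[n∸m]≡n k+n≤m))))
                 (R.trans (^-homo-* π (k ℕ.+ n) e) (R.*-congʳ (^-homo-* π k n)))))) ⟩
          ι (π ^ k R.* π ^ n R.* π ^ e R.* w)
            ≈⟨ ι-cong (SR.solve 4 (λ a b c d → a SR.:* b SR.:* c SR.:* d SR.:= a SR.:* (c SR.:* d) SR.:* b) R.refl (π ^ k) (π ^ n) (π ^ e) w) ⟩
          ι (π ^ k R.* (π ^ e R.* w) R.* π ^ n)
            ≈⟨ ι-* _ _ ⟩
          ι (π ^ k R.* (π ^ e R.* w)) * ι (π ^ n) ∎))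
        where
        open K
        open SetoidReasoning setoid
        e = m ℕ.∸ (k ℕ.+ n)
        πⁿ≉0 : ¬ ι (π ^ n) ≈ 0#
        πⁿ≉0 πⁿ≈0 = b≉0 (begin
          ι b                 ≈⟨ trans (ι-cong b≈) (ι-* _ _) ⟩
          ι (π ^ n) * ι v     ≈⟨ *-congʳ πⁿ≈0 ⟩
          0# * ι v            ≈⟨ zeroˡ _ ⟩
          0#                  ∎)

-- Local analysis at one cyclotomic polynomial

module QSeries {c ℓ c′ ℓ′ : Level} (R : CommutativeRing c ℓ) (K : CommutativeRing c′ ℓ′)
  (ι : CommutativeRing.Carrier R → CommutativeRing.Carrier K)
  (ι-mono : RingMorphisms.IsRingMonomorphism (CommutativeRing.rawRing R) (CommutativeRing.rawRing K) ι)
  (inv : CommutativeRing.Carrier K → CommutativeRing.Carrier K) (inverseʳ : IsInverse K inv)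
  (*-nonzero : NoZeroDivisors R)
  (q : CommutativeRing.Carrier R) (q≉0 : ¬ CommutativeRing._≈_ R q (CommutativeRing.0# R))
  (w≉0 : NotRootOfUnity R q) where

  private
    module R = CommutativeRing R
    module K = CommutativeRing K

  open RingMorphisms.IsRingMonomorphism ι-mono
    renaming (⟦⟧-cong to ι-cong; +-homo to ι-+; *-homo to ι-*; 1#-homo to ι-1; 0#-homo to ι-0; -‿homo to ι-neg; injective to ι-injective)
  open import Data.Nat.Divisibility using (_∣_; _∣?_; divides; ∣m+n∣m⇒∣n; ∣m∣n⇒∣m+n; n∣m*n; m∣m*n; ∣n⇒∣m*n; ∣⇒≤; ∣-trans; ∣1⇒≡1)
  open import Data.Nat.Coprimality using (Coprime; coprime-divisor)
  open import Data.Nat.Tactic.RingSolver using (solve-∀)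
  open Coprimality R
  open PowersMinusOne q using (w)
  open Valuation R K ι ι-mono
  open import Algebra.Properties.Semiring.Exp R.semiring using (_^_; ^-homo-*)
  open import Algebra.Properties.Semiring.Exp K.semiring as K^ using () renaming (_^_ to _^ᴷ_)
  open import Relation.Binary.Definitions using (tri<; tri≈; tri>)
  import Relation.Binary.Reasoning.Setoid as SetoidReasoning

  private
    module SR = IntegerCoefficients R
    module SK = IntegerCoefficients K
  module H = Hypergeometric K inv inverseʳ
  open H using (∏; ∏[_,_]; ∑≤; ∏-cong; ∏-quotient; ∏-∏[])

  module S = H.Series (ι q)

  poch : ℕ → ℕ → R.Carrier
  poch e zero    = R.1#
  poch e (suc k) = poch e k R.* (R.1# R.- q ^ (e ℕ.+ 4 ℕ.* k))

  ρnum ρden : R.Carrier → ℕ → R.Carrier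
  ρnum α k = let X = q ^ (2 ℕ.+ 4 ℕ.* k) in (R.1# R.- α R.* X) R.* (α R.- X) R.* (R.1# R.- X) R.* q
  ρden α k = let Y = q ^ (4 ℕ.+ 4 ℕ.* k) in (R.1# R.- α R.* Y) R.* (α R.- Y) R.* (R.1# R.- Y)

  -- The parameter a enters through a + 1/a only, whence the square.
  ρnum-ρden : ∀ α k → ∃[ z ] ρnum α k R.* ρden R.1# k R.- ρnum R.1# k R.* ρden α k
                              R.≈ (R.1# R.- α) R.* (R.1# R.- α) R.* z
  ρnum-ρden α k = _ , R.trans (solve 4 (λ α X Y q →
      (one :- α :* X) :* (α :- X) :* (one :- X) :* q :* ((one :- one :* Y) :* (one :- Y) :* (one :- Y))
        :- (one :- one :* X) :* (one :- X) :* (one :- X) :* q :* ((one :- α :* Y) :* (α :- Y) :* (one :- Y))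
      := (one :- α) :* (one :- α) :* ((one :- X) :* (one :- Y) :* q
           :* (Y :* (one :- X) :* (one :- X) :- X :* (one :- Y) :* (one :- Y))))
      R.refl α (q ^ (2 ℕ.+ 4 ℕ.* k)) (q ^ (4 ℕ.+ 4 ℕ.* k)) q) R.refl
    where
    open SR
    one : ∀ {n} → Polynomial n
    one = con (+ 1)

  open SK using (Polynomial; solve; con; _:=_; _:+_; _:*_; _:-_; :-_; _:^_)

  ι≉0 : ∀ {x} → ¬ x R.≈ R.0# → ¬ ι x K.≈ K.0#
  ι≉0 x≉0 ιx≈0 = x≉0 (ι-injective (K.trans ιx≈0 (K.sym ι-0)))

  1-qˡ≉0 : ∀ l → 0 ℕ.< l → ¬ R.1# R.- q ^ l R.≈ R.0#
  1-qˡ≉0 l l>0 eq = w≉0 l l>0 (begin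
    w l                      ≈⟨ SR.solve 1 (λ x → x SR.:- SR.con (+ 1) SR.:= SR.:- (SR.con (+ 1) SR.:- x)) R.refl (q ^ l) ⟩
    R.- (R.1# R.- q ^ l)     ≈⟨ R.-‿cong eq ⟩
    R.- R.0#                 ≈⟨ SR.solve 0 (SR.:- SR.con (+ 0) SR.:= SR.con (+ 0)) R.refl ⟩
    R.0#                     ∎)
    where open SetoidReasoning R.setoid

  1≉0 : ¬ R.1# R.≈ R.0#
  1≉0 1≈0 = q≉0 (R.trans (R.sym (R.*-identityʳ q)) (R.trans (R.*-congˡ 1≈0) (R.zeroʳ q)))

  poch≉0 : ∀ e k → 0 ℕ.< e → ¬ poch e k R.≈ R.0#
  poch≉0 e zero    e>0 = 1≉0
  poch≉0 e (suc k) e>0 = *-nonzero (poch≉0 e k e>0) (1-qˡ≉0 _ (ℕ.<-≤-trans e>0 (ℕ.m≤m+n e _)))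

  q^≉0 : ∀ n → ¬ q ^ n R.≈ R.0#
  q^≉0 zero    = 1≉0
  q^≉0 (suc n) = *-nonzero q≉0 (q^≉0 n)

  ι-^ : ∀ x n → ι (x ^ n) K.≈ ι x ^ᴷ n
  ι-^ x zero    = ι-1
  ι-^ x (suc n) = K.trans (ι-* _ _) (K.*-congˡ (ι-^ x n))

  module _ where
    open K
    open SetoidReasoning setoid

    ι-q⁴ : ∀ e k a → ι (q ^ (e ℕ.+ 4 ℕ.* k)) ≈ ι q ^ᴷ e * S.x a k
    ι-q⁴ e k a = begin
      ι (q ^ (e ℕ.+ 4 ℕ.* k))              ≈⟨ ι-^ q (e ℕ.+ 4 ℕ.* k) ⟩
      ι q ^ᴷ (e ℕ.+ 4 ℕ.* k)               ≈⟨ K^.^-homo-* (ι q) e (4 ℕ.* k) ⟩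
      ι q ^ᴷ e * ι q ^ᴷ (4 ℕ.* k)          ≈⟨ *-congˡ (K^.^-assocʳ (ι q) 4 k) ⟨
      ι q ^ᴷ e * (ι q ^ᴷ 4) ^ᴷ k           ≈⟨ *-congˡ (K^.^-congˡ k (solve 1 (λ y → y :^ 4 := y :* y :* y :* y) refl (ι q))) ⟩
      ι q ^ᴷ e * S.x a k                   ∎

    ι-- : ∀ x y → ι (x R.- y) ≈ ι x - ι y
    ι-- x y = trans (ι-+ _ _) (+-congˡ (ι-neg _))

    ι-1- : ∀ x → ι (R.1# R.- x) ≈ 1# - ι x
    ι-1- x = trans (ι-- _ _) (+-congʳ ι-1)

    ι-factor : ∀ e k a → ι (R.1# R.- q ^ (e ℕ.+ 4 ℕ.* k)) ≈ S.⟨_⟩ a e k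
    ι-factor e k a = trans (ι-1- _) (+-congˡ (-‿cong (ι-q⁴ e k a)))

    ι-poch : ∀ e k a → ι (poch e k) ≈ ∏ (S.⟨_⟩ a e) k
    ι-poch e zero    a = ι-1
    ι-poch e (suc k) a = trans (ι-* _ _) (*-cong (ι-poch e k a) (ι-factor e k a))

    ⟨⟩≉0 : ∀ e k a → 0 ℕ.< e → ¬ S.⟨_⟩ a e k ≈ 0#
    ⟨⟩≉0 e k a e>0 eq = ι≉0 (1-qˡ≉0 _ (ℕ.<-≤-trans e>0 (ℕ.m≤m+n e _))) (trans (ι-factor e k a) eq)

    ∏-* : ∀ f g k → ∏ (λ i → f i * g i) k ≈ ∏ f k * ∏ g k
    ∏-* f g zero    = sym (*-identityˡ 1#)
    ∏-* f g (suc k) = trans (*-congʳ (∏-* f g k))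
      (solve 4 (λ a b c d → a :* b :* (c :* d) := a :* c :* (b :* d)) refl (∏ f k) (∏ g k) (f k) (g k))

    ∏-const : ∀ y k → ∏ (λ _ → y) k ≈ y ^ᴷ k
    ∏-const y zero    = refl
    ∏-const y (suc k) = trans (*-congʳ (∏-const y k)) (*-comm _ _)

    1+q≉0 : ¬ 1# + ι q ≈ 0#
    1+q≉0 eq = ι≉0 (w≉0 2 ℕ.z<s) (begin
      ι (w 2)                           ≈⟨ ι-cong (SR.solve 1 (λ x → x SR.:^ 2 SR.:- SR.con (+ 1)
                                             SR.:= (SR.con (+ 1) SR.:+ x) SR.:* (x SR.:- SR.con (+ 1))) R.refl q) ⟩
      ι ((R.1# R.+ q) R.* (q R.- R.1#)) ≈⟨ trans (ι-* _ _) (*-congʳ (trans (ι-+ _ _) (+-congʳ ι-1))) ⟩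
      (1# + ι q) * ι (q R.- R.1#)       ≈⟨ *-congʳ eq ⟩
      0# * ι (q R.- R.1#)               ≈⟨ zeroˡ _ ⟩
      0#                                ∎)

    1-q≉0 : ¬ 1# - ι q ≈ 0#
    1-q≉0 eq = ι≉0 (1-qˡ≉0 1 ℕ.z<s) (trans (ι-1- _) (trans (+-congˡ (-‿cong (ι-cong (R.*-identityʳ q)))) eq))

    -- The specialisation a = 1

    module At1 where
      open S 1#

      ⟨1·⟩≈ : ∀ e k → ⟨a· e ⟩ k ≈ ⟨ e ⟩ k
      ⟨1·⟩≈ e k = +-congˡ (-‿cong (*-identityˡ _))

      4≉0 : ∀ k → ¬ ⟨ 4 ⟩ k ≈ 0#
      4≉0 k = ⟨⟩≉0 4 k 1# ℕ.z<s

      5≉0 : ∀ k → ¬ ⟨ 5 ⟩ k ≈ 0#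
      5≉0 k = ⟨⟩≉0 5 k 1# ℕ.z<s

      a4≉0 : ∀ k → ¬ ⟨a· 4 ⟩ k ≈ 0#
      a4≉0 k eq = 4≉0 k (trans (sym (⟨1·⟩≈ 4 k)) eq)

      D₃ : ℕ → Carrier
      D₃ k = ⟨a· 4 ⟩ k * [a- 4 ] k * ⟨ 4 ⟩ k

      D₃≉0 : ∀ k → ¬ D₃ k ≈ 0#
      D₃≉0 k = H.*-nonzero (H.*-nonzero (a4≉0 k) (4≉0 k)) (4≉0 k)

      ∏₃ : ∀ e k → ∏ (λ i → ⟨a· e ⟩ i * [a- e ] i * ⟨ e ⟩ i) k ≈ ι (poch e k) * ι (poch e k) * ι (poch e k)
      ∏₃ e k = begin
        ∏ (λ i → ⟨a· e ⟩ i * [a- e ] i * ⟨ e ⟩ i) k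
          ≈⟨ ∏-cong (λ i → *-congʳ (*-congʳ (⟨1·⟩≈ e i))) k ⟩
        ∏ (λ i → ⟨ e ⟩ i * ⟨ e ⟩ i * ⟨ e ⟩ i) k
          ≈⟨ trans (∏-* _ _ k) (*-congʳ (∏-* _ _ k)) ⟩
        ∏ ⟨ e ⟩ k * ∏ ⟨ e ⟩ k * ∏ ⟨ e ⟩ k
          ≈⟨ *-cong (*-cong (ι-poch e k 1#) (ι-poch e k 1#)) (ι-poch e k 1#) ⟨
        ι (poch e k) * ι (poch e k) * ι (poch e k) ∎

      ∏ρ≈ : ∀ k → ∏ ρ k * ι (poch 4 k ^ 3) ≈ ι (poch 2 k ^ 3 R.* q ^ k)
      ∏ρ≈ k = begin
        ∏ ρ k * ι (poch 4 k ^ 3)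
          ≈⟨ *-congˡ (cube 4) ⟩
        ∏ ρ k * (ι (poch 4 k) * ι (poch 4 k) * ι (poch 4 k))
          ≈⟨ *-congˡ (∏₃ 4 k) ⟨
        ∏ ρ k * ∏ D₃ k
          ≈⟨ ∏-quotient (λ i → ⟨a· 2 ⟩ i * [a- 2 ] i * ⟨ 2 ⟩ i * ι q) D₃≉0 k ⟩
        ∏ (λ i → ⟨a· 2 ⟩ i * [a- 2 ] i * ⟨ 2 ⟩ i * ι q) k
          ≈⟨ trans (∏-* _ _ k) (*-cong (∏₃ 2 k) (trans (∏-const (ι q) k) (sym (ι-^ q k)))) ⟩
        ι (poch 2 k) * ι (poch 2 k) * ι (poch 2 k) * ι (q ^ k)
          ≈⟨ *-congʳ (cube 2) ⟨
        ι (poch 2 k ^ 3) * ι (q ^ k)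
          ≈⟨ ι-* _ _ ⟨
        ι (poch 2 k ^ 3 R.* q ^ k) ∎
        where
        cube : ∀ e → ι (poch e k ^ 3) ≈ ι (poch e k) * ι (poch e k) * ι (poch e k)
        cube e = trans (ι-^ _ 3) (solve 1 (λ y → y :^ 3 := y :* y :* y) refl (ι (poch e k)))

      t-cleared : ∀ k → t k * ι ((R.1# R.+ q) R.* poch 4 k ^ 3)
                      ≈ ι ((R.1# R.+ q ^ (4 ℕ.* k ℕ.+ 1)) R.* poch 2 k ^ 3 R.* q ^ k)
      t-cleared k = begin
        inv (1# + ι q) * (1# + ι q * x k) * ∏ ρ k * ι ((R.1# R.+ q) R.* poch 4 k ^ 3)
          ≈⟨ *-congˡ (trans (ι-* _ _) (*-congʳ (trans (ι-+ _ _) (+-congʳ ι-1)))) ⟩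
        inv (1# + ι q) * (1# + ι q * x k) * ∏ ρ k * ((1# + ι q) * ι (poch 4 k ^ 3))
          ≈⟨ solve 5 (λ i a b c d → i :* a :* b :* (c :* d) := c :* i :* a :* (b :* d)) refl
               (inv (1# + ι q)) (1# + ι q * x k) (∏ ρ k) (1# + ι q) (ι (poch 4 k ^ 3)) ⟩
        (1# + ι q) * inv (1# + ι q) * (1# + ι q * x k) * (∏ ρ k * ι (poch 4 k ^ 3))
          ≈⟨ *-cong (trans (*-congʳ (inverseʳ 1+q≉0)) (*-identityˡ _)) (∏ρ≈ k) ⟩
        (1# + ι q * x k) * ι (poch 2 k ^ 3 R.* q ^ k)
          ≈⟨ *-congʳ (+-cong ι-1 (trans (reflexive (≡.cong (λ i → ι (q ^ i)) (ℕ.+-comm (4 ℕ.* k) 1))) (trans (ι-q⁴ 1 k 1#) (*-congʳ (*-identityʳ _))))) ⟨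
        (ι R.1# + ι (q ^ (4 ℕ.* k ℕ.+ 1))) * ι (poch 2 k ^ 3 R.* q ^ k)
          ≈⟨ trans (ι-* _ _) (*-congʳ (ι-+ _ _)) ⟨
        ι ((R.1# R.+ q ^ (4 ℕ.* k ℕ.+ 1)) R.* (poch 2 k ^ 3 R.* q ^ k))
          ≈⟨ ι-cong (R.*-assoc _ _ _) ⟨
        ι ((R.1# R.+ q ^ (4 ℕ.* k ℕ.+ 1)) R.* poch 2 k ^ 3 R.* q ^ k) ∎

      truncated : ∀ m → ∑≤ m t ≈ ∑≤ m (λ j → F m (m ℕ.∸ j) j)
      truncated = Identity.truncated-sum 1+q≉0 1-q≉0 4≉0 5≉0 a4≉0 4≉0

      -- F(m, j) at a = 1 as a quotient of complete shifted factorials, whose orders can be counted.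
      -- The partial product is (q⁶)ₘ/(q⁶)ᵢ, whence the second (q⁶)ₘ above and the (q⁶)ᵢ below.
      Fden Fnum : ℕ → ℕ → ℕ → R.Carrier
      Fden m i j = poch 4 m R.* poch 5 m R.* poch 6 i R.* (poch 4 j R.* poch 4 j)
      Fnum m i j = poch 6 m R.* poch 6 m R.* poch 3 i R.* (poch 2 j R.* poch 1 j R.* q ^ j)

      F-cleared : ∀ i j → let m = i ℕ.+ j in F m i j * ι (Fden m i j) ≈ ι (Fnum m i j)
      F-cleared i j = begin
        P m * ∏ ⟨ 3 ⟩ i * ∏[ i , j ] ⟨ 6 ⟩ * u j * ι (Fden m i j)
          ≈⟨ *-congˡ (trans (ι-* _ _) (*-cong (trans (ι-* _ _) (*-cong (ι-* _ _) (ι-poch 6 i 1#))) (ι-* _ _))) ⟩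
        P m * ∏ ⟨ 3 ⟩ i * ∏[ i , j ] ⟨ 6 ⟩ * u j * (p₄ m * p₅ m * ∏ ⟨ 6 ⟩ i * (p₄ j * p₄ j))
          ≈⟨ solve 8 (λ P a e u b c f d → P :* a :* e :* u :* (b :* c :* f :* d)
               := (P :* (b :* c)) :* (f :* e) :* a :* (u :* d)) refl
               (P m) (∏ ⟨ 3 ⟩ i) (∏[ i , j ] ⟨ 6 ⟩) (u j) (p₄ m) (p₅ m) (∏ ⟨ 6 ⟩ i) (p₄ j * p₄ j) ⟩
        (P m * (p₄ m * p₅ m)) * (∏ ⟨ 6 ⟩ i * ∏[ i , j ] ⟨ 6 ⟩) * ∏ ⟨ 3 ⟩ i * (u j * (p₄ j * p₄ j))
          ≈⟨ *-cong (*-cong (*-cong P≈ (∏-∏[] i j ⟨ 6 ⟩)) refl) u≈ ⟩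
        ∏ ⟨ 6 ⟩ m * ∏ ⟨ 6 ⟩ m * ∏ ⟨ 3 ⟩ i * (ι (poch 2 j) * ι (poch 1 j) * ι (q ^ j))
          ≈⟨ *-congʳ (*-cong (*-cong (ι-poch 6 m 1#) (ι-poch 6 m 1#)) (ι-poch 3 i 1#)) ⟨
        ι (poch 6 m) * ι (poch 6 m) * ι (poch 3 i) * (ι (poch 2 j) * ι (poch 1 j) * ι (q ^ j))
          ≈⟨ trans (ι-* _ _) (*-cong (trans (ι-* _ _) (*-congʳ (ι-* _ _))) (trans (ι-* _ _) (*-congʳ (ι-* _ _)))) ⟨
        ι (Fnum m i j) ∎
        where
        m = i ℕ.+ j
        p₄ p₅ : ℕ → Carrier
        p₄ k = ι (poch 4 k)
        p₅ k = ι (poch 5 k)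
        P≈ : P m * (p₄ m * p₅ m) ≈ ∏ ⟨ 6 ⟩ m
        P≈ = trans (*-congˡ (trans (*-cong (ι-poch 4 m 1#) (ι-poch 5 m 1#)) (sym (∏-* _ _ m))))
               (∏-quotient ⟨ 6 ⟩ (λ k → H.*-nonzero (4≉0 k) (5≉0 k)) m)
        u≈ : u j * (p₄ j * p₄ j) ≈ ι (poch 2 j) * ι (poch 1 j) * ι (q ^ j)
        u≈ = begin
          u j * (p₄ j * p₄ j)
            ≈⟨ *-congˡ (trans (*-cong (ι-poch 4 j 1#) (ι-poch 4 j 1#))
                 (trans (*-congˡ (sym (∏-cong (⟨1·⟩≈ 4) j))) (sym (∏-* _ _ j)))) ⟩
          u j * ∏ (λ k → ⟨ 4 ⟩ k * ⟨a· 4 ⟩ k) j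
            ≈⟨ ∏-quotient (λ k → ⟨a· 2 ⟩ k * ⟨ 1 ⟩ k * ι q) (λ k → H.*-nonzero (4≉0 k) (a4≉0 k)) j ⟩
          ∏ (λ k → ⟨a· 2 ⟩ k * ⟨ 1 ⟩ k * ι q) j
            ≈⟨ trans (∏-* _ _ j) (*-cong (trans (∏-* _ _ j) (*-congʳ (∏-cong (⟨1·⟩≈ 2) j))) (∏-const (ι q) j)) ⟩
          ∏ ⟨ 2 ⟩ j * ∏ ⟨ 1 ⟩ j * ι q ^ᴷ j
            ≈⟨ *-cong (*-cong (ι-poch 2 j 1#) (ι-poch 1 j 1#)) (ι-^ q j) ⟨
          ι (poch 2 j) * ι (poch 1 j) * ι (q ^ j) ∎

    q^-difference≉0 : ∀ i j → i ≢ j → ¬ q ^ i R.- q ^ j R.≈ R.0#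
    q^-difference≉0 i j i≢j eq with ℕ.<-cmp i j
    ... | tri≈ _ i≡j _ = i≢j i≡j
    ... | tri< i<j _ _ = *-nonzero (q^≉0 i) (1-qˡ≉0 (j ℕ.∸ i) (ℕ.m<n⇒0<n∸m i<j)) (R.trans (R.sym (split i<j)) eq)
      where
      split : i ℕ.< j → q ^ i R.- q ^ j R.≈ q ^ i R.* (R.1# R.- q ^ (j ℕ.∸ i))
      split i<j = R.trans (R.+-congˡ (R.-‿cong (R.trans (R.reflexive (≡.cong (q ^_) (≡.sym (ℕ.m+[n∸m]≡n (ℕ.<⇒≤ i<j)))))
        (^-homo-* q i (j ℕ.∸ i)))))
        (SR.solve 2 (λ x y → x SR.:- x SR.:* y SR.:= x SR.:* (SR.con (+ 1) SR.:- y)) R.refl (q ^ i) (q ^ (j ℕ.∸ i)))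
    ... | tri> _ _ j<i = *-nonzero (q^≉0 j) (w≉0 (i ℕ.∸ j) (ℕ.m<n⇒0<n∸m j<i)) (R.trans (R.sym (split j<i)) eq)
      where
      split : j ℕ.< i → q ^ i R.- q ^ j R.≈ q ^ j R.* w (i ℕ.∸ j)
      split j<i = R.trans (R.+-congʳ (R.trans (R.reflexive (≡.cong (q ^_) (≡.sym (ℕ.m+[n∸m]≡n (ℕ.<⇒≤ j<i)))))
        (^-homo-* q j (i ℕ.∸ j))))
        (SR.solve 2 (λ x y → x SR.:* y SR.:- x SR.:= x SR.:* (y SR.:- SR.con (+ 1))) R.refl (q ^ j) (q ^ (i ℕ.∸ j)))

    module _ {a : Carrier} {α : R.Carrier} (a≈ : a ≈ ι α) where

      ι-a·factor : ∀ e k → ι (R.1# R.- α R.* q ^ (e ℕ.+ 4 ℕ.* k)) ≈ S.⟨a·_⟩ a e k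
      ι-a·factor e k = trans (ι-1- _) (+-congˡ (-‿cong (trans (ι-* _ _) (*-cong (sym a≈) (ι-q⁴ e k a)))))

      ι-a-factor : ∀ e k → ι (α R.- q ^ (e ℕ.+ 4 ℕ.* k)) ≈ S.[a-_] a e k
      ι-a-factor e k = trans (ι-- _ _) (+-cong (sym a≈) (-‿cong (ι-q⁴ e k a)))

      ρ-cleared : ∀ k → ¬ ρden α k R.≈ R.0# → S.ρ a k * ι (ρden α k) ≈ ι (ρnum α k)
      ρ-cleared k den≉0 = begin
        S.ρ a k * ι (ρden α k)
          ≈⟨ *-congˡ den≈ ⟩
        S.ρ a k * (S.⟨a·_⟩ a 4 k * S.[a-_] a 4 k * S.⟨_⟩ a 4 k)
          ≈⟨ H.inverseˡ _ (λ eq → ι≉0 den≉0 (trans den≈ eq)) ⟩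
        S.⟨a·_⟩ a 2 k * S.[a-_] a 2 k * S.⟨_⟩ a 2 k * ι q
          ≈⟨ trans (ι-* _ _) (*-congʳ (trans (ι-*₃ _ _ _) (*-cong (*-cong (ι-a·factor 2 k) (ι-a-factor 2 k)) (ι-factor 2 k a)))) ⟨
        ι (ρnum α k) ∎
        where
        den≈ : ι (ρden α k) ≈ S.⟨a·_⟩ a 4 k * S.[a-_] a 4 k * S.⟨_⟩ a 4 k
        den≈ = trans (ι-*₃ _ _ _) (*-cong (*-cong (ι-a·factor 4 k) (ι-a-factor 4 k)) (ι-factor 4 k a))

    -- The specialisation a = q^{2N} with N = 2m + 1

    module AtPower (m : ℕ) where
      α : R.Carrier
      α = q ^ (2 ℕ.+ 4 ℕ.* m)
      open S (ι α)

      -- The two sides differ modulo 4. Hence no factor a - q^{4+4k} of a denominator vanishes at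
      -- this a.
      2+4m≢4+4k : ∀ k → 2 ℕ.+ 4 ℕ.* m ≢ 4 ℕ.+ 4 ℕ.* k
      2+4m≢4+4k k eq with ℕ.≤-<-connex m k
      ... | inj₁ m≤k = ℕ.<⇒≢ (ℕ.+-mono-<-≤ {2} {4} {4 ℕ.* m} {4 ℕ.* k} (ℕ.s≤s (ℕ.s≤s ℕ.z<s)) (ℕ.*-monoʳ-≤ 4 m≤k)) eq
      ... | inj₂ k<m = ℕ.<⇒≢ (ℕ.≤-<-trans {4 ℕ.+ 4 ℕ.* k} {4 ℕ.* m} (ℕ.≤-trans (ℕ.≤-reflexive (≡.sym (ℕ.*-suc 4 k))) (ℕ.*-monoʳ-≤ 4 k<m))
                                 (ℕ.+-monoˡ-< (4 ℕ.* m) {0} {2} ℕ.z<s)) (≡.sym eq)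

      private
        a≈ : ι α ≈ ι q ^ᴷ 2 * x m
        a≈ = ι-q⁴ 2 m (ι α)

        4≉0 : ∀ k → ¬ ⟨ 4 ⟩ k ≈ 0#
        4≉0 k = ⟨⟩≉0 4 k (ι α) ℕ.z<s

        5≉0 : ∀ k → ¬ ⟨ 5 ⟩ k ≈ 0#
        5≉0 k = ⟨⟩≉0 5 k (ι α) ℕ.z<s

        a4≉0 : ∀ k → ¬ ⟨a· 4 ⟩ k ≈ 0#
        a4≉0 k eq = ι≉0 (1-qˡ≉0 (2 ℕ.+ 4 ℕ.* m ℕ.+ (4 ℕ.+ 4 ℕ.* k)) ℕ.z<s)
          (trans (ι-cong (R.+-congˡ (R.-‿cong (^-homo-* q (2 ℕ.+ 4 ℕ.* m) (4 ℕ.+ 4 ℕ.* k)))))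
            (trans (ι-a·factor {ι α} {α} refl 4 k) eq))

        4a≉0 : ∀ k → ¬ [a- 4 ] k ≈ 0#
        4a≉0 k eq = ι≉0 (q^-difference≉0 _ _ (2+4m≢4+4k k)) (trans (ι-a-factor {ι α} {α} refl 4 k) eq)

        one : ∀ {n} → Polynomial n
        one = con (+ 1)

        -- The partial product of `[a- 6 ]` ends at the index m - 1, where the factor is a -
        -- q^{4m+2} = 0; for j = 0 it would be empty.
        F-vanishes : ∀ j → 0 ℕ.< j → j ℕ.≤ m → F m (m ℕ.∸ j) j ≈ 0#
        F-vanishes (suc j) _ (ℕ.s≤s {n = m′} j≤m′) = begin
          P m * ∏ [a- 3 ] i * ∏[ i , suc j ] [a- 6 ] * u (suc j)
            ≈⟨ *-congʳ (*-congˡ (H.∏[]-snoc i j [a- 6 ])) ⟩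
          P m * ∏ [a- 3 ] i * (∏[ i , j ] [a- 6 ] * [a- 6 ] (i ℕ.+ j)) * u (suc j)
            ≈⟨ *-congʳ (*-congˡ (*-congˡ last≈0)) ⟩
          P m * ∏ [a- 3 ] i * (∏[ i , j ] [a- 6 ] * 0#) * u (suc j)
            ≈⟨ solve 3 (λ a b c → a :* (b :* con (+ 0)) :* c := con (+ 0)) refl (P m * ∏ [a- 3 ] i) (∏[ i , j ] [a- 6 ]) (u (suc j)) ⟩
          0# ∎
          where
          i = m′ ℕ.∸ j
          last≈0 : [a- 6 ] (i ℕ.+ j) ≈ 0#
          last≈0 = begin
            ι α - ι q ^ᴷ 6 * x (i ℕ.+ j)
              ≈⟨ +-cong a≈ (-‿cong (*-congˡ (reflexive (≡.cong x (ℕ.m∸n+n≡m j≤m′))))) ⟩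
            ι q ^ᴷ 2 * x (suc m′) - ι q ^ᴷ 6 * x m′
              ≈⟨ solve 2 (λ q y → q :^ 2 :* (q :* q :* q :* q :* y) :- q :^ 6 :* y := con (+ 0)) refl (ι q) (x m′) ⟩
            0# ∎

      -- a − q^(3 + 4k) and a − q^(4 + 4k) are up to a monomial 1 − q^(3 + 4l) and
      -- 1 − q^(2 + 4l) with l = m − 1 − k, so the products in a run backwards.
      flip : ∀ k l → l ℕ.+ k ≡ m →
        ∏ [a- 3 ] k * ∏[ l , k ] ⟨ 2 ⟩ * ι q ^ᴷ k ≈ ∏[ l , k ] ⟨ 3 ⟩ * ∏ [a- 4 ] k
      flip zero    l l+k≡m = *-identityʳ _
      flip (suc k) l l+k≡m = begin
        (A * [a- 3 ] k) * (⟨ 2 ⟩ l * B) * (ι q * ι q ^ᴷ k)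
          ≈⟨ solve 6 (λ A a b B q r → (A :* a) :* (b :* B) :* (q :* r) := a :* b :* q :* (A :* B :* r)) refl
               A ([a- 3 ] k) (⟨ 2 ⟩ l) B (ι q) (ι q ^ᴷ k) ⟩
        [a- 3 ] k * ⟨ 2 ⟩ l * ι q * (A * B * ι q ^ᴷ k)
          ≈⟨ *-cong (*-congʳ (*-congʳ (+-congʳ a≈′))) (flip k (suc l) (≡.trans (≡.sym (ℕ.+-suc l k)) l+k≡m)) ⟩
        (ι q ^ᴷ 2 * (x l * x (suc k)) - ι q ^ᴷ 3 * x k) * ⟨ 2 ⟩ l * ι q * (C * D)
          ≈⟨ solve 5 (λ q y z C D →
               (q :^ 2 :* (z :* (q :* q :* q :* q :* y)) :- q :^ 3 :* y) :* (one :- q :^ 2 :* z) :* q :* (C :* D)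
               := ((one :- q :^ 3 :* z) :* C) :* (D :* (q :^ 2 :* (z :* (q :* q :* q :* q :* y)) :- q :^ 4 :* y)))
               refl (ι q) (x k) (x l) C D ⟩
        (⟨ 3 ⟩ l * C) * (D * (ι q ^ᴷ 2 * (x l * x (suc k)) - ι q ^ᴷ 4 * x k))
          ≈⟨ *-congˡ (*-congˡ (+-congʳ a≈′)) ⟨
        (⟨ 3 ⟩ l * C) * (D * [a- 4 ] k) ∎
        where
        A = ∏ [a- 3 ] k
        B = ∏[ suc l , k ] ⟨ 2 ⟩
        C = ∏[ suc l , k ] ⟨ 3 ⟩
        D = ∏ [a- 4 ] k
        a≈′ : ι α ≈ ι q ^ᴷ 2 * (x l * x (suc k))
        a≈′ = trans a≈ (*-congˡ (trans (reflexive (≡.cong x (≡.sym l+k≡m))) (K^.^-homo-* _ l (suc k))))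

      shift : ∀ k → ∏ ⟨ 6 ⟩ k * ⟨ 2 ⟩ 0 ≈ ∏ ⟨ 2 ⟩ k * ⟨ 2 ⟩ k
      shift zero    = refl
      shift (suc k) = begin
        ∏ ⟨ 6 ⟩ k * ⟨ 6 ⟩ k * ⟨ 2 ⟩ 0
          ≈⟨ solve 3 (λ a b c → a :* b :* c := a :* c :* b) refl (∏ ⟨ 6 ⟩ k) (⟨ 6 ⟩ k) (⟨ 2 ⟩ 0) ⟩
        ∏ ⟨ 6 ⟩ k * ⟨ 2 ⟩ 0 * ⟨ 6 ⟩ k
          ≈⟨ *-cong (shift k) (solve 2 (λ q y → one :- q :^ 6 :* y
               := one :- q :^ 2 :* (q :* q :* q :* q :* y)) refl (ι q) (x k)) ⟩
        ∏ ⟨ 2 ⟩ k * ⟨ 2 ⟩ k * ⟨ 2 ⟩ (suc k) ∎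

      sum≈F : ∑≤ m t ≈ F m m 0
      sum≈F = trans (Identity.truncated-sum 1+q≉0 1-q≉0 4≉0 5≉0 a4≉0 4a≉0 m)
                    (H.∑≤-head m F-vanishes)

      -- In F(m, 0), `shift` rewrites (q⁶)ₘ as (q²)ₘ (1 - q^{2N})/(1 - q²) and `flip` rewrites
      -- (q³/a)ₘ/(q⁴/a)ₘ as (q³)ₘ/((q²)ₘ q^m). Cancelling (q²)ₘ leaves [N]_{q²} (q³)ₘ/((q⁵)ₘ q^m).
      sum-cleared : ∑≤ m t * ι (poch 5 m R.* q ^ m R.* (R.1# R.- q ^ 2)) ≈ ι ((R.1# R.- q ^ (2 ℕ.+ 4 ℕ.* m)) R.* poch 3 m)
      sum-cleared = H.cancelʳ (H.*-nonzero p₂≉0 A₄≉0) (begin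
        ∑≤ m t * ι (poch 5 m R.* q ^ m R.* (R.1# R.- q ^ 2)) * (p₂ * A₄)
          ≈⟨ *-congʳ (*-cong sum≈F (trans (ι-* _ _) (*-cong (trans (ι-* _ _) (*-cong (ι-poch 5 m (ι α)) (ι-^ q m))) 1-q²≈))) ⟩
        P m * A₃ * 1# * 1# * (p₅ * ι q ^ᴷ m * ⟨ 2 ⟩ 0) * (p₂ * A₄)
          ≈⟨ solve 7 (λ P a b r c d e → P :* a :* one :* one :* (b :* r :* c) :* (d :* e)
               := (P :* (e :* b)) :* c :* (a :* d :* r)) refl
               (P m) A₃ p₅ (ι q ^ᴷ m) (⟨ 2 ⟩ 0) p₂ A₄ ⟩
        (P m * (A₄ * p₅)) * ⟨ 2 ⟩ 0 * (A₃ * p₂ * ι q ^ᴷ m)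
          ≈⟨ *-cong (trans (*-congʳ P≈) (shift m)) flipped ⟩
        (p₂ * ⟨ 2 ⟩ m) * (p₃ * A₄)
          ≈⟨ solve 4 (λ a b c d → (a :* b) :* (c :* d) := (b :* c) :* (a :* d)) refl p₂ (⟨ 2 ⟩ m) p₃ A₄ ⟩
        (⟨ 2 ⟩ m * p₃) * (p₂ * A₄)
          ≈⟨ *-congʳ (trans (ι-* _ _) (*-cong (ι-factor 2 m (ι α)) (ι-poch 3 m (ι α)))) ⟨
        ι ((R.1# R.- q ^ (2 ℕ.+ 4 ℕ.* m)) R.* poch 3 m) * (p₂ * A₄) ∎)
        where
        p₂ = ∏ ⟨ 2 ⟩ m
        p₃ = ∏ ⟨ 3 ⟩ m
        p₅ = ∏ ⟨ 5 ⟩ m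
        A₃ = ∏ [a- 3 ] m
        A₄ = ∏ [a- 4 ] m
        1≉0ᴷ : ¬ 1# ≈ 0#
        1≉0ᴷ = H.nonzero⇒1≉0 1+q≉0
        p₂≉0 : ¬ p₂ ≈ 0#
        p₂≉0 = H.∏-nonzero 1≉0ᴷ (λ k → ⟨⟩≉0 2 k (ι α) ℕ.z<s) m
        A₄≉0 : ¬ A₄ ≈ 0#
        A₄≉0 = H.∏-nonzero 1≉0ᴷ 4a≉0 m
        1-q²≈ : ι (R.1# R.- q ^ 2) ≈ ⟨ 2 ⟩ 0
        1-q²≈ = ι-factor 2 0 (ι α)
        P≈ : P m * (A₄ * p₅) ≈ ∏ ⟨ 6 ⟩ m
        P≈ = trans (*-congˡ (sym (∏-* _ _ m))) (∏-quotient ⟨ 6 ⟩ (λ k → H.*-nonzero (4a≉0 k) (5≉0 k)) m)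
        flipped : A₃ * p₂ * ι q ^ᴷ m ≈ p₃ * A₄
        flipped = trans (*-congʳ (*-congˡ (sym (H.∏[]0 m ⟨ 2 ⟩)))) (trans (flip m 0 ≡.refl) (*-congʳ (H.∏[]0 m ⟨ 3 ⟩)))

  import Relation.Binary.Reasoning.Setoid as SetoidReasoning

  -1⊥ : ∀ {x} → R.- R.1# ⊥ x
  -1⊥ {x} = R.- R.1# , R.0# , + 1 , (λ ()) ,
    SR.solve 1 (λ x → (SR.:- SR.con (+ 1)) SR.:* (SR.:- SR.con (+ 1)) SR.:+ SR.con (+ 0) SR.:* x SR.:= SR.con (+ 1)) R.refl x

  1-qˡ≈-1*w : ∀ l → R.1# R.- q ^ l R.≈ R.- R.1# R.* w l
  1-qˡ≈-1*w l = SR.solve 1 (λ x → SR.con (+ 1) SR.:- x SR.:= (SR.:- SR.con (+ 1)) SR.:* (x SR.:- SR.con (+ 1))) R.refl (q ^ l)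

  -- Orders of shifted factorials at π = Φ_d, where d = 2g + 1

  module AtCyclotomic (g : ℕ) (g>0 : 0 ℕ.< g) (π : R.Carrier) (q⊥π : q ⊥ π)
    (w⊥π : ∀ l → ¬ suc (2 ℕ.* g) ∣ l → w l ⊥ π)
    (w-val : ∀ l → 0 ℕ.< l → suc (2 ℕ.* g) ∣ l → AtPrime.Val π (w l) 1) where

    open AtPrime π

    private
      d = suc (2 ℕ.* g)

      -- Since d² = 4(g² + g) + 1, a common divisor of d and 4 divides 1.
      coprime : Coprime d 4
      coprime {i} (i∣d , i∣4) = ∣1⇒≡1 (∣m+n∣m⇒∣n (≡.subst (i ∣_) (square g) (∣n⇒∣m*n d i∣d))
        (∣-trans i∣4 (m∣m*n (g ℕ.* g ℕ.+ g))))
        where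
        square : ∀ g → suc (2 ℕ.* g) ℕ.* suc (2 ℕ.* g) ≡ 4 ℕ.* (g ℕ.* g ℕ.+ g) ℕ.+ 1
        square = solve-∀

    1-qˡ⊥π : ∀ l → ¬ d ∣ l → R.1# R.- q ^ l ⊥ π
    1-qˡ⊥π l d∤l = ⊥-respˡ (R.sym (1-qˡ≈-1*w l)) (*⊥ -1⊥ (w⊥π l d∤l))

    1-qˡ-val : ∀ l → 0 ℕ.< l → d ∣ l → Val (R.1# R.- q ^ l) 1
    1-qˡ-val l l>0 d∣l = Val-resp (R.sym (1-qˡ≈-1*w l)) (Val-* (Val-⊥ -1⊥) (w-val l l>0 d∣l))

    -- n is ⌊(k + b)/d⌋, given by the two inequalities that determine it, so orders can be compared
    -- without division.
    record PochVal (e b k : ℕ) : Set (c ⊔ ℓ) where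
      field
        n     : ℕ
        isVal : Val (poch e k) n
        lower : n ℕ.* d ℕ.≤ k ℕ.+ b
        upper : k ℕ.+ b ℕ.< suc n ℕ.* d
    open PochVal

    -- The number of i < k such that d divides e + 4i is ⌊(k + c)/d⌋, where
    -- c + 1 is the residue of e/4 mod d in the range 1, …, d.
    poch-val : ∀ e s c → 4 ℕ.* suc c ≡ e ℕ.+ s ℕ.* d → 0 ℕ.< e → c ℕ.< d → ∀ k → PochVal e c k
    poch-val e s c eq e>0 c<d zero = record
      { n = 0 ; isVal = Val-⊥ 1⊥ ; lower = ℕ.z≤n ; upper = ≡.subst (c ℕ.<_) (≡.sym (ℕ.+-identityʳ d)) c<d }
    poch-val e s c eq e>0 c<d (suc k) = extend (d ∣? suc (k ℕ.+ c))
      where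
      ih = poch-val e s c eq e>0 c<d k
      e+4k = e ℕ.+ 4 ℕ.* k
      e+4k>0 : 0 ℕ.< e+4k
      e+4k>0 = ℕ.<-≤-trans e>0 (ℕ.m≤m+n e _)

      quadruple : 4 ℕ.* suc (k ℕ.+ c) ≡ e+4k ℕ.+ s ℕ.* d
      quadruple = ≡.trans (lem₁ k c) (≡.trans (≡.cong (4 ℕ.* k ℕ.+_) eq) (lem₂ (4 ℕ.* k) e (s ℕ.* d)))
        where
        lem₁ : ∀ k c → 4 ℕ.* suc (k ℕ.+ c) ≡ 4 ℕ.* k ℕ.+ 4 ℕ.* suc c
        lem₁ = solve-∀
        lem₂ : ∀ x y z → x ℕ.+ (y ℕ.+ z) ≡ y ℕ.+ x ℕ.+ z
        lem₂ = solve-∀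

      to : d ∣ suc (k ℕ.+ c) → d ∣ e+4k
      to d∣ = ∣m+n∣m⇒∣n (≡.subst (d ∣_) (≡.trans quadruple (ℕ.+-comm e+4k (s ℕ.* d))) (∣n⇒∣m*n 4 d∣)) (n∣m*n s)

      from : d ∣ e+4k → d ∣ suc (k ℕ.+ c)
      from d∣ = coprime-divisor coprime (≡.subst (d ∣_) (≡.sym quadruple) (∣m∣n⇒∣m+n d∣ (n∣m*n s)))

      -- The floor jumps exactly when d divides k + c + 1. As 4(k + c + 1) = e + 4k + s d with d
      -- coprime to 4, this is exactly when π divides the new factor 1 - q^{e+4k}.
      extend : Dec (d ∣ suc (k ℕ.+ c)) → PochVal e c (suc k)
      extend (yes d∣@(divides t eqₜ)) = record
        { n     = suc (n ih)
        ; isVal = ≡.subst (Val _) (ℕ.+-comm (n ih) 1) (Val-* (isVal ih) (1-qˡ-val e+4k e+4k>0 (to d∣)))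
        ; lower = ℕ.≤-trans (ℕ.*-monoˡ-≤ d n<t) (ℕ.≤-reflexive (≡.sym eqₜ))
        ; upper = ℕ.≤-<-trans (upper ih) (ℕ.*-monoˡ-< d (ℕ.n<1+n (suc (n ih))))
        }
        where
        n<t : n ih ℕ.< t
        n<t = ℕ.*-cancelʳ-< d (n ih) t (ℕ.≤-<-trans (lower ih) (ℕ.≤-reflexive eqₜ))
      extend (no d∤) = record
        { n     = n ih
        ; isVal = ≡.subst (Val _) (ℕ.+-identityʳ (n ih)) (Val-* (isVal ih) (Val-⊥ (1-qˡ⊥π e+4k λ d∣ → d∤ (from d∣))))
        ; lower = ℕ.m≤n⇒m≤1+n (lower ih)
        ; upper = ℕ.≤∧≢⇒< (upper ih) λ eqₙ → d∤ (divides (suc (n ih)) eqₙ)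
        }

    ≤-val : ∀ {e c k} t → t ℕ.* d ℕ.≤ k ℕ.+ c → (v : PochVal e c k) → t ℕ.≤ n v
    ≤-val t td≤ v = ℕ.s≤s⁻¹ (ℕ.*-cancelʳ-< d t (suc (n v)) (ℕ.≤-<-trans td≤ (upper v)))

    val-≤ : ∀ {e c k} t → k ℕ.+ c ℕ.< suc t ℕ.* d → (v : PochVal e c k) → n v ℕ.≤ t
    val-≤ t <td v = ℕ.s≤s⁻¹ (ℕ.*-cancelʳ-< d (n v) (suc t) (ℕ.≤-<-trans (lower v) <td))

    val-mono : ∀ {e c e′ c′ k} → c ℕ.≤ c′ → (v : PochVal e c k) (v′ : PochVal e′ c′ k) → n v ℕ.≤ n v′
    val-mono {k = k} c≤c′ v v′ = ≤-val (n v) (ℕ.≤-trans (lower v) (ℕ.+-monoʳ-≤ k c≤c′)) v′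

    val₂ : ∀ k → PochVal 2 g k
    val₂ = poch-val 2 2 g (lem g) ℕ.z<s (ℕ.s≤s (ℕ.m≤m+n g _))
      where
      lem : ∀ g → 4 ℕ.* suc g ≡ 2 ℕ.+ 2 ℕ.* suc (2 ℕ.* g)
      lem = solve-∀

    val₄ : ∀ k → PochVal 4 0 k
    val₄ = poch-val 4 0 0 ≡.refl ℕ.z<s ℕ.z<s

    d∤2 : ¬ d ∣ 2
    d∤2 d∣2 = ℕ.<⇒≱ (ℕ.s≤s (ℕ.≤-trans (ℕ.+-mono-≤ g>0 (ℕ.≤-trans g>0 (ℕ.≤-reflexive (≡.sym (ℕ.+-identityʳ g))))) ℕ.≤-refl)) (∣⇒≤ d∣2)

    1+q⊥π : R.1# R.+ q ⊥ π
    1+q⊥π = factor⊥ (SR.solve 1 (λ x → x SR.:^ 2 SR.:- SR.con (+ 1) SR.:= (x SR.:- SR.con (+ 1)) SR.:* (SR.con (+ 1) SR.:+ x)) R.refl q)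
              (w⊥π 2 d∤2)

    Div-∑ : ∀ {k f} n → (∀ i → i ℕ.≤ n → Div k (f i)) → Div k (∑≤ n f)
    Div-∑ zero    div-f = div-f 0 ℕ.z≤n
    Div-∑ (suc n) div-f = Div-+ (Div-∑ n λ i i≤n → div-f i (ℕ.m≤n⇒m≤1+n i≤n)) (div-f (suc n) ℕ.≤-refl)

    S₁ : ℕ → K.Carrier
    S₁ m = ∑≤ m (S.t K.1#)

    *≉0 : ∀ {x y} → ¬ x R.≈ R.0# → ¬ y R.≈ R.0# → ¬ x R.* y R.≈ R.0#
    *≉0 = *-nonzero

    1+q≉0ᴿ : ¬ R.1# R.+ q R.≈ R.0#
    1+q≉0ᴿ eq = w≉0 2 ℕ.z<s (R.trans
      (SR.solve 1 (λ x → x SR.:^ 2 SR.:- SR.con (+ 1) SR.:= (SR.con (+ 1) SR.:+ x) SR.:* (x SR.:- SR.con (+ 1))) R.refl q)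
      (R.trans (R.*-congʳ eq) (R.zeroˡ _)))

    Val-cube : ∀ {b n} → Val b n → Val (b ^ 3) (n ℕ.+ (n ℕ.+ (n ℕ.+ 0)))
    Val-cube v = Val-* v (Val-* v (Val-* v (Val-⊥ 1⊥)))

    -- (q²;q⁴)ₖ has one factor divisible by π more than (q⁴;q⁴)ₖ when
    -- k mod d > g.
    tail-term : ∀ α y → y ℕ.< g → Div 2 (S.t K.1# (α ℕ.* d ℕ.+ g ℕ.+ suc y))
    tail-term α y y<g = Div-quotient inv inverseʳ 2
      (ι≉0 (*≉0 1+q≉0ᴿ (*≉0 p₄≉0 (*≉0 p₄≉0 (*≉0 p₄≉0 1≉0)))))
      (R.trans (R.*-congʳ (R.*-congˡ (Val.b≈ cube₂)))
        (SR.solve 4 (λ c p v r → c SR.:* (p SR.:* v) SR.:* r SR.:= p SR.:* (c SR.:* v SR.:* r)) R.refl _ _ (Val.v cube₂) (q ^ k)))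
      (Val-* (Val-⊥ 1+q⊥π) (Val-cube (isVal v₄)))
      bound
      (At1.t-cleared k)
      where
      k = α ℕ.* d ℕ.+ g ℕ.+ suc y
      v₂ = val₂ k
      v₄ = val₄ k
      cube₂ = Val-cube (isVal v₂)
      p₄≉0 : ¬ poch 4 k R.≈ R.0#
      p₄≉0 = poch≉0 4 k ℕ.z<s
      n₂≥ : suc α ℕ.≤ n v₂
      n₂≥ = ≤-val (suc α) (ℕ.≤-trans (ℕ.m≤m+n _ y) (ℕ.≤-reflexive (lem α g y))) v₂
        where
        lem : ∀ α g y → suc α ℕ.* suc (2 ℕ.* g) ℕ.+ y ≡ α ℕ.* suc (2 ℕ.* g) ℕ.+ g ℕ.+ suc y ℕ.+ g
        lem = solve-∀
      n₄≤ : n v₄ ℕ.≤ α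
      n₄≤ = val-≤ α (ℕ.≤-<-trans (ℕ.≤-reflexive (lem₁ α g y)) (ℕ.<-≤-trans (ℕ.+-monoʳ-< (α ℕ.* d ℕ.+ suc g) y<g) (ℕ.≤-reflexive (lem₂ α g)))) v₄
        where
        lem₁ : ∀ α g y → α ℕ.* suc (2 ℕ.* g) ℕ.+ g ℕ.+ suc y ℕ.+ 0 ≡ α ℕ.* suc (2 ℕ.* g) ℕ.+ suc g ℕ.+ y
        lem₁ = solve-∀
        lem₂ : ∀ α g → α ℕ.* suc (2 ℕ.* g) ℕ.+ suc g ℕ.+ g ≡ suc α ℕ.* suc (2 ℕ.* g)
        lem₂ = solve-∀
      n₄<n₂ : n v₄ ℕ.< n v₂
      n₄<n₂ = ℕ.≤-<-trans n₄≤ n₂≥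
      bound : 2 ℕ.+ (0 ℕ.+ (n v₄ ℕ.+ (n v₄ ℕ.+ (n v₄ ℕ.+ 0)))) ℕ.≤ n v₂ ℕ.+ (n v₂ ℕ.+ (n v₂ ℕ.+ 0))
      bound = ℕ.≤-trans (ℕ.n≤1+n _) (ℕ.≤-trans (ℕ.≤-reflexive (lem (n v₄)))
        (ℕ.+-mono-≤ n₄<n₂ (ℕ.+-mono-≤ n₄<n₂ (ℕ.+-monoˡ-≤ 0 n₄<n₂))))
        where
        lem : ∀ x → 3 ℕ.+ (x ℕ.+ (x ℕ.+ (x ℕ.+ 0))) ≡ suc x ℕ.+ (suc x ℕ.+ (suc x ℕ.+ 0))
        lem = solve-∀

    tail : ∀ α y → y ℕ.≤ g → Div 2 (S₁ (α ℕ.* d ℕ.+ g ℕ.+ y) K.- S₁ (α ℕ.* d ℕ.+ g))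
    tail α zero _ rewrite ℕ.+-identityʳ (α ℕ.* d ℕ.+ g) = Div-ι {2} {r = R.0#} R.0#
      (K.trans (K.-‿inverseʳ _) (K.sym ι-0)) (R.sym (R.zeroʳ _))
    tail α (suc y) y<g = Div-resp (K.sym step) (Div-+ (tail α y (ℕ.<⇒≤ y<g)) (tail-term α y y<g))
      where
      b = α ℕ.* d ℕ.+ g
      step : S₁ (b ℕ.+ suc y) K.- S₁ b K.≈ S₁ (b ℕ.+ y) K.- S₁ b K.+ S.t K.1# (b ℕ.+ suc y)
      step rewrite ℕ.+-suc b y = solve 3 (λ s u t → s :+ t :- u := s :- u :+ t) K.refl
        (S₁ (b ℕ.+ y)) (S₁ b) (S.t K.1# (suc (b ℕ.+ y)))

    -- Counting factors for d = 4h + 3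

    module Congruent3Mod4 (h : ℕ) (g≡ : g ≡ suc (2 ℕ.* h)) where

      private
        -- s is chosen with 4 ∣ e + s d, and r is the gap d - 1 - c. Modulo d = 4h + 3 the quotients
        -- 1/4, 3/4, 5/4 and 6/4 are h + 1, 3h + 3, h + 2 and 2h + 3, which gives the values of c
        -- below.
        poch-val′ : ∀ e s (c r : ℕ → ℕ) → 0 ℕ.< e → (∀ h → 4 ℕ.* suc (c h) ≡ e ℕ.+ s ℕ.* suc (2 ℕ.* suc (2 ℕ.* h))) →
                    (∀ h → c h ℕ.+ suc (r h) ≡ suc (2 ℕ.* suc (2 ℕ.* h))) → ∀ k → PochVal e (c h) k
        poch-val′ e s c r e>0 eq lt = poch-val e s (c h)
          (≡.trans (eq h) (≡.cong (λ g → e ℕ.+ s ℕ.* suc (2 ℕ.* g)) (≡.sym g≡))) e>0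
          (ℕ.<-≤-trans (ℕ.m<m+n (c h) ℕ.z<s) (ℕ.≤-reflexive (≡.trans (lt h) (≡.cong (λ g → suc (2 ℕ.* g)) (≡.sym g≡)))))

      val₁ : ∀ k → PochVal 1 h k
      val₁ = poch-val′ 1 1 (λ h → h) (λ h → 3 ℕ.* h ℕ.+ 2) ℕ.z<s eq lt
        where
        eq : ∀ h → 4 ℕ.* suc (h) ≡ 1 ℕ.+ 1 ℕ.* suc (2 ℕ.* suc (2 ℕ.* h))
        eq = solve-∀
        lt : ∀ h → h ℕ.+ suc (3 ℕ.* h ℕ.+ 2) ≡ suc (2 ℕ.* suc (2 ℕ.* h))
        lt = solve-∀

      val₃ : ∀ k → PochVal 3 (3 ℕ.* h ℕ.+ 2) k
      val₃ = poch-val′ 3 3 (λ h → 3 ℕ.* h ℕ.+ 2) (λ h → h) ℕ.z<s eq lt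
        where
        eq : ∀ h → 4 ℕ.* suc (3 ℕ.* h ℕ.+ 2) ≡ 3 ℕ.+ 3 ℕ.* suc (2 ℕ.* suc (2 ℕ.* h))
        eq = solve-∀
        lt : ∀ h → 3 ℕ.* h ℕ.+ 2 ℕ.+ suc (h) ≡ suc (2 ℕ.* suc (2 ℕ.* h))
        lt = solve-∀

      val₅ : ∀ k → PochVal 5 (h ℕ.+ 1) k
      val₅ = poch-val′ 5 1 (λ h → h ℕ.+ 1) (λ h → 3 ℕ.* h ℕ.+ 1) ℕ.z<s eq lt
        where
        eq : ∀ h → 4 ℕ.* suc (h ℕ.+ 1) ≡ 5 ℕ.+ 1 ℕ.* suc (2 ℕ.* suc (2 ℕ.* h))
        eq = solve-∀
        lt : ∀ h → h ℕ.+ 1 ℕ.+ suc (3 ℕ.* h ℕ.+ 1) ≡ suc (2 ℕ.* suc (2 ℕ.* h))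
        lt = solve-∀

      val₆ : ∀ k → PochVal 6 (2 ℕ.* h ℕ.+ 2) k
      val₆ = poch-val′ 6 2 (λ h → 2 ℕ.* h ℕ.+ 2) (λ h → 2 ℕ.* h) ℕ.z<s eq lt
        where
        eq : ∀ h → 4 ℕ.* suc (2 ℕ.* h ℕ.+ 2) ≡ 6 ℕ.+ 2 ℕ.* suc (2 ℕ.* suc (2 ℕ.* h))
        eq = solve-∀
        lt : ∀ h → 2 ℕ.* h ℕ.+ 2 ℕ.+ suc (2 ℕ.* h) ≡ suc (2 ℕ.* suc (2 ℕ.* h))
        lt = solve-∀

      Fnum-val : ∀ m i j (v₆ : PochVal 6 (2 ℕ.* h ℕ.+ 2) m) →
        Val (At1.Fnum m i j) (n v₆ ℕ.+ n v₆ ℕ.+ n (val₃ i) ℕ.+ (n (val₂ j) ℕ.+ n (val₁ j) ℕ.+ 0))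
      Fnum-val m i j v₆ = Val-* (Val-* (Val-* (isVal v₆) (isVal v₆)) (isVal (val₃ i)))
                                (Val-* (Val-* (isVal (val₂ j)) (isVal (val₁ j))) (Val-⊥ (⊥-power j q⊥π)))

      Fden-val : ∀ m i j (v₄ : PochVal 4 0 m) (v₅ : PochVal 5 (h ℕ.+ 1) m) →
        Val (At1.Fden m i j) (n v₄ ℕ.+ n v₅ ℕ.+ n (val₆ i) ℕ.+ (n (val₄ j) ℕ.+ n (val₄ j)))
      Fden-val m i j v₄ v₅ = Val-* (Val-* (Val-* (isVal v₄) (isVal v₅)) (isVal (val₆ i))) (Val-* (isVal (val₄ j)) (isVal (val₄ j)))

      Fden≉0 : ∀ m i j → ¬ At1.Fden m i j R.≈ R.0#
      Fden≉0 m i j = *≉0 (*≉0 (*≉0 (poch≉0 4 m ℕ.z<s) (poch≉0 5 m ℕ.z<s)) (poch≉0 6 i ℕ.z<s))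
                         (*≉0 (poch≉0 4 j ℕ.z<s) (poch≉0 4 j ℕ.z<s))

      private
        bound : ∀ {a b e c₃ c₆ c₂ c₁ c₄} → a ℕ.< e → b ℕ.< e → c₆ ℕ.≤ c₃ → c₄ ℕ.≤ c₂ → c₄ ℕ.≤ c₁ →
          2 ℕ.+ (a ℕ.+ b ℕ.+ c₆ ℕ.+ (c₄ ℕ.+ c₄)) ℕ.≤ e ℕ.+ e ℕ.+ c₃ ℕ.+ (c₂ ℕ.+ c₁ ℕ.+ 0)
        bound {a} {b} {c₆ = c₆} {c₄ = c₄} a<e b<e c₆≤ c₄≤c₂ c₄≤c₁ = ℕ.≤-trans (ℕ.≤-reflexive (lem a b c₆ c₄))
          (ℕ.+-mono-≤ (ℕ.+-mono-≤ (ℕ.+-mono-≤ a<e b<e) c₆≤) (ℕ.+-monoˡ-≤ 0 (ℕ.+-mono-≤ c₄≤c₂ c₄≤c₁)))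
          where
          lem : ∀ a b c e → 2 ℕ.+ (a ℕ.+ b ℕ.+ c ℕ.+ (e ℕ.+ e)) ≡ suc a ℕ.+ suc b ℕ.+ c ℕ.+ (e ℕ.+ e ℕ.+ 0)
          lem = solve-∀

        2h+2≤3h+2 : 2 ℕ.* h ℕ.+ 2 ℕ.≤ 3 ℕ.* h ℕ.+ 2
        2h+2≤3h+2 = ℕ.+-monoˡ-≤ 2 (ℕ.*-monoˡ-≤ h (ℕ.s≤s (ℕ.s≤s (ℕ.z≤n {1}))))

      -- The two copies of (q⁶)ₘ gain one factor π each, over (q⁴)ₘ and (q⁵)ₘ. The quotients
      -- (q³)ᵢ/(q⁶)ᵢ and (q²)ⱼ(q)ⱼ/(q⁴)ⱼ² have non-negative order for all i and j, by comparing
      -- offsets alone.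
      F-Div′ : ∀ m i j → i ℕ.+ j ≡ m →
        (v₄ : PochVal 4 0 m) (v₅ : PochVal 5 (h ℕ.+ 1) m) (v₆ : PochVal 6 (2 ℕ.* h ℕ.+ 2) m) →
        n v₄ ℕ.< n v₆ → n v₅ ℕ.< n v₆ → Div 2 (S.F K.1# m i j)
      F-Div′ m i j ≡.refl v₄ v₅ v₆ n₄<n₆ n₅<n₆ =
        Div-quotient inv inverseʳ 2 (ι≉0 (Fden≉0 m i j)) (Val.b≈ (Fnum-val m i j v₆)) (Fden-val m i j v₄ v₅)
          (bound n₄<n₆ n₅<n₆ (val-mono 2h+2≤3h+2 (val₆ i) (val₃ i)) (val-mono ℕ.z≤n (val₄ j) (val₂ j)) (val-mono ℕ.z≤n (val₄ j) (val₁ j)))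
          (At1.F-cleared i j)

      module _ (μ : ℕ) where
        private
          M = μ ℕ.* d ℕ.+ g

        -- This is tight: M + 2h + 2 = (μ + 1)d, so at this truncation (q⁶) has just reached the
        -- multiple of d that (q⁴) and (q⁵) still lack.
        n₆≥ : suc μ ℕ.≤ n (val₆ M)
        n₆≥ = ≤-val (suc μ) (ℕ.≤-reflexive (lem g g≡)) (val₆ M)
          where
          lem′ : ∀ μ h → let g = suc (2 ℕ.* h) in suc μ ℕ.* suc (2 ℕ.* g) ≡ μ ℕ.* suc (2 ℕ.* g) ℕ.+ g ℕ.+ (2 ℕ.* h ℕ.+ 2)
          lem′ = solve-∀
          lem : ∀ g → g ≡ suc (2 ℕ.* h) → suc μ ℕ.* suc (2 ℕ.* g) ≡ μ ℕ.* suc (2 ℕ.* g) ℕ.+ g ℕ.+ (2 ℕ.* h ℕ.+ 2)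
          lem _ ≡.refl = lem′ μ h

        n₃≥ : suc μ ℕ.≤ n (val₃ M)
        n₃≥ = ≤-val (suc μ) (ℕ.≤-trans (ℕ.m≤m+n _ h) (ℕ.≤-reflexive (lem g g≡))) (val₃ M)
          where
          lem′ : ∀ μ h → let g = suc (2 ℕ.* h) in suc μ ℕ.* suc (2 ℕ.* g) ℕ.+ h ≡ μ ℕ.* suc (2 ℕ.* g) ℕ.+ g ℕ.+ (3 ℕ.* h ℕ.+ 2)
          lem′ = solve-∀
          lem : ∀ g → g ≡ suc (2 ℕ.* h) → suc μ ℕ.* suc (2 ℕ.* g) ℕ.+ h ≡ μ ℕ.* suc (2 ℕ.* g) ℕ.+ g ℕ.+ (3 ℕ.* h ℕ.+ 2)
          lem _ ≡.refl = lem′ μ h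

        n₄≤ : n (val₄ M) ℕ.≤ μ
        n₄≤ = val-≤ μ (ℕ.<-≤-trans (ℕ.m<m+n _ ℕ.z<s) (ℕ.≤-reflexive (lem μ g))) (val₄ M)
          where
          lem : ∀ μ g → μ ℕ.* suc (2 ℕ.* g) ℕ.+ g ℕ.+ 0 ℕ.+ suc g ≡ suc μ ℕ.* suc (2 ℕ.* g)
          lem = solve-∀

        n₅≤ : n (val₅ M) ℕ.≤ μ
        n₅≤ = val-≤ μ (ℕ.<-≤-trans (ℕ.m<m+n _ ℕ.z<s) (ℕ.≤-reflexive (lem g g≡))) (val₅ M)
          where
          lem′ : ∀ μ h → let g = suc (2 ℕ.* h) in μ ℕ.* suc (2 ℕ.* g) ℕ.+ g ℕ.+ (h ℕ.+ 1) ℕ.+ suc h ≡ suc μ ℕ.* suc (2 ℕ.* g)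
          lem′ = solve-∀
          lem : ∀ g → g ≡ suc (2 ℕ.* h) → μ ℕ.* suc (2 ℕ.* g) ℕ.+ g ℕ.+ (h ℕ.+ 1) ℕ.+ suc h ≡ suc μ ℕ.* suc (2 ℕ.* g)
          lem _ ≡.refl = lem′ μ h

        F-Div : ∀ i j → i ℕ.+ j ≡ M → Div 2 (S.F K.1# M i j)
        F-Div i j i+j≡M = F-Div′ M i j i+j≡M (val₄ M) (val₅ M) (val₆ M) (ℕ.≤-<-trans n₄≤ n₆≥) (ℕ.≤-<-trans n₅≤ n₆≥)

        S₁-Div : Div 2 (S₁ M)
        S₁-Div = Div-resp (K.sym (At1.truncated M)) (Div-∑ M λ j j≤M → F-Div (M ℕ.∸ j) j (ℕ.m∸n+n≡m j≤M))

        -- One π comes from 1 - q^{2+4M}, as 2 + 4M = (4μ + 2)d, and a second from the surplus of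
        -- (q³) over (q⁵).
        closed-form-Div : ∀ {x} → x K.* ι (poch 5 M R.* q ^ M R.* (R.1# R.- q ^ 2))
                                  K.≈ ι ((R.1# R.- q ^ (2 ℕ.+ 4 ℕ.* M)) R.* poch 3 M) → Div 2 x
        closed-form-Div = Div-quotient inv inverseʳ 2
          (ι≉0 (*≉0 (*≉0 (poch≉0 5 M ℕ.z<s) (q^≉0 M)) (1-qˡ≉0 2 ℕ.z<s)))
          (Val.b≈ num-val)
          (Val-* (Val-* (isVal (val₅ M)) (Val-⊥ (⊥-power M q⊥π))) (Val-⊥ (1-qˡ⊥π 2 d∤2)))
          (ℕ.≤-trans (ℕ.≤-reflexive (lem (n (val₅ M)))) (ℕ.s≤s (ℕ.≤-<-trans n₅≤ n₃≥)))
          where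
          lem : ∀ a → 2 ℕ.+ (a ℕ.+ 0 ℕ.+ 0) ≡ 1 ℕ.+ suc a
          lem = solve-∀
          d∣2+4M : d ∣ 2 ℕ.+ 4 ℕ.* M
          d∣2+4M = divides (4 ℕ.* μ ℕ.+ 2) (lem′ μ g)
            where
            lem′ : ∀ μ g → 2 ℕ.+ 4 ℕ.* (μ ℕ.* suc (2 ℕ.* g) ℕ.+ g) ≡ (4 ℕ.* μ ℕ.+ 2) ℕ.* suc (2 ℕ.* g)
            lem′ = solve-∀
          num-val : Val ((R.1# R.- q ^ (2 ℕ.+ 4 ℕ.* M)) R.* poch 3 M) (1 ℕ.+ n (val₃ M))
          num-val = Val-* (1-qˡ-val (2 ℕ.+ 4 ℕ.* M) ℕ.z<s d∣2+4M) (isVal (val₃ M))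

    -- Comparison of a = 1 with a = q^{2d} modulo Φ_d²

    private
      α : R.Carrier
      α = q ^ (2 ℕ.+ 4 ℕ.* g)

      2+4g≡ : 2 ℕ.+ 4 ℕ.* g ≡ 2 ℕ.* d
      2+4g≡ = lem g
        where
        lem : ∀ g → 2 ℕ.+ 4 ℕ.* g ≡ 2 ℕ.* suc (2 ℕ.* g)
        lem = solve-∀

      -- Since 0 < k + 1 ≤ g < d and d is coprime to 4. It keeps the denominators of the first g
      -- ratios coprime to π for both values of a, because q^{2d} ≡ 1.
      d∤4+4k : ∀ k → k ℕ.< g → ¬ d ∣ 4 ℕ.+ 4 ℕ.* k
      d∤4+4k k k<g d∣ = ℕ.<⇒≱ (ℕ.s≤s (ℕ.≤-trans k<g (ℕ.m≤m+n g _)))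
        (∣⇒≤ (coprime-divisor coprime (≡.subst (d ∣_) (≡.sym (ℕ.*-suc 4 k)) d∣)))

      4+4k≤2+4g : ∀ k → k ℕ.< g → 4 ℕ.+ 4 ℕ.* k ℕ.≤ 2 ℕ.+ 4 ℕ.* g
      4+4k≤2+4g k k<g = ℕ.≤-trans (ℕ.≤-trans (ℕ.≤-reflexive (≡.sym (ℕ.*-suc 4 k))) (ℕ.*-monoʳ-≤ 4 k<g)) (ℕ.m≤n+m (4 ℕ.* g) 2)

      α-Y⊥π : ∀ k → k ℕ.< g → α R.- q ^ (4 ℕ.+ 4 ℕ.* k) ⊥ π
      α-Y⊥π k k<g = ⊥-respˡ (R.sym split) (*⊥ (⊥-power l q⊥π) (w⊥π (2 ℕ.+ 4 ℕ.* g ℕ.∸ l) λ d∣ →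
        d∤4+4k k k<g (∣m+n∣m⇒∣n (≡.subst (d ∣_) (≡.trans (≡.sym 2+4g≡) (≡.sym (ℕ.m∸n+n≡m (4+4k≤2+4g k k<g)))) (n∣m*n 2)) d∣)))
        where
        l = 4 ℕ.+ 4 ℕ.* k
        split : α R.- q ^ l R.≈ q ^ l R.* w (2 ℕ.+ 4 ℕ.* g ℕ.∸ l)
        split = R.trans (R.+-congʳ (R.trans (R.reflexive (≡.cong (q ^_) (≡.sym (ℕ.m+[n∸m]≡n (4+4k≤2+4g k k<g)))))
          (^-homo-* q l (2 ℕ.+ 4 ℕ.* g ℕ.∸ l))))
          (SR.solve 2 (λ x y → x SR.:* y SR.:- x SR.:= x SR.:* (y SR.:- SR.con (+ 1))) R.refl (q ^ l) _)

      1-αY⊥π : ∀ k → k ℕ.< g → R.1# R.- α R.* q ^ (4 ℕ.+ 4 ℕ.* k) ⊥ π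
      1-αY⊥π k k<g = ⊥-respˡ (R.+-congˡ (R.-‿cong (^-homo-* q (2 ℕ.+ 4 ℕ.* g) (4 ℕ.+ 4 ℕ.* k))))
        (1-qˡ⊥π _ λ d∣ → d∤4+4k k k<g (∣m+n∣m⇒∣n d∣ (≡.subst (d ∣_) (≡.sym 2+4g≡) (n∣m*n 2))))

      Y⊥π : ∀ k → k ℕ.< g → R.1# R.- q ^ (4 ℕ.+ 4 ℕ.* k) ⊥ π
      Y⊥π k k<g = 1-qˡ⊥π _ (d∤4+4k k k<g)

      ρden-α⊥π : ∀ k → k ℕ.< g → ρden α k ⊥ π
      ρden-α⊥π k k<g = *⊥ (*⊥ (1-αY⊥π k k<g) (α-Y⊥π k k<g)) (Y⊥π k k<g)

      ρden-1⊥π : ∀ k → k ℕ.< g → ρden R.1# k ⊥ π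
      ρden-1⊥π k k<g = *⊥ (*⊥ (⊥-respˡ (R.+-congˡ (R.-‿cong (R.sym (R.*-identityˡ _)))) (Y⊥π k k<g)) (Y⊥π k k<g)) (Y⊥π k k<g)

      Y≉0 : ∀ k → ¬ R.1# R.- q ^ (4 ℕ.+ 4 ℕ.* k) R.≈ R.0#
      Y≉0 k = 1-qˡ≉0 (4 ℕ.+ 4 ℕ.* k) ℕ.z<s

      ρden-1≉0 : ∀ k → ¬ ρden R.1# k R.≈ R.0#
      ρden-1≉0 k = *≉0 (*≉0 (λ eq → Y≉0 k (R.trans (R.+-congˡ (R.-‿cong (R.sym (R.*-identityˡ _)))) eq)) (Y≉0 k)) (Y≉0 k)

      ρden-α≉0 : ∀ k → ¬ ρden α k R.≈ R.0#
      ρden-α≉0 k = *≉0 (*≉0 (λ eq → 1-qˡ≉0 (2 ℕ.+ 4 ℕ.* g ℕ.+ (4 ℕ.+ 4 ℕ.* k)) ℕ.z<s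
          (R.trans (R.+-congˡ (R.-‿cong (^-homo-* q (2 ℕ.+ 4 ℕ.* g) (4 ℕ.+ 4 ℕ.* k)))) eq))
        (q^-difference≉0 (2 ℕ.+ 4 ℕ.* g) (4 ℕ.+ 4 ℕ.* k) (AtPower.2+4m≢4+4k g k))) (Y≉0 k)

      ρ₁ ρₐ : ℕ → K.Carrier
      ρ₁ = S.ρ K.1#
      ρₐ = S.ρ (ι α)

      ρ₁-cleared : ∀ k → ρ₁ k K.* ι (ρden R.1# k) K.≈ ι (ρnum R.1# k)
      ρ₁-cleared k = ρ-cleared (K.sym ι-1) k (ρden-1≉0 k)

      ρₐ-cleared : ∀ k → ρₐ k K.* ι (ρden α k) K.≈ ι (ρnum α k)
      ρₐ-cleared k = ρ-cleared K.refl k (ρden-α≉0 k)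

      Div-clear : ∀ {x a b} → b ⊥ π → x K.* ι b K.≈ ι a → Div 0 x
      Div-clear {x} {a} {b} b⊥π eq = div a b b⊥π (K.trans eq (ι-cong (R.sym (R.*-identityˡ a))))

      -- The cleared difference carries (1 - α)², and 1 - α = 1 - q^{2d} has order one at π.
      ρₐ-ρ₁ : ∀ k → k ℕ.< g → Div 2 (ρₐ k K.- ρ₁ k)
      ρₐ-ρ₁ k k<g = div (v R.* v R.* z) (ρden α k R.* ρden R.1# k) (*⊥ (ρden-α⊥π k k<g) (ρden-1⊥π k k<g)) (begin
        (ρₐ k - ρ₁ k) * ι (ρden α k R.* ρden R.1# k)
          ≈⟨ *-congˡ (ι-* _ _) ⟩
        (ρₐ k - ρ₁ k) * (ι (ρden α k) * ι (ρden R.1# k))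
          ≈⟨ solve 4 (λ a b c e → (a :- b) :* (c :* e) := a :* c :* e :- b :* e :* c) refl
               (ρₐ k) (ρ₁ k) (ι (ρden α k)) (ι (ρden R.1# k)) ⟩
        ρₐ k * ι (ρden α k) * ι (ρden R.1# k) - ρ₁ k * ι (ρden R.1# k) * ι (ρden α k)
          ≈⟨ +-cong (*-congʳ (ρₐ-cleared k)) (-‿cong (*-congʳ (ρ₁-cleared k))) ⟩
        ι (ρnum α k) * ι (ρden R.1# k) - ι (ρnum R.1# k) * ι (ρden α k)
          ≈⟨ +-cong (ι-* _ _) (-‿cong (ι-* _ _)) ⟨
        ι (ρnum α k R.* ρden R.1# k) - ι (ρnum R.1# k R.* ρden α k)
          ≈⟨ ι-- _ _ ⟨
        ι (ρnum α k R.* ρden R.1# k R.- ρnum R.1# k R.* ρden α k)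
          ≈⟨ ι-cong (R.trans (proj₂ (ρnum-ρden α k)) (R.*-congʳ (R.*-cong 1-α≈ 1-α≈))) ⟩
        ι ((π ^ 1 R.* v) R.* (π ^ 1 R.* v) R.* z)
          ≈⟨ ι-cong (SR.solve 3 (λ p v z → (p SR.:^ 1 SR.:* v) SR.:* (p SR.:^ 1 SR.:* v) SR.:* z SR.:= p SR.:^ 2 SR.:* (v SR.:* v SR.:* z)) R.refl π v z) ⟩
        ι (π ^ 2 R.* (v R.* v R.* z)) ∎)
        where
        open K
        open SetoidReasoning setoid
        1-α-val : Val (R.1# R.- α) 1
        1-α-val = 1-qˡ-val _ ℕ.z<s (≡.subst (d ∣_) (≡.sym 2+4g≡) (n∣m*n 2))
        v = Val.v 1-α-val
        1-α≈ : R.1# R.- α R.≈ π ^ 1 R.* v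
        1-α≈ = Val.b≈ 1-α-val
        z = proj₁ (ρnum-ρden α k)

      -- The product rule a x - b y = (a - b) y + a (x - y) needs its cofactors free of π in the
      -- denominator, so this is carried along for both products.
      ∏ρ-Div : ∀ k → k ℕ.≤ g → Div 0 (∏ ρ₁ k) × Div 0 (∏ ρₐ k) × Div 2 (∏ ρₐ k K.- ∏ ρ₁ k)
      ∏ρ-Div zero _ = Div-ι₀ R.1# (K.sym ι-1) , Div-ι₀ R.1# (K.sym ι-1) ,
        Div-ι {2} {r = R.0#} R.0# (K.trans (K.-‿inverseʳ _) (K.sym ι-0)) (R.sym (R.zeroʳ _))
      ∏ρ-Div (suc k) k<g = Div-* p₁ r₁ , Div-* pₐ rₐ , Div-resp
        (solve 4 (λ a b x y → (a :- b) :* y :+ a :* (x :- y) := a :* x :- b :* y) K.refl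
          (∏ ρₐ k) (∏ ρ₁ k) (ρₐ k) (ρ₁ k))
        (Div-+ (Div-* p r₁) (Div-* pₐ (ρₐ-ρ₁ k k<g)))
        where
        ih = ∏ρ-Div k (ℕ.<⇒≤ k<g)
        p₁ = proj₁ ih
        pₐ = proj₁ (proj₂ ih)
        p  = proj₂ (proj₂ ih)
        r₁ = Div-clear (ρden-1⊥π k k<g) (ρ₁-cleared k)
        rₐ = Div-clear (ρden-α⊥π k k<g) (ρₐ-cleared k)

      t-difference : ∀ k → k ℕ.≤ g → Div 2 (S.t K.1# k K.- S.t (ι α) k)
      t-difference k k≤g = Div-resp
        (solve 4 (λ s y a b → s :* y :* (:- (a :- b)) := s :* y :* b :- s :* y :* a) K.refl
          (inv (K.1# K.+ ι q)) (K.1# K.+ ι q K.* S.x K.1# k) (∏ ρₐ k) (∏ ρ₁ k))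
        (Div-* (Div-* s-Div y-Div) (Div-neg (proj₂ (proj₂ (∏ρ-Div k k≤g)))))
        where
        s-Div : Div 0 (inv (K.1# K.+ ι q))
        s-Div = Div-clear {a = R.1#} 1+q⊥π (K.trans (K.*-comm _ _) (K.trans (K.*-congʳ (K.trans (ι-+ _ _) (K.+-congʳ ι-1)))
          (K.trans (inverseʳ 1+q≉0) (K.sym ι-1))))
        y-Div : Div 0 (K.1# K.+ ι q K.* S.x K.1# k)
        y-Div = Div-ι₀ (R.1# R.+ q R.* q ^ (0 ℕ.+ 4 ℕ.* k)) (K.sym (K.trans (ι-+ _ _)
          (K.+-cong ι-1 (K.trans (ι-* _ _) (K.*-congˡ (K.trans (ι-q⁴ 0 k K.1#) (K.*-identityˡ _)))))))

    S₁-closed-form : Div 2 (S₁ g K.- ∑≤ g (S.t (ι α)))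
    S₁-closed-form = Div-resp (∑-- g) (Div-∑ g t-difference)
      where
      ∑-- : ∀ m → ∑≤ m (λ k → S.t K.1# k K.- S.t (ι α) k) K.≈ S₁ m K.- ∑≤ m (S.t (ι α))
      ∑-- zero = K.refl
      ∑-- (suc m) = K.trans (K.+-congʳ (∑-- m)) (solve 4 (λ a b c e → a :- b :+ (c :- e) := a :+ c :- (b :+ e)) K.refl _ _ _ _)

-- The congruences

open import Data.Nat using (ℕ; _<_; _^_; _*_; _∸_)
open IntegerPolynomials
open MonicDivision
open CyclotomicPolynomials

open import Data.Nat.DivMod using (_%_; _/_; m≡m%n+[m/n]*n; m*n/n≡m)
open import Data.Nat.Tactic.RingSolver using (solve-∀)
open import Data.List.Base using ([])

private module R = CommutativeRing ℤ[q]
open Coprimality ℤ[q]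
open import Algebra.Properties.Semiring.Exp R.semiring using () renaming (_^_ to _^ᴿ_)
import Relation.Binary.Reasoning.Setoid as SetoidReasoning

oneₚ≉0 : ¬ oneₚ ≋ []
oneₚ≉0 = degree⇒≉0 (monic⇒degree monic-one)

module Fr = FractionField ℤ[q] oneₚ≉0 *ₚ-cancelʳ _≟0
open Fr using (Fraction; _/_∣_; cross; ι; invᶠ; invᶠ-inverseʳ; ι-isRingMonomorphism; fraction-num)
ℚ[q] : CommutativeRing _ _
ℚ[q] = Fr.field-of-fractions
private module K = CommutativeRing ℚ[q]

X^1≉0 : ¬ X^ 1 ≋ []
X^1≉0 eq = contradiction (coeff-≡ eq 1) λ ()

open QSeries ℤ[q] ℚ[q] ι ι-isRingMonomorphism invᶠ invᶠ-inverseʳ *-nonzero (X^ 1) X^1≉0 w≉0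
open Valuation ℤ[q] ℚ[q] ι ι-isRingMonomorphism
open H using (∑≤)

-- A common divisor of f and g, up to the integers a and b, divides the nonzero constant a b k and
-- is therefore constant.
⊥⇒Coprimeₚ : ∀ {f g} → f ⊥ g → Coprimeₚ f g
⊥⇒Coprimeₚ {f} {g} (u , v , k , k≢0 , eq) d (a , x , a≢0 , af≈dx) (b , y , b≢0 , bg≈dy) =
  proj₁ const , ≋⇒≈ₚ (proj₂ const)
  where
  open SetoidReasoning R.setoid
  open IntegerCoefficients ℤ[q]
  c = a ℤ.* b ℤ.* k
  c≢0 : c ≢ + 0
  c≢0 = (a≢0 ≢0×≢0⇒*≢0 b≢0) ≢0×≢0⇒*≢0 k≢0
  A = constₚ a
  B = constₚ b
  d*≋c : d *ₚ (B *ₚ u *ₚ x +ₚ A *ₚ v *ₚ y) ≋ constₚ c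
  d*≋c = begin
    d *ₚ (B *ₚ u *ₚ x +ₚ A *ₚ v *ₚ y)
      ≈⟨ solve 7 (λ d x y A B u v → d :* (B :* u :* x :+ A :* v :* y) := B :* u :* (d :* x) :+ A :* v :* (d :* y)) R.refl d x y A B u v ⟩
    B *ₚ u *ₚ (d *ₚ x) +ₚ A *ₚ v *ₚ (d *ₚ y)
      ≈⟨ R.+-cong (R.*-congˡ {B *ₚ u} (≈ₚ⇒≋ {A *ₚ f} af≈dx)) (R.*-congˡ {A *ₚ v} (≈ₚ⇒≋ {B *ₚ g} bg≈dy)) ⟨
    B *ₚ u *ₚ (A *ₚ f) +ₚ A *ₚ v *ₚ (B *ₚ g)
      ≈⟨ solve 6 (λ f g A B u v → B :* u :* (A :* f) :+ A :* v :* (B :* g) := A :* B :* (u :* f :+ v :* g)) R.refl f g A B u v ⟩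
    A *ₚ B *ₚ (u *ₚ f +ₚ v *ₚ g)
      ≈⟨ R.*-cong (constₚ-* a b) (R.sym (R.trans eq (fromℤ≋constₚ k))) ⟨
    constₚ (a ℤ.* b) *ₚ constₚ k
      ≈⟨ constₚ-* (a ℤ.* b) k ⟨
    constₚ c ∎
  const = const-divisor {d} {B *ₚ u *ₚ x +ₚ A *ₚ v *ₚ y} c≢0 d*≋c

toFraction : (f : RatF) → ¬ proj₂ f ≋ [] → Fraction
toFraction (a , b) b≉0 = a / b ∣ b≉0

Multiple⇒≡modₚ : ∀ A B (a≉0 : ¬ proj₂ A ≋ []) (b≉0 : ¬ proj₂ B ≋ []) {P} →
  Multiple P (toFraction A a≉0 K.- toFraction B b≉0) → A ≡ B [modₚ P ]
Multiple⇒≡modₚ (a₁ , a₂) (b₁ , b₂) _ _ {P} (u , v , v⊥P , cross eq) = u , v , ⊥⇒Coprimeₚ v⊥P , ≋⇒≈ₚ (begin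
  (a₁ *ₚ b₂ -ₚ b₁ *ₚ a₂) *ₚ v
    ≈⟨ solve 5 (λ a b c d v → (a :* b :- c :* d) :* v := (a :* b :+ (:- c) :* d) :* v :* con (+ 1)) R.refl a₁ b₂ b₁ a₂ v ⟩
  (a₁ *ₚ b₂ +ₚ negₚ b₁ *ₚ a₂) *ₚ v *ₚ oneₚ
    ≈⟨ eq ⟩
  P *ₚ u *ₚ (a₂ *ₚ b₂ *ₚ oneₚ)
    ≈⟨ R.*-congˡ {P *ₚ u} (R.*-identityʳ (a₂ *ₚ b₂)) ⟩
  P *ₚ u *ₚ (a₂ *ₚ b₂) ∎)
  where
  open SetoidReasoning R.setoid
  open IntegerCoefficients ℤ[q]

toFraction-unique : ∀ {x} f (f≉0 : ¬ proj₂ f ≋ []) → x K.* ι (proj₂ f) K.≈ ι (proj₁ f) → x K.≈ toFraction f f≉0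
toFraction-unique f@(a , b) b≉0 eq = H.cancelʳ {d = ι b} (ι≉0 {b} b≉0) (K.trans eq (K.sym (fraction-num (toFraction f b≉0))))

qPoch≋ : ∀ e k → qPoch e 4 k ≋ poch e k
qPoch≋ e zero    = ≋-refl
qPoch≋ e (suc k) = R.*-cong (qPoch≋ e k) (R.+-congˡ {oneₚ} (R.-‿cong (X^≋ (e ℕ.+ 4 ℕ.* k))))

qPoch≉0 : ∀ e k → 0 ℕ.< e → ¬ qPoch e 4 k ≋ []
qPoch≉0 e k e>0 eq = poch≉0 e k e>0 (R.trans (R.sym (qPoch≋ e k)) eq)

cube-cong : ∀ {f g} → f ≋ g → f ^ₚ 3 ≋ g ^ᴿ 3
cube-cong f≋g = R.*-cong f≋g (R.*-cong f≋g (R.*-cong f≋g ≋-refl))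

term-num : ∀ k → proj₁ (term k) ≋ (oneₚ +ₚ X^ 1 ^ᴿ (4 ℕ.* k ℕ.+ 1)) *ₚ poch 2 k ^ᴿ 3 *ₚ X^ 1 ^ᴿ k
term-num k = R.*-cong (R.*-cong (R.+-congˡ {oneₚ} (X^≋ (4 ℕ.* k ℕ.+ 1))) (cube-cong (qPoch≋ 2 k))) (X^≋ k)

term-den : ∀ k → proj₂ (term k) ≋ (oneₚ +ₚ X^ 1) *ₚ poch 4 k ^ᴿ 3
term-den k = R.*-congˡ {oneₚ +ₚ X^ 1} (cube-cong (qPoch≋ 4 k))

term≉0 : ∀ k → ¬ proj₂ (term k) ≋ []
term≉0 k = *-nonzero {oneₚ +ₚ X^ 1} (λ eq → contradiction (coeff-≡ eq 0) λ ()) (*-nonzero p (*-nonzero p (*-nonzero p oneₚ≉0)))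
  where
  p : ¬ qPoch 4 4 k ≋ []
  p = qPoch≉0 4 k ℕ.z<s

sumTo≉0 : ∀ t → (∀ k → ¬ proj₂ (t k) ≋ []) → ∀ m → ¬ proj₂ (sumTo m t) ≋ []
sumTo≉0 t t≉0 zero    = t≉0 0
sumTo≉0 t t≉0 (suc m) = *-nonzero (sumTo≉0 t t≉0 m) (t≉0 (suc m))

t-fraction : ∀ k → S.t K.1# k K.≈ toFraction (term k) (term≉0 k)
t-fraction k = toFraction-unique (term k) (term≉0 k)
  (K.trans (K.*-congˡ {S.t K.1# k} (Fr.ι-cong (term-den k)))
    (K.trans (At1.t-cleared k) (Fr.ι-cong (R.sym (term-num k)))))

sum-fraction : ∀ m → ∑≤ m (S.t K.1#) K.≈ toFraction (sumTo m term) (sumTo≉0 term term≉0 m)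
sum-fraction zero    = t-fraction 0
-- `_+ᵣ_` and the addition of fractions form the same numerator and the same denominator.
sum-fraction (suc m) = K.trans (K.+-cong (sum-fraction m) (t-fraction (suc m))) (cross R.refl)

rhs≉0 : ∀ N m → ¬ proj₂ (rhs N m) ≋ []
rhs≉0 N m = *-nonzero {qPoch 5 4 m} (qPoch≉0 5 m ℕ.z<s) (λ eq → q^≉0 m (R.trans (R.sym (X^≋ m)) eq))

qInt2-geometric : ∀ N → qInt2 N *ₚ (oneₚ -ₚ X^ 1 ^ᴿ 2) ≋ oneₚ -ₚ X^ 1 ^ᴿ (2 ℕ.* N)
qInt2-geometric zero = R.sym (R.-‿inverseʳ oneₚ)
qInt2-geometric (suc N) = begin
  (qInt2 N +ₚ X^ (2 ℕ.* N)) *ₚ (oneₚ -ₚ q ^ᴿ 2)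
    ≈⟨ R.distribʳ _ (qInt2 N) (X^ (2 ℕ.* N)) ⟩
  qInt2 N *ₚ (oneₚ -ₚ q ^ᴿ 2) +ₚ X^ (2 ℕ.* N) *ₚ (oneₚ -ₚ q ^ᴿ 2)
    ≈⟨ R.+-cong (qInt2-geometric N) (R.*-congʳ {oneₚ -ₚ q ^ᴿ 2} (X^≋ (2 ℕ.* N))) ⟩
  (oneₚ -ₚ q ^ᴿ (2 ℕ.* N)) +ₚ q ^ᴿ (2 ℕ.* N) *ₚ (oneₚ -ₚ q ^ᴿ 2)
    ≈⟨ solve 2 (λ x y → (con (+ 1) :- y) :+ y :* (con (+ 1) :- x) := con (+ 1) :- x :* y) R.refl (q ^ᴿ 2) (q ^ᴿ (2 ℕ.* N)) ⟩
  oneₚ -ₚ q ^ᴿ 2 *ₚ q ^ᴿ (2 ℕ.* N)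
    ≈⟨ R.+-congˡ {oneₚ} (R.-‿cong (^-homo-* q 2 (2 ℕ.* N))) ⟨
  oneₚ -ₚ q ^ᴿ (2 ℕ.+ 2 ℕ.* N)
    ≡⟨ cong (λ k → oneₚ -ₚ q ^ᴿ k) (ℕ.*-suc 2 N) ⟨
  oneₚ -ₚ q ^ᴿ (2 ℕ.* suc N) ∎
  where
  q = X^ 1
  open SetoidReasoning R.setoid
  open IntegerCoefficients ℤ[q]
  open import Algebra.Properties.Semiring.Exp R.semiring using (^-homo-*)

rhs-fraction : ∀ m → Fraction
rhs-fraction m = toFraction (rhs (suc (2 ℕ.* m)) m) (rhs≉0 (suc (2 ℕ.* m)) m)

-- Given the shape shared by `AtPower.sum-cleared` and the hypothesis of `closed-form-Div`, so that
-- both the comparison at Φ_N and the counting at Φ_d apply to the right-hand side.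
rhs-cleared : ∀ m → rhs-fraction m K.* ι (poch 5 m *ₚ X^ 1 ^ᴿ m *ₚ (oneₚ -ₚ X^ 1 ^ᴿ 2))
                    K.≈ ι ((oneₚ -ₚ X^ 1 ^ᴿ (2 ℕ.+ 4 ℕ.* m)) *ₚ poch 3 m)
rhs-cleared m = cross (begin
  qInt2 N *ₚ qPoch 3 4 m *ₚ (poch 5 m *ₚ q ^ᴿ m *ₚ (oneₚ -ₚ q ^ᴿ 2)) *ₚ oneₚ
    ≈⟨ solve 4 (λ a b c e → a :* b :* (c :* e) :* con (+ 1) := (a :* e) :* b :* (c :* con (+ 1))) R.refl
         (qInt2 N) (qPoch 3 4 m) (poch 5 m *ₚ q ^ᴿ m) (oneₚ -ₚ q ^ᴿ 2) ⟩
  qInt2 N *ₚ (oneₚ -ₚ q ^ᴿ 2) *ₚ qPoch 3 4 m *ₚ (poch 5 m *ₚ q ^ᴿ m *ₚ oneₚ)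
    ≈⟨ R.*-cong (R.*-cong (qInt2-geometric N) (qPoch≋ 3 m)) (R.*-congʳ {oneₚ} (R.sym (R.*-cong (qPoch≋ 5 m) (X^≋ m)))) ⟩
  (oneₚ -ₚ q ^ᴿ (2 ℕ.* N)) *ₚ poch 3 m *ₚ (qPoch 5 4 m *ₚ X^ m *ₚ oneₚ)
    ≡⟨ cong (λ k → (oneₚ -ₚ q ^ᴿ k) *ₚ poch 3 m *ₚ (qPoch 5 4 m *ₚ X^ m *ₚ oneₚ)) (2N≡ m) ⟩
  (oneₚ -ₚ q ^ᴿ (2 ℕ.+ 4 ℕ.* m)) *ₚ poch 3 m *ₚ (qPoch 5 4 m *ₚ X^ m *ₚ oneₚ) ∎)
  where
  q = X^ 1
  N = suc (2 ℕ.* m)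
  open SetoidReasoning R.setoid
  open IntegerCoefficients ℤ[q]
  2N≡ : ∀ m → 2 ℕ.* suc (2 ℕ.* m) ≡ 2 ℕ.+ 4 ℕ.* m
  2N≡ = solve-∀

closed-form≈rhs : ∀ m → ∑≤ m (S.t (ι (X^ 1 ^ᴿ (2 ℕ.+ 4 ℕ.* m)))) K.≈ rhs-fraction m
closed-form≈rhs m = H.cancelʳ {d = ι (poch 5 m *ₚ X^ 1 ^ᴿ m *ₚ (oneₚ -ₚ X^ 1 ^ᴿ 2))}
  (ι≉0 {poch 5 m *ₚ X^ 1 ^ᴿ m *ₚ (oneₚ -ₚ X^ 1 ^ᴿ 2)}
    (*-nonzero {poch 5 m *ₚ X^ 1 ^ᴿ m} (*-nonzero {poch 5 m} (poch≉0 5 m ℕ.z<s) (q^≉0 m)) (1-qˡ≉0 2 ℕ.z<s)))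
  (K.trans (AtPower.sum-cleared m) (K.sym (rhs-cleared m)))

allCyclotomic : ∀ d e → 0 ℕ.< e → e ℕ.≤ d → IsCyclotomic e
allCyclotomic d e e>0 _ = cyclotomic e e>0

module AtΦ (g : ℕ) (g>0 : 0 ℕ.< g) where
  private
    d = suc (2 ℕ.* g)
    d>0 : 0 ℕ.< d
    d>0 = ℕ.s≤s ℕ.z≤n
  open AtPrime (Φ d) public

  private
    open import Data.Nat.Divisibility using (_∣_)

    Φ-val : ∀ {l} → 0 ℕ.< l → d ∣ l → Val (PowersMinusOne.w (X^ 1) l) 1
    Φ-val l>0 d∣l = let v , v⊥ , eq = w-multiple d>0 (allCyclotomic d) l>0 d∣l in
      val v v⊥ (R.trans eq (R.*-congʳ {v} (R.sym (R.*-identityʳ (Φ d)))))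

  open AtCyclotomic g g>0 (Φ d) (q⊥φ d>0 (cyclotomic d d>0))
    (λ l → w⊥φ d>0 (allCyclotomic d))
    (λ l → Φ-val)
    public

Multiple² : ℕ → Fraction → Set
Multiple² d = Multiple (Φ d ^ₚ 2)

difference half-difference : ℕ → Fraction
half-difference m = ∑≤ m (S.t K.1#) K.- rhs-fraction m
difference m = ∑≤ (2 ℕ.* m) (S.t K.1#) K.- rhs-fraction m

half-difference-top : ∀ m → 0 ℕ.< m → Multiple² (suc (2 ℕ.* m)) (half-difference m)
half-difference-top m m>0 = Div⇒Multiple (Div-resp {2} {S₁ m K.- Sₐ} {half-difference m}
    (K.+-congˡ {S₁ m} {K.- Sₐ} {K.- rhs-fraction m} (K.-‿cong {Sₐ} {rhs-fraction m} (closed-form≈rhs m))) S₁-closed-form)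
  where
  open AtΦ m m>0
  Sₐ = ∑≤ m (S.t (ι (X^ 1 ^ᴿ (2 ℕ.+ 4 ℕ.* m))))

-- For d = N the extra summands m < k ≤ 2m all have k mod d > (d - 1)/2, so they form a single tail.
difference-top : ∀ m → 0 ℕ.< m → Multiple² (suc (2 ℕ.* m)) (difference m)
difference-top m m>0 = Div⇒Multiple (Div-resp telescope (Div-+ (tail 0 m ℕ.≤-refl) S₁-closed-form))
  where
  open AtΦ m m>0
  open IntegerCoefficients ℚ[q]
  Sₐ = ∑≤ m (S.t (ι (X^ 1 ^ᴿ (2 ℕ.+ 4 ℕ.* m))))
  telescope : (S₁ (m ℕ.+ m) K.- S₁ m) K.+ (S₁ m K.- Sₐ) K.≈ difference m
  telescope = K.trans (solve 3 (λ a b c → (a :- b) :+ (b :- c) := a :- c) K.refl (S₁ (m ℕ.+ m)) (S₁ m) Sₐ)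
    (K.+-cong (K.reflexive (cong (λ k → S₁ (m ℕ.+ k)) (≡.sym (ℕ.+-identityʳ m)))) (K.-‿cong (closed-form≈rhs m)))

module _ (h μ : ℕ) where
  private
    g = suc (2 ℕ.* h)
    d = suc (2 ℕ.* g)
    m = μ ℕ.* d ℕ.+ g
    g>0 : 0 ℕ.< g
    g>0 = ℕ.s≤s ℕ.z≤n
    open AtΦ g g>0
    open Congruent3Mod4 h ≡.refl

    rhs-Div : Div 2 (rhs-fraction m)
    rhs-Div = closed-form-Div μ (rhs-cleared m)

  half-difference-lower : Multiple² d (half-difference m)
  half-difference-lower = Div⇒Multiple (Div-- (S₁-Div μ) rhs-Div)

  -- Here 2m = 2μd + 2g. Cutting at 2μd + g drops a tail of g summands and leaves a truncation of
  -- the required shape, with 2μ in place of μ.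
  difference-lower : Multiple² d (difference m)
  difference-lower = Div⇒Multiple (Div-- (Div-resp telescope (Div-+ (tail (2 ℕ.* μ) g ℕ.≤-refl) (S₁-Div (2 ℕ.* μ)))) rhs-Div)
    where
    open IntegerCoefficients ℚ[q]
    lem : ∀ μ d g → 2 ℕ.* μ ℕ.* d ℕ.+ g ℕ.+ g ≡ 2 ℕ.* (μ ℕ.* d ℕ.+ g)
    lem = solve-∀
    telescope : (S₁ (2 ℕ.* μ ℕ.* d ℕ.+ g ℕ.+ g) K.- S₁ (2 ℕ.* μ ℕ.* d ℕ.+ g)) K.+ S₁ (2 ℕ.* μ ℕ.* d ℕ.+ g)
                K.≈ S₁ (2 ℕ.* m)
    telescope = K.trans (solve 2 (λ a b → (a :- b) :+ b := a) K.refl (S₁ (2 ℕ.* μ ℕ.* d ℕ.+ g ℕ.+ g)) (S₁ (2 ℕ.* μ ℕ.* d ℕ.+ g)))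
      (K.reflexive (cong S₁ (lem μ d g)))

Φ⊥Φ : ∀ {e d} → 0 ℕ.< e → e ℕ.< d → Φ e ⊥ Φ d
Φ⊥Φ {e} {d} e>0 e<d = φ⊥φ e>0 e<d (allCyclotomic d)

-- The full modulus as a product of pairwise coprime squares

module _ (n : ℕ) (n>1 : 1 ℕ.< n) where

  private
    f : ℕ → Poly
    f j = Φ (n ^ (2 ℕ.* j ℕ.∸ 1)) ^ₚ 2

    Φ^⊥Φ^ : ∀ {i j} → i ℕ.< j → Φ (n ^ i) ⊥ Φ (n ^ j)
    Φ^⊥Φ^ {i} {j} i<j = Φ⊥Φ (ℕ.m^n>0 n {{ℕ.>-nonZero (ℕ.<-trans ℕ.z<s n>1)}} i) (ℕ.^-monoʳ-< n n>1 i<j)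

  -- The exponents 2j - 1 with j ≤ r stay below e, and n > 1 keeps the corresponding powers of n
  -- distinct.
  prodFrom1⊥ : ∀ r e → 2 ℕ.* r ℕ.≤ e → prodFrom1 r f ⊥ Φ (n ^ e) ^ₚ 2
  prodFrom1⊥ zero    e _    = 1⊥
  prodFrom1⊥ (suc r) e 2r≤e = *⊥ (prodFrom1⊥ r e (ℕ.≤-trans (ℕ.*-monoʳ-≤ 2 (ℕ.n≤1+n r)) 2r≤e))
    (⊥-sym (⊥-power 2 (⊥-sym (⊥-power 2 (Φ^⊥Φ^ 2r∸1<e)))))
    where
    2r∸1<e : 2 ℕ.* suc r ℕ.∸ 1 ℕ.< e
    2r∸1<e = 2r≤e

  prodFrom1-multiple : ∀ x r → (∀ k → k ℕ.< r → Multiple² (n ^ suc (2 ℕ.* k)) x) → Multiple (prodFrom1 r f) x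
  prodFrom1-multiple x zero    _        = Fraction.num x , Fraction.den x , ⊥-sym 1⊥ ,
    K.trans (fraction-num x) (Fr.ι-cong (R.sym (R.*-identityˡ (Fraction.num x))))
  prodFrom1-multiple x (suc r) multiple = multiple-* {prodFrom1 r f} {f (suc r)} {x} (prodFrom1⊥ r (2 ℕ.* suc r ℕ.∸ 1) 2r≤)
    (prodFrom1-multiple x r (λ k k<r → multiple k (ℕ.m≤n⇒m≤1+n k<r)))
    (≡.subst (λ e → Multiple² (n ^ e) x) (≡.sym 2[1+r]∸1) (multiple r (ℕ.n<1+n r)))
    where
    2[1+r]∸1 : 2 ℕ.* suc r ℕ.∸ 1 ≡ suc (2 ℕ.* r)
    2[1+r]∸1 = cong (ℕ._∸ 1) (ℕ.*-suc 2 r)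
    2r≤ : 2 ℕ.* r ℕ.≤ 2 ℕ.* suc r ℕ.∸ 1
    2r≤ = ℕ.≤-trans (ℕ.n≤1+n _) (ℕ.≤-reflexive (≡.sym 2[1+r]∸1))

  modulus-multiple : ∀ x r → Multiple² (n ^ (2 ℕ.* r)) x → (∀ k → k ℕ.< r → Multiple² (n ^ suc (2 ℕ.* k)) x) →
    Multiple (Φ (n ^ (2 ℕ.* r)) ^ₚ 2 *ₚ prodFrom1 r f) x
  modulus-multiple x r top lower =
    multiple-* {Φ (n ^ (2 ℕ.* r)) ^ₚ 2} {prodFrom1 r f} {x} (⊥-sym {prodFrom1 r f} (prodFrom1⊥ r (2 ℕ.* r) ℕ.≤-refl)) top (prodFrom1-multiple x r lower)

-- 4a + 3 and 4a + 1, in the form in which half of the predecessor is visible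
[3+4_] [1+4_] : ℕ → ℕ
[3+4 a ] = suc (2 ℕ.* suc (2 ℕ.* a))
[1+4 a ] = suc (2 ℕ.* (2 ℕ.* a))

even-power : ∀ a t → ∃[ b ] [3+4 a ] ^ (2 ℕ.* t) ≡ [1+4 b ]
even-power a zero = 0 , ≡.refl
even-power a (suc t) = let b , eq = even-power a t in
  -- From (4a + 3)² = 4(4a² + 6a + 2) + 1.
  (4 ℕ.* a ℕ.* a ℕ.+ 6 ℕ.* a ℕ.+ 2) ℕ.* [1+4 b ] ℕ.+ b ,
  ≡.trans (cong ([3+4 a ] ^_) (ℕ.*-suc 2 t)) (≡.trans (cong (λ y → [3+4 a ] ℕ.* ([3+4 a ] ℕ.* y)) eq) (lem a b))
  where
  lem : ∀ a b → suc (2 ℕ.* suc (2 ℕ.* a)) ℕ.* (suc (2 ℕ.* suc (2 ℕ.* a)) ℕ.* suc (2 ℕ.* (2 ℕ.* b)))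
        ≡ suc (2 ℕ.* (2 ℕ.* ((4 ℕ.* a ℕ.* a ℕ.+ 6 ℕ.* a ℕ.+ 2) ℕ.* suc (2 ℕ.* (2 ℕ.* b)) ℕ.+ b)))
  lem = solve-∀

odd-power : ∀ a t → ∃[ h ] [3+4 a ] ^ suc (2 ℕ.* t) ≡ [3+4 h ]
odd-power a t = let b , eq = even-power a t in
  a ℕ.+ [3+4 a ] ℕ.* b , ≡.trans (cong ([3+4 a ] ℕ.*_) eq) (lem a b)
  where
  lem : ∀ a b → suc (2 ℕ.* suc (2 ℕ.* a)) ℕ.* suc (2 ℕ.* (2 ℕ.* b))
        ≡ suc (2 ℕ.* suc (2 ℕ.* (a ℕ.+ suc (2 ℕ.* suc (2 ℕ.* a)) ℕ.* b)))
  lem = solve-∀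

-- The exponent 2r splits into two odd parts, and the power of n with the complementary exponent is
-- odd, say 2μ + 1. Then 2m + 1 = (2μ + 1)d, which is m = μd + (d - 1)/2.
lower-power : ∀ a r k m → k ℕ.< r → [3+4 a ] ^ (2 ℕ.* r) ≡ suc (2 ℕ.* m) →
  ∃[ h ] ∃[ μ ] ([3+4 a ] ^ suc (2 ℕ.* k) ≡ [3+4 h ] × m ≡ μ ℕ.* [3+4 h ] ℕ.+ suc (2 ℕ.* h))
lower-power a r k m k<r N≡ = h , suc (2 ℕ.* h′) , d≡ , ℕ.*-cancelˡ-≡ _ _ 2 (ℕ.suc-injective (
  ≡.trans (≡.sym N≡) (≡.trans (cong ([3+4 a ] ^_) exponent) (≡.trans (ℕ.^-distribˡ-+-* [3+4 a ] (suc (2 ℕ.* t)) (suc (2 ℕ.* k)))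
    (≡.trans (≡.cong₂ ℕ._*_ T≡ d≡) (lem h′ h))))))
  where
  t = r ℕ.∸ suc k
  h = proj₁ (odd-power a k)
  d≡ = proj₂ (odd-power a k)
  h′ = proj₁ (odd-power a t)
  T≡ = proj₂ (odd-power a t)
  exponent : 2 ℕ.* r ≡ suc (2 ℕ.* t) ℕ.+ suc (2 ℕ.* k)
  exponent = ≡.trans (cong (2 ℕ.*_) (≡.sym (ℕ.m∸n+n≡m k<r))) (lem′ t k)
    where
    lem′ : ∀ t k → 2 ℕ.* (t ℕ.+ suc k) ≡ suc (2 ℕ.* t) ℕ.+ suc (2 ℕ.* k)
    lem′ = solve-∀
  lem : ∀ h′ h → suc (2 ℕ.* suc (2 ℕ.* h′)) ℕ.* suc (2 ℕ.* suc (2 ℕ.* h))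
        ≡ suc (2 ℕ.* (suc (2 ℕ.* h′) ℕ.* suc (2 ℕ.* suc (2 ℕ.* h)) ℕ.+ suc (2 ℕ.* h)))
  lem = solve-∀

Modulus : ℕ → ℕ → Poly
Modulus n r = Φ (n ^ (2 ℕ.* r)) ^ₚ 2 *ₚ prodFrom1 r (λ j → Φ (n ^ (2 ℕ.* j ℕ.∸ 1)) ^ₚ 2)

congruences : ∀ a r m → 0 ℕ.< m → [3+4 a ] ^ (2 ℕ.* r) ≡ suc (2 ℕ.* m) →
  (sumTo m term ≡ rhs (suc (2 ℕ.* m)) m [modₚ Modulus [3+4 a ] r ])
  × (sumTo (2 ℕ.* m) term ≡ rhs (suc (2 ℕ.* m)) m [modₚ Modulus [3+4 a ] r ])
congruences a r m m>0 N≡ =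
    congruence m (half-difference m) K.refl
      (half-difference-top m m>0) (λ h μ m≡ → ≡.subst (λ m → Multiple² [3+4 h ] (half-difference m)) (≡.sym m≡) (half-difference-lower h μ))
  , congruence (2 ℕ.* m) (difference m) K.refl
      (difference-top m m>0) (λ h μ m≡ → ≡.subst (λ m → Multiple² [3+4 h ] (difference m)) (≡.sym m≡) (difference-lower h μ))
  where
  n = [3+4 a ]
  n>1 : 1 ℕ.< n
  n>1 = ℕ.s≤s ℕ.z<s
  congruence : ∀ M x → x K.≈ ∑≤ M (S.t K.1#) K.- rhs-fraction m →
    Multiple² (suc (2 ℕ.* m)) x → (∀ h μ → m ≡ μ ℕ.* [3+4 h ] ℕ.+ suc (2 ℕ.* h) → Multiple² [3+4 h ] x) →
    sumTo M term ≡ rhs (suc (2 ℕ.* m)) m [modₚ Modulus n r ]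
  congruence M x x≈ top lower = Multiple⇒≡modₚ (sumTo M term) (rhs (suc (2 ℕ.* m)) m) (sumTo≉0 term term≉0 M) (rhs≉0 (suc (2 ℕ.* m)) m)
    (Multiple-resp (K.trans x≈ (K.+-congʳ {K.- rhs-fraction m} (sum-fraction M)))
      (modulus-multiple n n>1 x r (≡.subst (λ N → Multiple² N x) (≡.sym N≡) top)
        λ k k<r → let h , μ , d≡ , m≡ = lower-power a r k m k<r N≡ in
          ≡.subst (λ d → Multiple² d x) (≡.sym d≡) (lower h μ m≡)))
    where
    Multiple-resp : ∀ {P x y} → x K.≈ y → Multiple P x → Multiple P y
    Multiple-resp {x = x} {y} x≈y (u , v , v⊥ , eq) = u , v , v⊥ , K.trans (K.*-congʳ {ι v} {y} {x} (K.sym x≈y)) eq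

theorem4p1 : (n r : ℕ) → 0 < n → 0 < r → n % 4 ≡ 3 →
  (sumTo ((n ^ (2 * r) ∸ 1) / 2) term
     ≡ rhs (n ^ (2 * r)) ((n ^ (2 * r) ∸ 1) / 2)
     [modₚ (Φ (n ^ (2 * r)) ^ₚ 2) *ₚ prodFrom1 r (λ j → Φ (n ^ (2 * j ∸ 1)) ^ₚ 2) ])
  × (sumTo (n ^ (2 * r) ∸ 1) term
     ≡ rhs (n ^ (2 * r)) ((n ^ (2 * r) ∸ 1) / 2)
     [modₚ (Φ (n ^ (2 * r)) ^ₚ 2) *ₚ prodFrom1 r (λ j → Φ (n ^ (2 * j ∸ 1)) ^ₚ 2) ])
theorem4p1 n r _ r>0 n%4≡3 =
  ≡.subst (λ N → Congruences n N ((N ℕ.∸ 1) / 2) (N ℕ.∸ 1)) (≡.sym N≡)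
    (≡.subst (λ k → Congruences n (suc (2 ℕ.* m)) k (2 ℕ.* m)) (≡.sym half)
      (≡.subst (λ n → Congruences n (suc (2 ℕ.* m)) m (2 ℕ.* m)) (≡.sym n≡) (congruences a r m m>0 [3+4a]^≡)))
  where
  Congruences : ℕ → ℕ → ℕ → ℕ → Set
  Congruences n N k M = (sumTo k term ≡ rhs N k [modₚ Modulus n r ]) × (sumTo M term ≡ rhs N k [modₚ Modulus n r ])
  a = n / 4
  n≡ : n ≡ [3+4 a ]
  n≡ = ≡.trans (m≡m%n+[m/n]*n n 4) (≡.trans (cong (ℕ._+ a ℕ.* 4) n%4≡3) (lem a))
    where
    lem : ∀ a → 3 ℕ.+ a ℕ.* 4 ≡ suc (2 ℕ.* suc (2 ℕ.* a))
    lem = solve-∀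
  m = 2 ℕ.* proj₁ (even-power a r)
  [3+4a]^≡ : [3+4 a ] ^ (2 ℕ.* r) ≡ suc (2 ℕ.* m)
  [3+4a]^≡ = proj₂ (even-power a r)
  N≡ : n ^ (2 ℕ.* r) ≡ suc (2 ℕ.* m)
  N≡ = ≡.trans (cong (_^ (2 ℕ.* r)) n≡) [3+4a]^≡
  half : 2 ℕ.* m / 2 ≡ m
  half = ≡.trans (cong (_/ 2) (ℕ.*-comm 2 m)) (m*n/n≡m m 2)
  m>0 : 0 ℕ.< m
  m>0 = ℕ.n≢0⇒n>0 λ m≡0 → ℕ.<⇒≢ (ℕ.^-monoʳ-< [3+4 a ] (ℕ.s≤s ℕ.z<s) {0} {2 ℕ.* r} (ℕ.*-monoʳ-< 2 r>0))
    (≡.sym (≡.trans [3+4a]^≡ (cong (λ k → suc (2 ℕ.* k)) m≡0)))
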